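{- For all integers $n\ge 1$ and $k$ with $0\le 2k\le n$, the polynomial $F_{2^k1^{n-2k}}(z)$ is log-concave. In other words, for every involution $\pi\in\mathfrak{S}_n$ (i.e. $\pi^2=\mathrm{id}$, fixed points allowed), the polynomial $F_\pi(z)$ is log-concave.
   Context: For a positive integer $m$, $\mathfrak{S}_m$ is the symmetric group on $\{1,\dots,m\}$, $Q_m\subseteq\mathfrak{S}_m$ is the set of $m$-cycles, and $c(\eta)$ denotes the number of cycles (including fixed points) of a permutation $\eta$. Permutations are multiplied from left to right. For $\pi\in\mathfrak{S}_m$ the IO-polynomial is \[ F_\pi(z)=\sum_{\zeta\in Q_m} z^{\lfloor (c(\zeta\pi)-1)/2\rfloor}. \] A permutation has type $\lambda$ (a partition of $m$) if the multiset of its cycle lengths is $\lambda$; $F_\pi$ depends only on the type of $\pi$, and $F_\lambda:=F_\pi$ for $\pi$ of type $\lambda$. The partition $2^k1^{n-2k}$ has $k$ parts equal to $2$ and $n-2k$ parts equal to $1$. A polynomial $\sum_k a_kz^k$ with nonnegative coefficients is log-concave if $a_k^2\ge a_{k-1}a_{k+1}$ for all $k$. -}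

module Defs where

open import Data.Nat using (ℕ; zero; suc; _≤_; _/_; _∸_; _≟_)
open import Data.Fin using (Fin; toℕ) renaming (zero to fzero)
open import Data.Fin.Properties as FinP using ()
open import Data.List using (List; []; _∷_; map; concatMap; length; filter; upTo; allFin)
open import Data.List.Relation.Unary.All using (All)
open import Data.List.Relation.Unary.All.Properties using ()
open import Data.List.Relation.Unary.AllPairs using (AllPairs)
open import Data.Vec using (Vec; []; _∷_; lookup)
open import Relation.Binary.PropositionalEquality using (_≡_; _≢_)
open import Relation.Nullary using (Dec; ¬_)
open import Relation.Nullary.Decidable using (_×-dec_)
open import Data.Product using (_×_)
open import Relation.Nullary.Decidable using (¬?)
import Data.List.Relation.Unary.All as All
import Data.List.Relation.Unary.AllPairs as AllPairs

Map : ℕ → Set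
Map n = Fin n → Fin n

iter : ∀ {n} → Map n → ℕ → Fin n → Fin n
iter η zero    x = x
iter η (suc j) x = η (iter η j x)

_·_ : ∀ {n} → Map n → Map n → Map n
(ζ · π) x = π (ζ x)

allVecs : (n m : ℕ) → List (Vec (Fin n) m)
allVecs n zero    = [] ∷ []
allVecs n (suc m) = concatMap (λ x → map (x ∷_) (allVecs n m)) (allFin n)

allMaps : (n : ℕ) → List (Map n)
allMaps n = map lookup (allVecs n n)

-- ζ : Fin (suc m) → Fin (suc m) is an (m+1)-cycle iff the orbit
-- 0, ζ 0, ζ² 0, …, ζ^m 0 consists of m+1 pairwise distinct points
-- and ζ^{m+1} 0 = 0
-- (this forces ζ to be a bijection consisting of one single cycle).
IsFullCycle : ∀ {m} → Map (suc m) → Set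
IsFullCycle {m} ζ = AllPairs _≢_ (map (λ i → iter ζ i fzero) (upTo (suc m)))
                  × iter ζ (suc m) fzero ≡ fzero

isFullCycle? : ∀ {m} (ζ : Map (suc m)) → Dec (IsFullCycle ζ)
isFullCycle? {m} ζ = AllPairs.allPairs? (λ x y → ¬? (x FinP.≟ y)) _
                     ×-dec (iter ζ (suc m) fzero FinP.≟ fzero)

IsCycleMin : ∀ {n} → Map n → Fin n → Set
IsCycleMin {n} η x = All (λ j → toℕ x ≤ toℕ (iter η j x)) (upTo n)

isCycleMin? : ∀ {n} (η : Map n) (x : Fin n) → Dec (IsCycleMin η x)
isCycleMin? {n} η x = All.all? (λ j → toℕ x Data.Nat.≤? toℕ (iter η j x)) (upTo n)

-- number of cycles (fixed points included) of a permutation η: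
-- the number of points that are the minimum of their cycle
cycles : ∀ {n} → Map n → ℕ
cycles {n} η = length (filter (isCycleMin? η) (allFin n))

expo : ∀ {n} → Map n → Map n → ℕ
expo ζ π = (cycles (ζ · π) ∸ 1) / 2

fullCycles : (m : ℕ) → List (Map (suc m))
fullCycles m = filter isFullCycle? (allMaps (suc m))

-- coefficient of z^j in F_π(z) = Σ_{ζ ∈ Q_n} z^{⌊(c(ζπ)-1)/2⌋}
F-coeff : ∀ {m} → Map (suc m) → ℕ → ℕ
F-coeff {m} π j = length (filter (λ ζ → expo ζ π ≟ j) (fullCycles m))

-- log-concavity of a coefficient sequence a : ℕ → ℕ (a_{-1} = 0, so only
-- k ≥ 1 is nontrivial): a_k² ≥ a_{k-1} a_{k+1}
LogConcave : (ℕ → ℕ) → Set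
LogConcave a = ∀ k → a k Data.Nat.* a (suc (suc k)) ≤ a (suc k) Data.Nat.* a (suc k)

{-# OPTIONS --safe #-}
module Submission where

-- For q colours, q^c(ζπ) counts the colourings f with f(π(ζ x)) = f(x).  For
-- fixed f these ζ are the Eulerian tours of the digraph whose edges are
-- f(π x) → f(x).  Let P_π(q) = Σ_ζ q^c(ζπ), let π fix a ≠ b, let π′ = (a b) π,
-- and let B(q) count the pairs (ζ , f) for π with f(a) = f(b).
--   * Exactly one of ζπ, ζπ′ has a and b on one cycle, so
--     P_π′(q) + P_π(q) = (q + 1) B(q).
--   * Passing from π to π′ replaces two loops at u = f(a) and v = f(b) by two
--     opposite edges between u and v.  As for spanning trees in the BEST theorem,
--     this changes the number of tours by a multiple of the number of tours with
--     u and v identified, and summing over f gives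
--     P_π′(q + 1) = P_π(q + 1) + (q + 1) B(q).
-- Hence P_π′(q + 1) - P_π′(q) = P_π(q + 1) + P_π(q).  For an involution with k
-- transpositions it follows that (k + 1)! P_π is a multiple of w_k, where
-- w_(k+2) = 2 q w_(k+1) + (k + 2) (k + 1) w_k; this is the Harer–Zagier
-- recurrence.  The coefficients of w_k and w_(k+1) interlace, which propagates
-- log-concavity along the recurrence.

open import Defs
open import Algebra.Definitions using (Involutive)
open import Data.Bool using (Bool; true; false; if_then_else_)
open import Data.Fin using (Fin; zero; suc; toℕ; punchIn; punchOut)
open import Data.Fin.Permutation.Components using (transpose)
import Data.Fin.Properties as FinP
open import Data.Fin.Properties using (_≟_; all?; toℕ-injective; pigeonhole; toℕ≤pred[n]; punchIn-injective; punchInᵢ≢i; punchIn-punchOut; punchOut-injective; punchOut-punchIn; punchOut-cong)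
open import Data.List using (List; []; _∷_; _++_; map; concatMap; filter; length; allFin; upTo; applyUpTo; replicate; tabulate)
import Data.List as List
open import Data.List.Membership.Propositional using (_∈_; _∉_; find; lose)
open import Data.List.Membership.Propositional.Properties using (∈-map⁺; ∈-map⁻; ∈-concatMap⁺; ∈-concatMap⁻; ∈-filter⁺; ∈-filter⁻; ∈-allFin; ∈-upTo⁺; ∈-∃++; ∈-lookup)
open import Data.List.Membership.Propositional.Properties.WithK using (unique∧set⇒bag)
open import Data.List.Properties using (map-++; map-cong; map-∘; length-map; length-filter; map-tabulate; tabulate-cong; length-tabulate; map-applyUpTo; ∷-injectiveˡ; ∷-injectiveʳ)
open import Data.List.Relation.Binary.BagAndSetEquality using (∼bag⇒↭)
open import Data.List.Relation.Binary.Permutation.Propositional using (_↭_; prep; swap; ↭-refl; ↭-sym; ↭-trans)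
import Data.List.Relation.Binary.Permutation.Propositional as ↭
import Data.List.Relation.Binary.Permutation.Propositional.Properties as Perm
import Data.List.Relation.Binary.Permutation.Setoid.Properties as SetoidPerm
open import Data.List.Relation.Unary.All using (All; []; _∷_)
import Data.List.Relation.Unary.All as All
open import Data.List.Relation.Unary.All.Properties using (¬All⇒Any¬; replicate⁺)
open import Data.List.Relation.Unary.AllPairs using ([]; _∷_)
open import Data.List.Relation.Unary.Any using (here; there; index)
import Data.List.Relation.Unary.Any as Any
open import Data.List.Relation.Unary.Any.Properties using (lookup-index)
open import Data.List.Relation.Unary.Unique.Propositional using (Unique)
import Data.List.Relation.Unary.Unique.Propositional.Properties as Uniq
open import Data.Nat using (ℕ; zero; suc; _+_; _*_; _^_; _∸_; _/_; _%_; _!; _≤_; _<_; z≤n; s≤s; NonZero)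
import Data.Nat as ℕ
open import Data.Nat.DivMod using (m≡m%n+[m/n]*n; m%n<n; [m+kn]%n≡m%n; m<n⇒m%n≡m; m/n≡1+[m∸n]/n)
open import Data.Nat.Induction using (<-wellFounded)
open import Data.Nat.ListAction using (sum)
open import Data.Nat.ListAction.Properties using (sum-++; sum-↭)
open import Data.Nat.Properties hiding (_≟_)
open import Algebra.Properties.CommutativeSemigroup +-commutativeSemigroup using () renaming (interchange to +-interchange; x∙yz≈y∙xz to x+yz≡y+xz)
open import Algebra.Properties.CommutativeSemigroup *-commutativeSemigroup using () renaming (interchange to *-interchange; x∙yz≈y∙xz to x*yz≡y*xz)
open import Data.Nat.Tactic.RingSolver using (solve-∀)
open import Data.Product using (∃; _×_; _,_; proj₁; proj₂)
open import Data.Sum using (_⊎_; inj₁; inj₂)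
open import Data.Vec using (Vec; []; _∷_; lookup; _[_]≔_; insertAt)
import Data.Vec as Vec
import Data.Vec.Properties as VecP
open import Function using (_∘_; id; mk⇔; _⇔_; case_of_)
open import Function.Definitions using (Injective)
open import Induction.WellFounded using (Acc; acc)
open import Relation.Binary.Definitions using (DecidableEquality; _Respects_)
open import Relation.Binary.PropositionalEquality
open import Relation.Nullary using (Dec; does; yes; no; ¬_; contradiction)
open import Relation.Nullary.Decidable using (_×-dec_; _⊎-dec_; does-⇔; dec-true; dec-false)
open import Relation.Unary using (Decidable)
open ≡-Reasoning

private variable
  A B : Set
  P Q : Set
  k m n p q : ℕ

-- Finite sums

∑ : List A → (A → ℕ) → ℕ
∑ xs φ = sum (map φ xs)

syntax ∑ xs (λ x → e) = ∑[ x ∈ xs ] e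
infix 5 ∑

𝟙 : Dec P → ℕ
𝟙 p? = if does p? then 1 else 0

𝟙-true : (p? : Dec P) → P → 𝟙 p? ≡ 1
𝟙-true p? p = cong (if_then 1 else 0) (dec-true p? p)

𝟙-false : (p? : Dec P) → ¬ P → 𝟙 p? ≡ 0
𝟙-false p? ¬p = cong (if_then 1 else 0) (dec-false p? ¬p)

𝟙-≟-refl : (x : Fin n) → 𝟙 (x ≟ x) ≡ 1
𝟙-≟-refl x = 𝟙-true (x ≟ x) refl

𝟙-⇔ : P ⇔ Q → (p? : Dec P) (q? : Dec Q) → 𝟙 p? ≡ 𝟙 q?
𝟙-⇔ P⇔Q p? q? = cong (if_then 1 else 0) (does-⇔ P⇔Q p? q?)

𝟙-×-dec : (p? : Dec P) (q? : Dec Q) → 𝟙 (p? ×-dec q?) ≡ 𝟙 p? * 𝟙 q?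
𝟙-×-dec (yes _) q? = sym (*-identityˡ (𝟙 q?))
𝟙-×-dec (no _)  q? = refl

𝟙-*-cong : (p? : Dec P) {a b : ℕ} → (P → a ≡ b) → 𝟙 p? * a ≡ 𝟙 p? * b
𝟙-*-cong (yes p) a≡b = cong (1 *_) (a≡b p)
𝟙-*-cong (no _)  a≡b = refl

∑-cong-∈ : (xs : List A) {φ ψ : A → ℕ} → (∀ {x} → x ∈ xs → φ x ≡ ψ x) → ∑ xs φ ≡ ∑ xs ψ
∑-cong-∈ []       φ≡ψ = refl
∑-cong-∈ (x ∷ xs) φ≡ψ = cong₂ _+_ (φ≡ψ (here refl)) (∑-cong-∈ xs (φ≡ψ ∘ there))

∑-cong : (xs : List A) {φ ψ : A → ℕ} → φ ≗ ψ → ∑ xs φ ≡ ∑ xs ψ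
∑-cong xs φ≗ψ = cong sum (map-cong φ≗ψ xs)

∑-++ : (xs ys : List A) (φ : A → ℕ) → ∑ (xs ++ ys) φ ≡ ∑ xs φ + ∑ ys φ
∑-++ xs ys φ = trans (cong sum (map-++ φ xs ys)) (sum-++ (map φ xs) (map φ ys))

∑-↭ : (φ : A → ℕ) {xs ys : List A} → xs ↭ ys → ∑ xs φ ≡ ∑ ys φ
∑-↭ φ xs↭ys = sum-↭ (Perm.map⁺ φ xs↭ys)

∑-map : (f : A → B) (xs : List A) (φ : B → ℕ) → ∑ (map f xs) φ ≡ ∑ xs (φ ∘ f)
∑-map f xs φ = cong sum (sym (map-∘ xs))

∑-tabulate : (f : Fin n → A) (φ : A → ℕ) → ∑ (tabulate f) φ ≡ ∑ (allFin n) (φ ∘ f)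
∑-tabulate f φ = trans (cong (λ xs → ∑ xs φ) (sym (map-tabulate id f))) (∑-map f (allFin _) φ)

∑-concatMap : (f : A → List B) (xs : List A) (φ : B → ℕ) →
  ∑ (concatMap f xs) φ ≡ ∑[ x ∈ xs ] ∑ (f x) φ
∑-concatMap f []       φ = refl
∑-concatMap f (x ∷ xs) φ =
  trans (∑-++ (f x) (concatMap f xs) φ) (cong (∑ (f x) φ +_) (∑-concatMap f xs φ))

∑-+ : (xs : List A) (φ ψ : A → ℕ) → ∑[ x ∈ xs ] (φ x + ψ x) ≡ ∑ xs φ + ∑ xs ψ
∑-+ []       φ ψ = refl
∑-+ (x ∷ xs) φ ψ =
  trans (cong (φ x + ψ x +_) (∑-+ xs φ ψ)) (+-interchange (φ x) (ψ x) (∑ xs φ) (∑ xs ψ))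

∑-*ˡ : (c : ℕ) (xs : List A) (φ : A → ℕ) → ∑[ x ∈ xs ] (c * φ x) ≡ c * ∑ xs φ
∑-*ˡ c []       φ = sym (*-zeroʳ c)
∑-*ˡ c (x ∷ xs) φ =
  trans (cong (c * φ x +_) (∑-*ˡ c xs φ)) (sym (*-distribˡ-+ c (φ x) (∑ xs φ)))

∑-*ʳ : (c : ℕ) (xs : List A) (φ : A → ℕ) → ∑[ x ∈ xs ] (φ x * c) ≡ ∑ xs φ * c
∑-*ʳ c xs φ = begin
  ∑[ x ∈ xs ] (φ x * c)  ≡⟨ ∑-cong xs (λ x → *-comm (φ x) c) ⟩
  ∑[ x ∈ xs ] (c * φ x)  ≡⟨ ∑-*ˡ c xs φ ⟩
  c * ∑ xs φ             ≡⟨ *-comm c (∑ xs φ) ⟩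
  ∑ xs φ * c             ∎

∑-const : (xs : List A) (c : ℕ) → ∑[ _ ∈ xs ] c ≡ length xs * c
∑-const []       c = refl
∑-const (x ∷ xs) c = cong (c +_) (∑-const xs c)

∑-replicate : (n : ℕ) (x : A) (φ : A → ℕ) → ∑ (replicate n x) φ ≡ n * φ x
∑-replicate zero    x φ = refl
∑-replicate (suc n) x φ = cong (φ x +_) (∑-replicate n x φ)

∑-zero : (xs : List A) {φ : A → ℕ} → (∀ {x} → x ∈ xs → φ x ≡ 0) → ∑ xs φ ≡ 0
∑-zero xs φ≡0 = trans (∑-cong-∈ xs φ≡0) (trans (∑-const xs 0) (*-zeroʳ (length xs)))

∑-swap : (xs : List A) (ys : List B) (φ : A → B → ℕ) →
  ∑[ x ∈ xs ] ∑[ y ∈ ys ] φ x y ≡ ∑[ y ∈ ys ] ∑[ x ∈ xs ] φ x y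
∑-swap []       ys φ = sym (∑-zero ys (λ _ → refl))
∑-swap (x ∷ xs) ys φ = begin
  ∑ ys (φ x) + (∑[ x ∈ xs ] ∑[ y ∈ ys ] φ x y)  ≡⟨ cong (∑ ys (φ x) +_) (∑-swap xs ys φ) ⟩
  ∑ ys (φ x) + (∑[ y ∈ ys ] ∑[ x ∈ xs ] φ x y)  ≡⟨ ∑-+ ys (φ x) _ ⟨
  ∑[ y ∈ ys ] (φ x y + (∑[ x ∈ xs ] φ x y))     ∎

∑-filter : {P : A → Set} (P? : Decidable P) (xs : List A) (φ : A → ℕ) →
  ∑ (filter P? xs) φ ≡ ∑[ x ∈ xs ] (𝟙 (P? x) * φ x)
∑-filter P? []       φ = refl
∑-filter P? (x ∷ xs) φ with does (P? x)
... | true  = cong₂ _+_ (sym (*-identityˡ (φ x))) (∑-filter P? xs φ)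
... | false = ∑-filter P? xs φ

length-filter-𝟙 : {P : A → Set} (P? : Decidable P) (xs : List A) →
  length (filter P? xs) ≡ ∑[ x ∈ xs ] 𝟙 (P? x)
length-filter-𝟙 P? []       = refl
length-filter-𝟙 P? (x ∷ xs) with does (P? x)
... | true  = cong suc (length-filter-𝟙 P? xs)
... | false = length-filter-𝟙 P? xs

∑-single : {xs : List A} {x : A} (φ : A → ℕ) → Unique xs → x ∈ xs →
  (∀ {y} → y ∈ xs → y ≢ x → φ y ≡ 0) → ∑ xs φ ≡ φ x
∑-single {xs = x ∷ xs} φ (x∉xs ∷ _) (here refl) φ≡0 = trans
  (cong (φ x +_) (∑-zero xs (λ y∈xs → φ≡0 (there y∈xs) (≢-sym (All.lookup x∉xs y∈xs)))))
  (+-identityʳ (φ x))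
∑-single {xs = y ∷ xs} φ (y∉xs ∷ xs!) (there x∈xs) φ≡0 =
  cong₂ _+_ (φ≡0 (here refl) (All.lookup y∉xs x∈xs)) (∑-single φ xs! x∈xs (φ≡0 ∘ there))

∑-𝟙-unique : {P : A → Set} (P? : Decidable P) {xs : List A} {y : A} → Unique xs → y ∈ xs → P y →
  (∀ {x} → P x → x ≡ y) → (φ : A → ℕ) → ∑[ x ∈ xs ] (𝟙 (P? x) * φ x) ≡ φ y
∑-𝟙-unique P? {xs} {y} xs! y∈xs Py P⇒≡y φ = begin
  ∑[ x ∈ xs ] (𝟙 (P? x) * φ x)  ≡⟨ ∑-single _ xs! y∈xs (λ {x} _ x≢y →
                                     cong (_* φ x) (𝟙-false (P? x) (x≢y ∘ P⇒≡y))) ⟩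
  𝟙 (P? y) * φ y                ≡⟨ cong (_* φ y) (𝟙-true (P? y) Py) ⟩
  1 * φ y                       ≡⟨ *-identityˡ (φ y) ⟩
  φ y                           ∎

fibre : DecidableEquality B → (A → B) → List A → B → List A
fibre _≟_ f xs y = filter (λ x → y ≟ f x) xs

∑-fibres : (_≟_ : DecidableEquality B) (f : A → B) (xs : List A) {ys : List B} →
  Unique ys → (∀ x → f x ∈ ys) → (φ : A → ℕ) →
  ∑ xs φ ≡ ∑[ y ∈ ys ] ∑ (fibre _≟_ f xs y) φ
∑-fibres _≟_ f xs {ys} ys! f∈ys φ = sym (begin
  ∑[ y ∈ ys ] ∑ (fibre _≟_ f xs y) φ
    ≡⟨ ∑-cong ys (λ y → ∑-filter (λ x → y ≟ f x) xs φ) ⟩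
  ∑[ y ∈ ys ] ∑[ x ∈ xs ] (𝟙 (y ≟ f x) * φ x)
    ≡⟨ ∑-swap ys xs _ ⟩
  ∑[ x ∈ xs ] ∑[ y ∈ ys ] (𝟙 (y ≟ f x) * φ x)
    ≡⟨ ∑-cong xs (λ x → ∑-𝟙-unique (_≟ f x) ys! (f∈ys x) refl id (λ _ → φ x)) ⟩
  ∑ xs φ ∎)

-- Enumerations without repetition

∈-remove : {x : A} {xs : List A} → x ∈ xs → ∃ λ ys → xs ↭ x ∷ ys
∈-remove x∈xs with ys , zs , refl ← ∈-∃++ x∈xs = ys ++ zs , Perm.shift _ ys zs

∈-tail : {x y : A} {ys : List A} → x ≢ y → x ∈ y ∷ ys → x ∈ ys
∈-tail x≢y (here x≡y)   = contradiction x≡y x≢y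
∈-tail x≢y (there x∈ys) = x∈ys

unique-⊆⇒↭ : {xs ys : List A} → Unique xs → (∀ {x} → x ∈ xs → x ∈ ys) →
  length ys ≤ length xs → xs ↭ ys
unique-⊆⇒↭ {xs = []}     {[]} []           xs⊆ys ∣ys∣≤∣xs∣ = ↭-refl
unique-⊆⇒↭ {xs = x ∷ xs}      (x∉xs ∷ xs!) xs⊆ys ∣ys∣≤∣xs∣
  with zs , ys↭ ← ∈-remove (xs⊆ys (here refl)) =
  ↭-trans (prep x (unique-⊆⇒↭ xs!
    (λ y∈xs → ∈-tail (≢-sym (All.lookup x∉xs y∈xs)) (Perm.∈-resp-↭ ys↭ (xs⊆ys (there y∈xs))))
    (≤-pred (subst (_≤ suc (length xs)) (Perm.↭-length ys↭) ∣ys∣≤∣xs∣))))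
  (↭-sym ys↭)

Unique-resp-↭ : Unique {A = A} Respects _↭_
Unique-resp-↭ xs↭ys = SetoidPerm.Unique-resp-↭ (setoid _) (↭.↭⇒↭ₛ xs↭ys)

map-unique : (f : A → B) {xs : List A} → Unique xs →
  (∀ {x y} → x ∈ xs → y ∈ xs → f x ≡ f y → x ≡ y) → Unique (map f xs)
map-unique f []            f-injective = []
map-unique f (x∉xs ∷ xs!) f-injective =
  All.tabulate (λ fy∈ fx≡ → let (y , y∈xs , z≡fy) = ∈-map⁻ f fy∈ in
    All.lookup x∉xs y∈xs (f-injective (here refl) (there y∈xs) (trans fx≡ z≡fy)))
  ∷ map-unique f xs! (λ x∈ y∈ → f-injective (there x∈) (there y∈))

unique-map⇒injective : (f : A → B) {xs : List A} → Unique (map f xs) →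
  ∀ {x y} → x ∈ xs → y ∈ xs → f x ≡ f y → x ≡ y
unique-map⇒injective f _          (here refl) (here refl) _     = refl
unique-map⇒injective f (fx∉ ∷ _)  (here refl) (there y∈)  fx≡fy =
  contradiction fx≡fy (All.lookup fx∉ (∈-map⁺ f y∈))
unique-map⇒injective f (fy∉ ∷ _)  (there x∈)  (here refl) fx≡fy =
  contradiction (sym fx≡fy) (All.lookup fy∉ (∈-map⁺ f x∈))
unique-map⇒injective f (_ ∷ fxs!) (there x∈)  (there y∈)  fx≡fy =
  unique-map⇒injective f fxs! x∈ y∈ fx≡fy

concatMap-unique : (f : A → List B) {xs : List A} → Unique xs → (∀ {x} → x ∈ xs → Unique (f x)) →
  (∀ {x y z} → x ∈ xs → y ∈ xs → z ∈ f x → z ∈ f y → x ≡ y) → Unique (concatMap f xs)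
concatMap-unique f []                        fx! disjoint = []
concatMap-unique f {x ∷ xs} (x∉xs ∷ xs!) fx! disjoint = Uniq.++⁺ (fx! (here refl))
  (concatMap-unique f xs! (fx! ∘ there) (λ x∈ y∈ → disjoint (there x∈) (there y∈)))
  (λ (z∈fx , z∈rest) → let (y , y∈xs , z∈fy) = find (∈-concatMap⁻ f {xs = xs} z∈rest) in
    All.lookup x∉xs y∈xs (disjoint (here refl) (there y∈xs) z∈fx z∈fy))

∑-bijection : {xs : List A} {ys : List B} (f : A → B) → Unique xs → Unique ys →
  (∀ {x} → x ∈ xs → f x ∈ ys) → (∀ {x y} → x ∈ xs → y ∈ xs → f x ≡ f y → x ≡ y) →
  (∀ {y} → y ∈ ys → ∃ λ x → x ∈ xs × y ≡ f x) →
  (φ : B → ℕ) → ∑ xs (φ ∘ f) ≡ ∑ ys φ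
∑-bijection {xs = xs} {ys} f xs! ys! f-maps f-injective f-onto φ = begin
  ∑ xs (φ ∘ f)    ≡⟨ ∑-map f xs φ ⟨
  ∑ (map f xs) φ  ≡⟨ ∑-↭ φ (∼bag⇒↭ (unique∧set⇒bag (map-unique f xs! f-injective) ys! (mk⇔ to from))) ⟩
  ∑ ys φ          ∎
  where
  to : ∀ {y} → y ∈ map f xs → y ∈ ys
  to y∈ with x , x∈xs , refl ← ∈-map⁻ f y∈ = f-maps x∈xs
  from : ∀ {y} → y ∈ ys → y ∈ map f xs
  from y∈ with x , x∈xs , refl ← f-onto y∈ = ∈-map⁺ f x∈xs

∑-reindex : {xs : List A} (f : A → A) → Unique xs → (∀ x → x ∈ xs) → Injective _≡_ _≡_ f →
  (φ : A → ℕ) → ∑ xs (φ ∘ f) ≡ ∑ xs φ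
∑-reindex {xs = xs} f xs! xs-complete f-injective φ = begin
  ∑ xs (φ ∘ f)    ≡⟨ ∑-map f xs φ ⟨
  ∑ (map f xs) φ  ≡⟨ ∑-↭ φ (unique-⊆⇒↭ (Uniq.map⁺ f-injective xs!) (λ {x} _ → xs-complete x)
                       (≤-reflexive (sym (length-map f xs)))) ⟩
  ∑ xs φ          ∎

tabulate-punchIn-↭ : (f : Fin (suc n) → A) (i : Fin (suc n)) →
  tabulate f ↭ f i ∷ tabulate (f ∘ punchIn i)
tabulate-punchIn-↭ f zero = ↭-refl
tabulate-punchIn-↭ {suc n} f (suc i) =
  ↭-trans (prep (f zero) (tabulate-punchIn-↭ (f ∘ suc) i)) (swap (f zero) (f (suc i)) ↭-refl)

∑-punchIn : (i : Fin (suc n)) (φ : Fin (suc n) → ℕ) →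
  ∑ (allFin (suc n)) φ ≡ φ i + ∑ (allFin n) (φ ∘ punchIn i)
∑-punchIn i φ = trans (∑-↭ φ (tabulate-punchIn-↭ id i)) (cong (φ i +_) (∑-tabulate (punchIn i) φ))

length-allFin : ∀ n → length (allFin n) ≡ n
length-allFin n = length-tabulate {n = n} id

∈-allVecs : (v : Vec (Fin n) m) → v ∈ allVecs n m
∈-allVecs []      = here refl
∈-allVecs (x ∷ v) = ∈-concatMap⁺ _ (lose (∈-allFin x) (∈-map⁺ (x ∷_) (∈-allVecs v)))

allVecs-unique : ∀ n m → Unique (allVecs n m)
allVecs-unique n zero    = [] ∷ []
allVecs-unique n (suc m) = concatMap-unique _ (Uniq.allFin⁺ n)
  (λ _ → Uniq.map⁺ VecP.∷-injectiveʳ (allVecs-unique n m))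
  (λ _ _ v∈ v∈′ → let (_ , _ , v≡) = ∈-map⁻ _ v∈ ; (_ , _ , v≡′) = ∈-map⁻ _ v∈′ in
    VecP.∷-injectiveˡ (trans (sym v≡) v≡′))

∑-allVecs-∷ : ∀ n m (φ : Vec (Fin n) (suc m) → ℕ) →
  ∑ (allVecs n (suc m)) φ ≡ ∑[ x ∈ allFin n ] ∑[ v ∈ allVecs n m ] φ (x ∷ v)
∑-allVecs-∷ n m φ = trans (∑-concatMap _ (allFin n) φ)
  (∑-cong (allFin n) (λ x → ∑-map (x ∷_) (allVecs n m) φ))

∑-allVecs-1 : ∀ n m → ∑[ _ ∈ allVecs n m ] 1 ≡ n ^ m
∑-allVecs-1 n zero    = refl
∑-allVecs-1 n (suc m) = begin
  ∑[ _ ∈ allVecs n (suc m) ] 1                     ≡⟨ ∑-allVecs-∷ n m _ ⟩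
  ∑[ _ ∈ allFin n ] ∑[ _ ∈ allVecs n m ] 1         ≡⟨ ∑-const (allFin n) _ ⟩
  length (allFin n) * (∑[ _ ∈ allVecs n m ] 1)     ≡⟨ cong₂ _*_ (length-allFin n) (∑-allVecs-1 n m) ⟩
  n ^ suc m                                        ∎

lookup-ext : {v w : Vec A n} → lookup v ≗ lookup w → v ≡ w
lookup-ext {v = v} {w} v≗w = begin
  v                        ≡⟨ VecP.tabulate∘lookup v ⟨
  Vec.tabulate (lookup v)  ≡⟨ VecP.tabulate-cong v≗w ⟩
  Vec.tabulate (lookup w)  ≡⟨ VecP.tabulate∘lookup w ⟩
  w                        ∎

-- Eulerian tours

picks : List A → List (A × List A)
picks []       = []
picks (x ∷ xs) = (x , xs) ∷ map (λ (y , ys) → y , x ∷ ys) (picks xs)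

picks-↭ : {x : A} {xs ys : List A} → (x , ys) ∈ picks xs → xs ↭ x ∷ ys
picks-↭ {xs = _ ∷ _} (here refl) = ↭-refl
picks-↭ {xs = z ∷ _} (there p) with _ , p′ , refl ← ∈-map⁻ _ p =
  ↭-trans (prep z (picks-↭ p′)) (swap _ _ ↭-refl)

∑-picks-∷ : (x : A) (xs : List A) (φ : A × List A → ℕ) →
  ∑ (picks (x ∷ xs)) φ ≡ φ (x , xs) + ∑ (picks xs) (λ (y , ys) → φ (y , x ∷ ys))
∑-picks-∷ x xs φ = cong (φ (x , xs) +_) (∑-map _ (picks xs) φ)

∑-picks-proj₁ : (xs : List A) (φ : A → ℕ) → ∑ (picks xs) (φ ∘ proj₁) ≡ ∑ xs φ
∑-picks-proj₁ []       φ = refl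
∑-picks-proj₁ (x ∷ xs) φ = trans (∑-picks-∷ x xs _) (cong (φ x +_) (∑-picks-proj₁ xs φ))

∑-picks-map : (f : A → B) (xs : List A) (φ : B × List B → ℕ) →
  ∑ (picks (map f xs)) φ ≡ ∑ (picks xs) (λ (y , ys) → φ (f y , map f ys))
∑-picks-map f []       φ = refl
∑-picks-map f (x ∷ xs) φ = begin
  ∑ (picks (f x ∷ map f xs)) φ
    ≡⟨ ∑-picks-∷ (f x) (map f xs) φ ⟩
  φ (f x , map f xs) + ∑ (picks (map f xs)) (λ (y , ys) → φ (y , f x ∷ ys))
    ≡⟨ cong (φ (f x , map f xs) +_) (∑-picks-map f xs _) ⟩
  φ (f x , map f xs) + ∑ (picks xs) (λ (y , ys) → φ (f y , f x ∷ map f ys))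
    ≡⟨ ∑-picks-∷ x xs _ ⟨
  ∑ (picks (x ∷ xs)) (λ (y , ys) → φ (f y , map f ys)) ∎

∑-picks-replicate : (n : ℕ) (x : A) (φ : A × List A → ℕ) →
  ∑ (picks (replicate (suc n) x)) φ ≡ suc n * φ (x , replicate n x)
∑-picks-replicate zero    x φ = refl
∑-picks-replicate (suc n) x φ = trans (∑-picks-∷ x (replicate (suc n) x) φ)
  (cong (φ (x , replicate (suc n) x) +_) (∑-picks-replicate n x _))

∑-picks-↭ : {xs ys : List A} (φ : A × List A → ℕ) →
  (∀ z {zs zs′} → zs ↭ zs′ → φ (z , zs) ≡ φ (z , zs′)) →
  xs ↭ ys → ∑ (picks xs) φ ≡ ∑ (picks ys) φ
∑-picks-↭ φ φ-resp ↭.refl = refl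
∑-picks-↭ {xs = x ∷ xs} {x ∷ ys} φ φ-resp (prep x σ) = begin
  ∑ (picks (x ∷ xs)) φ
    ≡⟨ ∑-picks-∷ x xs φ ⟩
  φ (x , xs) + ∑ (picks xs) (λ (z , zs) → φ (z , x ∷ zs))
    ≡⟨ cong₂ _+_ (φ-resp x σ) (∑-picks-↭ _ (λ z τ → φ-resp z (prep x τ)) σ) ⟩
  φ (x , ys) + ∑ (picks ys) (λ (z , zs) → φ (z , x ∷ zs))
    ≡⟨ ∑-picks-∷ x ys φ ⟨
  ∑ (picks (x ∷ ys)) φ ∎
∑-picks-↭ {xs = x ∷ y ∷ xs} {y ∷ x ∷ ys} φ φ-resp (swap x y σ) = begin
  ∑ (picks (x ∷ y ∷ xs)) φ
    ≡⟨ ∑-picks-∷∷ x y xs ⟩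
  φ (x , y ∷ xs) + (φ (y , x ∷ xs) + ∑ (picks xs) (λ (z , zs) → φ (z , x ∷ y ∷ zs)))
    ≡⟨ cong₂ _+_ (φ-resp x (prep y σ)) (cong₂ _+_ (φ-resp y (prep x σ)) swapped) ⟩
  φ (x , y ∷ ys) + (φ (y , x ∷ ys) + ∑ (picks ys) (λ (z , zs) → φ (z , y ∷ x ∷ zs)))
    ≡⟨ x+yz≡y+xz (φ (x , y ∷ ys)) (φ (y , x ∷ ys)) _ ⟩
  φ (y , x ∷ ys) + (φ (x , y ∷ ys) + ∑ (picks ys) (λ (z , zs) → φ (z , y ∷ x ∷ zs)))
    ≡⟨ ∑-picks-∷∷ y x ys ⟨
  ∑ (picks (y ∷ x ∷ ys)) φ ∎
  where
  ∑-picks-∷∷ : ∀ x y xs → ∑ (picks (x ∷ y ∷ xs)) φ ≡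
    φ (x , y ∷ xs) + (φ (y , x ∷ xs) + ∑ (picks xs) (λ (z , zs) → φ (z , x ∷ y ∷ zs)))
  ∑-picks-∷∷ x y xs = trans (∑-picks-∷ x (y ∷ xs) φ) (cong (φ (x , y ∷ xs) +_) (∑-picks-∷ y xs _))
  swapped : ∑ (picks xs) (λ (z , zs) → φ (z , x ∷ y ∷ zs)) ≡ ∑ (picks ys) (λ (z , zs) → φ (z , y ∷ x ∷ zs))
  swapped = trans (∑-cong (picks xs) (λ (z , _) → φ-resp z (swap x y ↭-refl)))
    (∑-picks-↭ _ (λ z τ → φ-resp z (prep y (prep x τ))) σ)
∑-picks-↭ φ φ-resp (↭.trans σ τ) = trans (∑-picks-↭ φ φ-resp σ) (∑-picks-↭ φ φ-resp τ)

∑-picks-swap : (xs : List A) (φ : A → A → List A → ℕ) →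
  ∑ (picks xs) (λ (x , ys) → ∑ (picks ys) (λ (y , zs) → φ x y zs)) ≡
  ∑ (picks xs) (λ (x , ys) → ∑ (picks ys) (λ (y , zs) → φ y x zs))
∑-picks-swap []       φ = refl
∑-picks-swap (w ∷ xs) φ = begin
  ∑ (picks (w ∷ xs)) (λ (x , ys) → ∑ (picks ys) (λ (y , zs) → φ x y zs))
    ≡⟨ separate φ ⟩
  ∑ (picks xs) (λ (y , zs) → φ w y zs) + (∑ (picks xs) (λ (y , zs) → φ y w zs)
    + ∑ (picks xs) (λ (x , ys) → ∑ (picks ys) (λ (y , zs) → φ x y (w ∷ zs))))
    ≡⟨ x+yz≡y+xz (∑ (picks xs) (λ (y , zs) → φ w y zs)) (∑ (picks xs) (λ (y , zs) → φ y w zs)) _ ⟩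
  ∑ (picks xs) (λ (y , zs) → φ y w zs) + (∑ (picks xs) (λ (y , zs) → φ w y zs)
    + ∑ (picks xs) (λ (x , ys) → ∑ (picks ys) (λ (y , zs) → φ x y (w ∷ zs))))
    ≡⟨ cong (λ c → ∑ (picks xs) (λ (y , zs) → φ y w zs) + (∑ (picks xs) (λ (y , zs) → φ w y zs) + c))
         (∑-picks-swap xs (λ x y zs → φ x y (w ∷ zs))) ⟩
  ∑ (picks xs) (λ (y , zs) → φ y w zs) + (∑ (picks xs) (λ (y , zs) → φ w y zs)
    + ∑ (picks xs) (λ (x , ys) → ∑ (picks ys) (λ (y , zs) → φ y x (w ∷ zs))))
    ≡⟨ separate (λ x y → φ y x) ⟨
  ∑ (picks (w ∷ xs)) (λ (x , ys) → ∑ (picks ys) (λ (y , zs) → φ y x zs)) ∎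
  where
  separate : ∀ φ → ∑ (picks (w ∷ xs)) (λ (x , ys) → ∑ (picks ys) (λ (y , zs) → φ x y zs)) ≡
    ∑ (picks xs) (λ (y , zs) → φ w y zs) + (∑ (picks xs) (λ (y , zs) → φ y w zs)
      + ∑ (picks xs) (λ (x , ys) → ∑ (picks ys) (λ (y , zs) → φ x y (w ∷ zs))))
  separate φ = trans (∑-picks-∷ w xs _) (cong (∑ (picks xs) (λ (y , zs) → φ w y zs) +_)
    (trans (∑-cong (picks xs) (λ (x , ys) → ∑-picks-∷ w ys _)) (∑-+ (picks xs) _ _)))

Edge : ℕ → Set
Edge q = Fin q × Fin q

source target : Edge q → Fin q
source = proj₁
target = proj₂

⟦_↝_⟧ : Edge q → Edge q → ℕ
⟦ e ↝ f ⟧ = 𝟙 (target e ≟ source f)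

infix 6 _⋈_

_⋈_ : Edge q → Edge q → Edge q
e ⋈ f = source e , target f

∑-merges : Edge q → List (Edge q) → (List (Edge q) → ℕ) → ℕ
∑-merges e L φ = ∑ (picks L) (λ (f , M) → ⟦ e ↝ f ⟧ * φ (e ⋈ f ∷ M))

toursₖ : ℕ → List (Edge q) → ℕ
toursₖ _       []      = 0
toursₖ zero    (e ∷ L) = ⟦ e ↝ e ⟧
toursₖ (suc k) (e ∷ L) = ∑-merges e L (toursₖ k)

-- The number of cyclic orders of the edges in which each target is the next source;
-- the value at [] is junk.
tours : List (Edge q) → ℕ
tours L = toursₖ (ℕ.pred (length L)) L

∑-merges-cong : (e : Edge q) (L : List (Edge q)) (φ ψ : List (Edge q) → ℕ) →
  (∀ t M → L ↭ (target e , t) ∷ M → φ ((source e , t) ∷ M) ≡ ψ ((source e , t) ∷ M)) →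
  ∑-merges e L φ ≡ ∑-merges e L ψ
∑-merges-cong e L φ ψ φ≡ψ = ∑-cong-∈ (picks L) (λ {(f , M)} f∈ →
  𝟙-*-cong (target e ≟ source f) (λ { refl → φ≡ψ (target f) M (picks-↭ f∈) }))

∑-merges-+ : (e : Edge q) (L : List (Edge q)) (φ ψ : List (Edge q) → ℕ) →
  ∑-merges e L (λ M → φ M + ψ M) ≡ ∑-merges e L φ + ∑-merges e L ψ
∑-merges-+ e L φ ψ =
  trans (∑-cong (picks L) (λ (f , _) → *-distribˡ-+ ⟦ e ↝ f ⟧ _ _)) (∑-+ (picks L) _ _)

∑-merges-*ˡ : (c : ℕ) (e : Edge q) (L : List (Edge q)) (φ : List (Edge q) → ℕ) →
  ∑-merges e L (λ M → c * φ M) ≡ c * ∑-merges e L φ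
∑-merges-*ˡ c e L φ =
  trans (∑-cong (picks L) (λ (f , _) → x*yz≡y*xz ⟦ e ↝ f ⟧ c _)) (∑-*ˡ c (picks L) _)

tours-merge : (e f : Edge q) (L : List (Edge q)) → tours (e ∷ f ∷ L) ≡ ∑-merges e (f ∷ L) tours
tours-merge e f L = ∑-merges-cong e (f ∷ L) (toursₖ (length L)) tours (λ t M fL↭ →
  cong (λ k → toursₖ k ((source e , t) ∷ M)) (suc-injective (Perm.↭-length fL↭)))

tours-merge-∷ : (e f : Edge q) (L : List (Edge q)) →
  tours (e ∷ f ∷ L) ≡
    ⟦ e ↝ f ⟧ * tours (e ⋈ f ∷ L) + ∑ (picks L) (λ (g , M) → ⟦ e ↝ g ⟧ * tours (e ⋈ g ∷ f ∷ M))
tours-merge-∷ e f L = trans (tours-merge e f L) (∑-picks-∷ f L _)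

∑-double-merges : Edge q → Edge q → List (Edge q) → (List (Edge q) → ℕ) → ℕ
∑-double-merges e f L φ = ∑ (picks L) (λ (x , M) → ∑ (picks M) (λ (y , N) →
  ⟦ e ↝ x ⟧ * ⟦ f ↝ y ⟧ * φ (f ⋈ y ∷ e ⋈ x ∷ N)))

∑-double-merges-comm : (e f : Edge q) (L : List (Edge q)) (φ : List (Edge q) → ℕ) →
  (∀ d d′ M → 2 + length M ≤ length L → φ (d ∷ d′ ∷ M) ≡ φ (d′ ∷ d ∷ M)) →
  ∑-double-merges e f L φ ≡ ∑-double-merges f e L φ
∑-double-merges-comm e f L φ φ-swap = trans (∑-picks-swap L _)
  (∑-cong-∈ (picks L) (λ {(x , M)} x∈ → ∑-cong-∈ (picks M) (λ {(y , N)} y∈ →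
    cong₂ _*_ (*-comm ⟦ e ↝ y ⟧ ⟦ f ↝ x ⟧) (φ-swap (f ⋈ x) (e ⋈ y) N (≤-reflexive (shorter x∈ y∈))))))
  where
  shorter : ∀ {x M y N} → (x , M) ∈ picks L → (y , N) ∈ picks M → 2 + length N ≡ length L
  shorter x∈ y∈ = sym (trans (Perm.↭-length (picks-↭ x∈)) (cong suc (Perm.↭-length (picks-↭ y∈))))

tours-merge-⋈ : (e f x : Edge q) (M : List (Edge q)) → tours (e ⋈ x ∷ f ∷ M) ≡ tours (f ∷ e ⋈ x ∷ M) →
  ⟦ e ↝ x ⟧ * tours (e ⋈ x ∷ f ∷ M) ≡
    ⟦ f ↝ e ⟧ * (⟦ e ↝ x ⟧ * tours (f ⋈ x ∷ M))
    + ∑ (picks M) (λ (y , N) → ⟦ e ↝ x ⟧ * ⟦ f ↝ y ⟧ * tours (f ⋈ y ∷ e ⋈ x ∷ N))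
tours-merge-⋈ {q} e f x M swap-f = begin
  ⟦ e ↝ x ⟧ * tours (e ⋈ x ∷ f ∷ M)
    ≡⟨ cong (⟦ e ↝ x ⟧ *_) (trans swap-f (tours-merge-∷ f (e ⋈ x) M)) ⟩
  ⟦ e ↝ x ⟧ * (⟦ f ↝ e ⟧ * tours (f ⋈ x ∷ M) + ∑ (picks M) after-f)
    ≡⟨ *-distribˡ-+ ⟦ e ↝ x ⟧ (⟦ f ↝ e ⟧ * tours (f ⋈ x ∷ M)) _ ⟩
  ⟦ e ↝ x ⟧ * (⟦ f ↝ e ⟧ * tours (f ⋈ x ∷ M)) + ⟦ e ↝ x ⟧ * ∑ (picks M) after-f
    ≡⟨ cong₂ _+_ (x*yz≡y*xz ⟦ e ↝ x ⟧ ⟦ f ↝ e ⟧ _)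
         (trans (sym (∑-*ˡ ⟦ e ↝ x ⟧ (picks M) after-f))
           (∑-cong (picks M) (λ (y , _) → sym (*-assoc ⟦ e ↝ x ⟧ ⟦ f ↝ y ⟧ _)))) ⟩
  ⟦ f ↝ e ⟧ * (⟦ e ↝ x ⟧ * tours (f ⋈ x ∷ M))
    + ∑ (picks M) (λ (y , N) → ⟦ e ↝ x ⟧ * ⟦ f ↝ y ⟧ * tours (f ⋈ y ∷ e ⋈ x ∷ N)) ∎
  where
  after-f : Edge q × List (Edge q) → ℕ
  after-f (y , N) = ⟦ f ↝ y ⟧ * tours (f ⋈ y ∷ e ⋈ x ∷ N)

-- Merging e and f with their successors leaves a sum that is symmetric in e and f.
tours-merge-both : (e f g : Edge q) (L : List (Edge q)) →
  (∀ d M → length M ≤ length L → tours (d ∷ f ∷ M) ≡ tours (f ∷ d ∷ M)) →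
  tours (e ∷ f ∷ g ∷ L) ≡
    ⟦ e ↝ f ⟧ * tours (e ⋈ f ∷ g ∷ L)
    + (⟦ f ↝ e ⟧ * tours (f ⋈ e ∷ g ∷ L) + ∑-double-merges e f (g ∷ L) tours)
tours-merge-both e f g L swap-f = begin
  tours (e ∷ f ∷ g ∷ L)
    ≡⟨ tours-merge-∷ e f (g ∷ L) ⟩
  direct + ∑ (picks (g ∷ L)) (λ (x , M) → ⟦ e ↝ x ⟧ * tours (e ⋈ x ∷ f ∷ M))
    ≡⟨ cong (direct +_) (∑-cong-∈ (picks (g ∷ L)) (λ {(x , M)} x∈ →
         tours-merge-⋈ e f x M (swap-f (e ⋈ x) M (≤-reflexive (suc-injective (sym (Perm.↭-length (picks-↭ x∈)))))))) ⟩
  direct + ∑ (picks (g ∷ L)) (λ (x , M) → ⟦ f ↝ e ⟧ * (⟦ e ↝ x ⟧ * tours (f ⋈ x ∷ M))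
      + ∑ (picks M) (λ (y , N) → ⟦ e ↝ x ⟧ * ⟦ f ↝ y ⟧ * tours (f ⋈ y ∷ e ⋈ x ∷ N)))
    ≡⟨ cong (direct +_) (∑-+ (picks (g ∷ L)) (λ (x , M) → ⟦ f ↝ e ⟧ * (⟦ e ↝ x ⟧ * tours (f ⋈ x ∷ M))) _) ⟩
  direct + (∑ (picks (g ∷ L)) (λ (x , M) → ⟦ f ↝ e ⟧ * (⟦ e ↝ x ⟧ * tours (f ⋈ x ∷ M)))
      + ∑-double-merges e f (g ∷ L) tours)
    ≡⟨ cong (λ s → direct + (s + ∑-double-merges e f (g ∷ L) tours))
         (trans (∑-*ˡ ⟦ f ↝ e ⟧ (picks (g ∷ L)) _) (cong (⟦ f ↝ e ⟧ *_) (sym (tours-merge (f ⋈ e) g L)))) ⟩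
  direct + (⟦ f ↝ e ⟧ * tours (f ⋈ e ∷ g ∷ L) + ∑-double-merges e f (g ∷ L) tours) ∎
  where
  direct : ℕ
  direct = ⟦ e ↝ f ⟧ * tours (e ⋈ f ∷ g ∷ L)

tours-swap : (e f : Edge q) (L : List (Edge q)) → tours (e ∷ f ∷ L) ≡ tours (f ∷ e ∷ L)
tours-swap {q} e f L = swap-≤ (length L) e f L ≤-refl
  where
  swap-≤ : ∀ k (e f : Edge q) L → length L ≤ k → tours (e ∷ f ∷ L) ≡ tours (f ∷ e ∷ L)
  swap-≤ k       e f []      _         = cong (_+ 0) (*-comm ⟦ e ↝ f ⟧ ⟦ f ↝ e ⟧)
  swap-≤ (suc k) e f (g ∷ L) (s≤s L≤k) = begin
    tours (e ∷ f ∷ g ∷ L)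
      ≡⟨ tours-merge-both e f g L (λ d M M≤L → swap-≤ k d f M (≤-trans M≤L L≤k)) ⟩
    ef + (fe + ∑-double-merges e f (g ∷ L) tours)
      ≡⟨ x+yz≡y+xz ef fe _ ⟩
    fe + (ef + ∑-double-merges e f (g ∷ L) tours)
      ≡⟨ cong (λ s → fe + (ef + s)) (∑-double-merges-comm e f (g ∷ L) tours
           (λ d d′ M M<L → swap-≤ k d d′ M (≤-trans (n≤1+n _) (≤-trans (≤-pred M<L) L≤k)))) ⟩
    fe + (ef + ∑-double-merges f e (g ∷ L) tours)
      ≡⟨ tours-merge-both f e g L (λ d M M≤L → swap-≤ k d e M (≤-trans M≤L L≤k)) ⟨
    tours (f ∷ e ∷ g ∷ L) ∎
    where
    ef fe : ℕ
    ef = ⟦ e ↝ f ⟧ * tours (e ⋈ f ∷ g ∷ L)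
    fe = ⟦ f ↝ e ⟧ * tours (f ⋈ e ∷ g ∷ L)

tours-prep-↭ : (e : Edge q) {L M : List (Edge q)} → L ↭ M → tours (e ∷ L) ≡ tours (e ∷ M)
tours-prep-↭ e {L} {M} L↭M =
  trans (toursₖ-↭ (length L) e L↭M) (cong (λ k → toursₖ k (e ∷ M)) (Perm.↭-length L↭M))
  where
  toursₖ-↭ : ∀ k e {L M} → L ↭ M → toursₖ k (e ∷ L) ≡ toursₖ k (e ∷ M)
  toursₖ-↭ zero    e L↭M = refl
  toursₖ-↭ (suc k) e L↭M = ∑-picks-↭ _ (λ f σ → cong (⟦ e ↝ f ⟧ *_) (toursₖ-↭ k (e ⋈ f) σ)) L↭M

tours-↭ : {L M : List (Edge q)} → L ↭ M → tours L ≡ tours M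
tours-↭ ↭.refl                       = refl
tours-↭ (prep e σ)                   = tours-prep-↭ e σ
tours-↭ {M = _ ∷ _ ∷ M} (swap e f σ) = trans (tours-prep-↭ e (prep f σ)) (tours-swap e f M)
tours-↭ (↭.trans σ τ)                = trans (tours-↭ σ) (tours-↭ τ)

tours-loops : (u : Fin q) (n : ℕ) → tours (replicate (suc n) (u , u)) ≡ n !
tours-loops u zero    = 𝟙-≟-refl u
tours-loops u (suc n) = begin
  tours (replicate (2 + n) (u , u))
    ≡⟨ tours-merge (u , u) (u , u) (replicate n (u , u)) ⟩
  ∑-merges (u , u) (replicate (suc n) (u , u)) tours
    ≡⟨ ∑-picks-replicate n (u , u) _ ⟩
  suc n * (𝟙 (u ≟ u) * tours (replicate (suc n) (u , u)))
    ≡⟨ cong₂ (λ s t → suc n * (s * t)) (𝟙-≟-refl u) (tours-loops u n) ⟩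
  suc n * (1 * n !)
    ≡⟨ cong (suc n *_) (*-identityˡ (n !)) ⟩
  suc n ! ∎

-- Exchanging the targets of two edges

outdeg indeg : Fin q → List (Edge q) → ℕ
outdeg u L = ∑[ e ∈ L ] 𝟙 (u ≟ source e)
indeg  u L = ∑[ e ∈ L ] 𝟙 (u ≟ target e)

outdeg-↭ : (u : Fin q) {L M : List (Edge q)} → L ↭ M → outdeg u L ≡ outdeg u M
outdeg-↭ u = ∑-↭ (λ e → 𝟙 (u ≟ source e))

indeg-↭ : (u : Fin q) {L M : List (Edge q)} → L ↭ M → indeg u L ≡ indeg u M
indeg-↭ u = ∑-↭ (λ e → 𝟙 (u ≟ target e))

record Balanced (L : List (Edge q)) : Set where
  field outdeg≡indeg : ∀ u → outdeg u L ≡ indeg u L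

open Balanced

Balanced-resp-↭ : Balanced {q} Respects _↭_
Balanced-resp-↭ L↭M balanced .outdeg≡indeg u =
  trans (sym (outdeg-↭ u L↭M)) (trans (outdeg≡indeg balanced u) (indeg-↭ u L↭M))

Balanced-merge : ∀ {a b c : Fin q} {L} → Balanced ((a , b) ∷ (b , c) ∷ L) → Balanced ((a , c) ∷ L)
Balanced-merge {a = a} {b} balanced .outdeg≡indeg u = +-cancelˡ-≡ (𝟙 (u ≟ b)) _ _
  (trans (x+yz≡y+xz (𝟙 (u ≟ b)) (𝟙 (u ≟ a)) _) (outdeg≡indeg balanced u))

Balanced-loop : ∀ {a : Fin q} {L} → Balanced ((a , a) ∷ L) → Balanced L
Balanced-loop {a = a} balanced .outdeg≡indeg u = +-cancelˡ-≡ (𝟙 (u ≟ a)) _ _ (outdeg≡indeg balanced u)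

Balanced⇒sources⊆targets : {P : Fin q → Set} {L : List (Edge q)} → Balanced L →
  All (P ∘ target) L → All (P ∘ source) L
Balanced⇒sources⊆targets {P = P} {L} balanced P-targets = All.tabulate source∈P
  where
  source∈P : ∀ {e} → e ∈ L → P (source e)
  source∈P {e} e∈L with Any.any? (λ f → source e ≟ target f) L
  ... | yes is-target =
    let (_ , f∈L , source≡target) = find is-target in subst P (sym source≡target) (All.lookup P-targets f∈L)
  ... | no ¬is-target with M , L↭ ← ∈-remove e∈L = contradiction (begin
    1 + outdeg (source e) M      ≡⟨ cong (_+ outdeg (source e) M) (𝟙-≟-refl (source e)) ⟨
    outdeg (source e) (e ∷ M)    ≡⟨ outdeg-↭ (source e) L↭ ⟨
    outdeg (source e) L          ≡⟨ outdeg≡indeg balanced (source e) ⟩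
    indeg (source e) L           ≡⟨ ∑-zero L (λ {f} f∈L → 𝟙-false (source e ≟ target f) (¬is-target ∘ lose f∈L)) ⟩
    0                            ∎) 1+n≢0

∑-merges-const : (e : Edge q) (L : List (Edge q)) (c : ℕ) →
  ∑-merges e L (λ _ → c) ≡ outdeg (target e) L * c
∑-merges-const e L c = trans (∑-picks-proj₁ L (λ f → ⟦ e ↝ f ⟧ * c)) (∑-*ʳ c L _)

∑-merges-zero : (e : Edge q) (L : List (Edge q)) (φ : List (Edge q) → ℕ) →
  All (λ f → target e ≢ source f) L → ∑-merges e L φ ≡ 0
∑-merges-zero e L φ apart = ∑-zero (picks L) (λ {(f , M)} f∈ → cong (_* φ (e ⋈ f ∷ M))
  (𝟙-false (target e ≟ source f) (All.lookup apart (Perm.∈-resp-↭ (↭-sym (picks-↭ f∈)) (here refl)))))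

tours-merge-second : (x e : Edge q) (L : List (Edge q)) →
  tours (x ∷ e ∷ L) ≡ ⟦ e ↝ x ⟧ * tours (e ⋈ x ∷ L) + ∑-merges e L (λ M → tours (x ∷ M))
tours-merge-second x e L = begin
  tours (x ∷ e ∷ L)
    ≡⟨ trans (tours-swap x e L) (tours-merge-∷ e x L) ⟩
  ⟦ e ↝ x ⟧ * tours (e ⋈ x ∷ L) + ∑ (picks L) (λ (f , M) → ⟦ e ↝ f ⟧ * tours (e ⋈ f ∷ x ∷ M))
    ≡⟨ cong (⟦ e ↝ x ⟧ * tours (e ⋈ x ∷ L) +_)
         (∑-cong (picks L) (λ (f , M) → cong (⟦ e ↝ f ⟧ *_) (tours-swap (e ⋈ f) x M))) ⟩
  ⟦ e ↝ x ⟧ * tours (e ⋈ x ∷ L) + ∑-merges e L (λ M → tours (x ∷ M)) ∎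

tours-merge-third : (x y e : Edge q) (L : List (Edge q)) →
  tours (x ∷ y ∷ e ∷ L) ≡
    ⟦ e ↝ x ⟧ * tours (e ⋈ x ∷ y ∷ L)
    + (⟦ e ↝ y ⟧ * tours (e ⋈ y ∷ x ∷ L) + ∑-merges e L (λ M → tours (x ∷ y ∷ M)))
tours-merge-third x y e L = begin
  tours (x ∷ y ∷ e ∷ L)
    ≡⟨ trans (tours-↭ (Perm.shift e (x ∷ y ∷ []) L)) (tours-merge-∷ e x (y ∷ L)) ⟩
  via-x + ∑ (picks (y ∷ L)) (λ (f , M) → ⟦ e ↝ f ⟧ * tours (e ⋈ f ∷ x ∷ M))
    ≡⟨ cong (via-x +_) (∑-picks-∷ y L _) ⟩
  via-x + (via-y + ∑ (picks L) (λ (f , M) → ⟦ e ↝ f ⟧ * tours (e ⋈ f ∷ x ∷ y ∷ M)))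
    ≡⟨ cong (λ s → via-x + (via-y + s)) (∑-cong (picks L) (λ (f , M) →
         cong (⟦ e ↝ f ⟧ *_) (sym (tours-↭ (Perm.shift (e ⋈ f) (x ∷ y ∷ []) M))))) ⟩
  via-x + (via-y + ∑-merges e L (λ M → tours (x ∷ y ∷ M))) ∎
  where
  via-x via-y : ℕ
  via-x = ⟦ e ↝ x ⟧ * tours (e ⋈ x ∷ y ∷ L)
  via-y = ⟦ e ↝ y ⟧ * tours (e ⋈ y ∷ x ∷ L)

tours-merge-third-apart : (x y e : Edge q) (L : List (Edge q)) →
  target e ≢ source x → target e ≢ source y →
  tours (x ∷ y ∷ e ∷ L) ≡ ∑-merges e L (λ M → tours (x ∷ y ∷ M))
tours-merge-third-apart x y e L e↛x e↛y = trans (tours-merge-third x y e L)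
  (cong₂ (λ s t → s * tours (e ⋈ x ∷ y ∷ L) + (t * tours (e ⋈ y ∷ x ∷ L) + ∑-merges e L (λ M → tours (x ∷ y ∷ M))))
    (𝟙-false (target e ≟ source x) e↛x) (𝟙-false (target e ≟ source y) e↛y))

tours-merge-third-via-second : (x y e : Edge q) (L : List (Edge q)) →
  target e ≢ source x → target e ≡ source y →
  tours (x ∷ y ∷ e ∷ L) ≡ tours (e ⋈ y ∷ x ∷ L) + ∑-merges e L (λ M → tours (x ∷ y ∷ M))
tours-merge-third-via-second x y e L e↛x e↝y = begin
  tours (x ∷ y ∷ e ∷ L)
    ≡⟨ tours-merge-third x y e L ⟩
  ⟦ e ↝ x ⟧ * tours (e ⋈ x ∷ y ∷ L) + (⟦ e ↝ y ⟧ * tours (e ⋈ y ∷ x ∷ L) + merges)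
    ≡⟨ cong₂ (λ s t → s * tours (e ⋈ x ∷ y ∷ L) + (t * tours (e ⋈ y ∷ x ∷ L) + merges))
         (𝟙-false (target e ≟ source x) e↛x) (𝟙-true (target e ≟ source y) e↝y) ⟩
  1 * tours (e ⋈ y ∷ x ∷ L) + merges
    ≡⟨ cong (_+ merges) (*-identityˡ (tours (e ⋈ y ∷ x ∷ L))) ⟩
  tours (e ⋈ y ∷ x ∷ L) + merges ∎
  where
  merges : ℕ
  merges = ∑-merges e L (λ M → tours (x ∷ y ∷ M))

All≡⇒replicate : {xs : List A} {x : A} → All (_≡ x) xs → xs ≡ replicate (length xs) x
All≡⇒replicate []           = refl
All≡⇒replicate (refl ∷ xs≡) = cong (_ ∷_) (All≡⇒replicate xs≡)

All-or-pick-induction : {P : List A → Set} {Q : A → Set} → Decidable Q → P Respects _↭_ →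
  (∀ {xs} → All Q xs → P xs) →
  (∀ x xs → ¬ Q x → (∀ ys → length ys ≤ length xs → P ys) → P (x ∷ xs)) →
  ∀ xs → P xs
All-or-pick-induction {A} {P} Q? P-resp-↭ base step xs = go (length xs) xs ≤-refl
  where
  go : ∀ k xs → length xs ≤ k → P xs
  go k xs ∣xs∣≤k with All.all? Q? xs
  ... | yes Q-xs = base Q-xs
  ... | no ¬Q-xs
    with x , x∈xs , ¬Qx ← find (¬All⇒Any¬ Q? xs ¬Q-xs)
    with ys , xs↭ ← ∈-remove x∈xs
    with k | subst (_≤ k) (Perm.↭-length xs↭) ∣xs∣≤k
  ...   | suc k | s≤s ∣ys∣≤k =
    P-resp-↭ (↭-sym xs↭) (step x ys ¬Qx (λ zs ∣zs∣≤∣ys∣ → go k zs (≤-trans ∣zs∣≤∣ys∣ ∣ys∣≤k)))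

mapEdge : (Fin q → Fin p) → Edge q → Edge p
mapEdge κ e = κ (source e) , κ (target e)

module Exchange {u v : Fin q} (u≢v : u ≢ v) where

  Terminal : Fin q → Set
  Terminal x = x ≡ u ⊎ x ≡ v

  terminal? : Decidable Terminal
  terminal? x = (x ≟ u) ⊎-dec (x ≟ v)

  parallel crossed : List (Edge q) → ℕ
  parallel L = tours ((u , u) ∷ (v , v) ∷ L)
  crossed  L = tours ((u , v) ∷ (v , u) ∷ L)

  parallel-↭ : ∀ {L M} → L ↭ M → parallel L ≡ parallel M
  parallel-↭ L↭M = tours-↭ (prep (u , u) (prep (v , v) L↭M))

  crossed-↭ : ∀ {L M} → L ↭ M → crossed L ≡ crossed M
  crossed-↭ L↭M = tours-↭ (prep (u , v) (prep (v , u) L↭M))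

  𝟙-u≟v : 𝟙 (u ≟ v) ≡ 0
  𝟙-u≟v = 𝟙-false (u ≟ v) u≢v

  𝟙-v≟u : 𝟙 (v ≟ u) ≡ 0
  𝟙-v≟u = 𝟙-false (v ≟ u) (u≢v ∘ sym)

  loops : ℕ → List (Edge q)
  loops n = replicate n (u , u)

  crossed-loops : ∀ n → crossed (loops n) ≡ n !
  crossed-loops n = begin
    tours ((u , v) ∷ (v , u) ∷ loops n)
      ≡⟨ trans (tours-swap (u , v) (v , u) (loops n)) (tours-merge-second (v , u) (u , v) (loops n)) ⟩
    𝟙 (v ≟ v) * tours (loops (suc n)) + ∑-merges (u , v) (loops n) (λ M → tours ((v , u) ∷ M))
      ≡⟨ cong₂ _+_ (cong₂ _*_ (𝟙-≟-refl v) (tours-loops u n))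
           (∑-merges-zero (u , v) (loops n) (λ M → tours ((v , u) ∷ M)) (replicate⁺ n (u≢v ∘ sym))) ⟩
    1 * n ! + 0
      ≡⟨ trans (+-identityʳ _) (*-identityˡ (n !)) ⟩
    n ! ∎

  parallel-loops : ∀ n → parallel (loops n) ≡ 0
  parallel-loops n = begin
    parallel (loops n)                      ≡⟨ tours-swap (u , u) (v , v) (loops n) ⟩
    tours ((v , v) ∷ loops (suc n))         ≡⟨ tours-merge (v , v) (u , u) (loops n) ⟩
    ∑-merges (v , v) (loops (suc n)) tours  ≡⟨ ∑-merges-zero (v , v) (loops (suc n)) tours (replicate⁺ (suc n) (u≢v ∘ sym)) ⟩
    0                                       ∎

  Exchangeable : List (Edge q) → Set
  Exchangeable L = Balanced L → All (Terminal ∘ target) L →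
    crossed L ≡ parallel L + indeg u L ! * indeg v L !

  Exchangeable-resp-↭ : Exchangeable Respects _↭_
  Exchangeable-resp-↭ {L} {M} L↭M exchange balanced targets = begin
    crossed M
      ≡⟨ crossed-↭ L↭M ⟨
    crossed L
      ≡⟨ exchange (Balanced-resp-↭ (↭-sym L↭M) balanced) (Perm.All-resp-↭ (↭-sym L↭M) targets) ⟩
    parallel L + indeg u L ! * indeg v L !
      ≡⟨ cong₂ _+_ (parallel-↭ L↭M) (cong₂ (λ i j → i ! * j !) (indeg-↭ u L↭M) (indeg-↭ v L↭M)) ⟩
    parallel M + indeg u M ! * indeg v M ! ∎

  exchange-loops : ∀ n → Exchangeable (loops n)
  exchange-loops n _ _ = begin
    crossed (loops n)
      ≡⟨ crossed-loops n ⟩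
    n !
      ≡⟨ *-identityʳ (n !) ⟨
    n ! * 0 !
      ≡⟨ cong₂ (λ i j → i ! * j !) indeg-u indeg-v ⟨
    indeg u (loops n) ! * indeg v (loops n) !
      ≡⟨ cong (_+ indeg u (loops n) ! * indeg v (loops n) !) (parallel-loops n) ⟨
    parallel (loops n) + indeg u (loops n) ! * indeg v (loops n) ! ∎
    where
    indeg-u : indeg u (loops n) ≡ n
    indeg-u = trans (∑-replicate n (u , u) _) (trans (cong (n *_) (𝟙-≟-refl u)) (*-identityʳ n))
    indeg-v : indeg v (loops n) ≡ 0
    indeg-v = trans (∑-replicate n (u , u) _) (trans (cong (n *_) 𝟙-v≟u) (*-zeroʳ n))

  ∑-merges-exchange : ∀ a L → (∀ M → length M ≤ length L → Exchangeable M) →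
    Balanced ((a , v) ∷ L) → All (Terminal ∘ target) L →
    ∑-merges (a , v) L crossed ≡ ∑-merges (a , v) L parallel + outdeg v L * (indeg u L ! * indeg v L !)
  ∑-merges-exchange a L exchange balanced targets = begin
    ∑-merges (a , v) L crossed
      ≡⟨ ∑-merges-cong (a , v) L crossed (λ M → parallel M + gain) merged ⟩
    ∑-merges (a , v) L (λ M → parallel M + gain)
      ≡⟨ ∑-merges-+ (a , v) L parallel (λ _ → gain) ⟩
    ∑-merges (a , v) L parallel + ∑-merges (a , v) L (λ _ → gain)
      ≡⟨ cong (∑-merges (a , v) L parallel +_) (∑-merges-const (a , v) L gain) ⟩
    ∑-merges (a , v) L parallel + outdeg v L * gain ∎
    where
    gain : ℕ
    gain = indeg u L ! * indeg v L !
    merged : ∀ t M → L ↭ (v , t) ∷ M → crossed ((a , t) ∷ M) ≡ parallel ((a , t) ∷ M) + gain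
    merged t M L↭ with t-terminal ∷ M-terminal ← Perm.All-resp-↭ L↭ targets = begin
      crossed ((a , t) ∷ M)
        ≡⟨ exchange ((a , t) ∷ M) (≤-reflexive (sym (Perm.↭-length L↭)))
             (Balanced-merge (Balanced-resp-↭ (prep (a , v) L↭) balanced)) (t-terminal ∷ M-terminal) ⟩
      parallel ((a , t) ∷ M) + indeg u ((v , t) ∷ M) ! * indeg v ((v , t) ∷ M) !
        ≡⟨ cong₂ (λ i j → parallel ((a , t) ∷ M) + i ! * j !) (indeg-↭ u L↭) (indeg-↭ v L↭) ⟨
      parallel ((a , t) ∷ M) + gain ∎

  exchange-first-merge : ∀ a L → Terminal a → Exchangeable L → Balanced ((a , v) ∷ L) → All (Terminal ∘ target) L →
    tours ((a , u) ∷ (u , v) ∷ L) + outdeg v L * (indeg u L ! * indeg v L !) ≡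
    tours ((a , v) ∷ (u , u) ∷ L) + suc (indeg v L) * (indeg u L ! * indeg v L !)
  exchange-first-merge .u L (inj₁ refl) exchange balanced targets =
    cong₂ (λ t d → t + d * (indeg u L ! * indeg v L !)) (tours-swap (u , u) (u , v) L) (begin
      outdeg v L                ≡⟨ cong (_+ outdeg v L) 𝟙-v≟u ⟨
      outdeg v ((u , v) ∷ L)    ≡⟨ outdeg≡indeg balanced v ⟩
      indeg v ((u , v) ∷ L)     ≡⟨ cong (_+ indeg v L) (𝟙-≟-refl v) ⟩
      suc (indeg v L)           ∎)
  exchange-first-merge .v L (inj₂ refl) exchange balanced targets = begin
    tours ((v , u) ∷ (u , v) ∷ L) + outdeg v L * gain
      ≡⟨ cong₂ (λ t d → t + d * gain) (tours-swap (v , u) (u , v) L) (outdeg≡indeg L-balanced v) ⟩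
    crossed L + indeg v L * gain
      ≡⟨ cong (_+ indeg v L * gain) (exchange L-balanced targets) ⟩
    parallel L + gain + indeg v L * gain
      ≡⟨ +-assoc (parallel L) gain _ ⟩
    parallel L + suc (indeg v L) * gain
      ≡⟨ cong (_+ suc (indeg v L) * gain) (tours-swap (u , u) (v , v) L) ⟩
    tours ((v , v) ∷ (u , u) ∷ L) + suc (indeg v L) * gain ∎
    where
    L-balanced : Balanced L
    L-balanced = Balanced-loop balanced
    gain : ℕ
    gain = indeg u L ! * indeg v L !

  exchange-merge : ∀ a L → Terminal a → (∀ M → length M ≤ length L → Exchangeable M) →
    Balanced ((a , v) ∷ L) → All (Terminal ∘ target) L →
    crossed ((a , v) ∷ L) ≡ parallel ((a , v) ∷ L) + indeg u L ! * suc (indeg v L) !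
  exchange-merge a L a-terminal exchange balanced targets = begin
    crossed ((a , v) ∷ L)
      ≡⟨ tours-merge-third-via-second (u , v) (v , u) (a , v) L (u≢v ∘ sym) refl ⟩
    crossed-first + ∑-merges (a , v) L crossed
      ≡⟨ cong (crossed-first +_) (∑-merges-exchange a L exchange balanced targets) ⟩
    crossed-first + (rest + outdeg v L * gain)
      ≡⟨ x+yz≡y+xz crossed-first rest _ ⟩
    rest + (crossed-first + outdeg v L * gain)
      ≡⟨ cong (rest +_) (exchange-first-merge a L a-terminal (exchange L ≤-refl) balanced targets) ⟩
    rest + (parallel-first + suc (indeg v L) * gain)
      ≡⟨ trans (x+yz≡y+xz rest parallel-first _) (sym (+-assoc parallel-first rest _)) ⟩
    parallel-first + rest + suc (indeg v L) * gain
      ≡⟨ cong₂ _+_ (tours-merge-third-via-second (u , u) (v , v) (a , v) L (u≢v ∘ sym) refl)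
           (x*yz≡y*xz (indeg u L !) (suc (indeg v L)) (indeg v L !)) ⟨
    parallel ((a , v) ∷ L) + indeg u L ! * suc (indeg v L) ! ∎
    where
    crossed-first parallel-first rest gain : ℕ
    crossed-first  = tours ((a , u) ∷ (u , v) ∷ L)
    parallel-first = tours ((a , v) ∷ (u , u) ∷ L)
    rest = ∑-merges (a , v) L parallel
    gain = indeg u L ! * indeg v L !

  exchange-terminal : ∀ L → Exchangeable L
  exchange-terminal = All-or-pick-induction (λ e → target e ≟ u) Exchangeable-resp-↭ base step
    where
    base : ∀ {L} → All ((_≡ u) ∘ target) L → Exchangeable L
    base {L} targets≡u balanced = subst Exchangeable (sym L≡loops) (exchange-loops (length L)) balanced
      where
      L≡loops : L ≡ loops (length L)
      L≡loops = All≡⇒replicate (All.zipWith (λ { {_ , _} (refl , refl) → refl })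
        (Balanced⇒sources⊆targets balanced targets≡u , targets≡u))

    step : ∀ e L → target e ≢ u → (∀ M → length M ≤ length L → Exchangeable M) → Exchangeable (e ∷ L)
    step (a , b)  L b≢u exchange balanced (inj₁ b≡u ∷ targets) = contradiction b≡u b≢u
    step (a , .v) L b≢u exchange balanced (inj₂ refl ∷ targets)
      with a-terminal ∷ _ ← Balanced⇒sources⊆targets {P = Terminal} balanced (inj₂ refl ∷ targets) = begin
      crossed ((a , v) ∷ L)
        ≡⟨ exchange-merge a L a-terminal exchange balanced targets ⟩
      parallel ((a , v) ∷ L) + indeg u L ! * suc (indeg v L) !
        ≡⟨ cong₂ (λ s t → parallel ((a , v) ∷ L) + (s + indeg u L) ! * (t + indeg v L) !) 𝟙-u≟v (𝟙-≟-refl v) ⟨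
      parallel ((a , v) ∷ L) + indeg u ((a , v) ∷ L) ! * indeg v ((a , v) ∷ L) ! ∎

  indeg-terminal : ∀ {L} → All (Terminal ∘ target) L → indeg u L + indeg v L ≡ length L
  indeg-terminal {L} targets = begin
    indeg u L + indeg v L                             ≡⟨ ∑-+ L _ _ ⟨
    ∑[ e ∈ L ] (𝟙 (u ≟ target e) + 𝟙 (v ≟ target e))  ≡⟨ ∑-cong-∈ L (once ∘ All.lookup targets) ⟩
    ∑[ _ ∈ L ] 1                                      ≡⟨ trans (∑-const L 1) (*-identityʳ (length L)) ⟩
    length L                                          ∎
    where
    once : ∀ {x} → Terminal x → 𝟙 (u ≟ x) + 𝟙 (v ≟ x) ≡ 1
    once (inj₁ refl) = cong₂ _+_ (𝟙-≟-refl u) 𝟙-v≟u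
    once (inj₂ refl) = cong₂ _+_ 𝟙-u≟v (𝟙-≟-refl v)

  module _ (κ : Fin q → Fin p) {w : Fin p} (κu≡w : κ u ≡ w) (κv≡w : κ v ≡ w)
    (κ-injective : ∀ {x y} → ¬ Terminal x → κ x ≡ κ y → x ≡ y) where

    contracted : List (Edge q) → ℕ
    contracted L = tours ((w , w) ∷ (w , w) ∷ map (mapEdge κ) L)

    contracted-↭ : ∀ {L M} → L ↭ M → contracted L ≡ contracted M
    contracted-↭ L↭M = tours-↭ (prep (w , w) (prep (w , w) (Perm.map⁺ (mapEdge κ) L↭M)))

    κ-terminal : ∀ {x} → Terminal x → κ x ≡ w
    κ-terminal (inj₁ refl) = κu≡w
    κ-terminal (inj₂ refl) = κv≡w

    contracted-terminal : ∀ {L} → All (Terminal ∘ source) L → All (Terminal ∘ target) L →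
      contracted L ≡ suc (length L) !
    contracted-terminal {L} sources targets =
      trans (cong (λ M → tours ((w , w) ∷ (w , w) ∷ M)) (all-loops sources targets)) (tours-loops w (suc (length L)))
      where
      all-loops : ∀ {L} → All (Terminal ∘ source) L → All (Terminal ∘ target) L →
        map (mapEdge κ) L ≡ replicate (length L) (w , w)
      all-loops []       []       = refl
      all-loops (s ∷ ss) (t ∷ ts) = cong₂ _∷_ (cong₂ _,_ (κ-terminal s) (κ-terminal t)) (all-loops ss ts)

    contracted-merge : ∀ e L → ¬ Terminal (target e) → contracted (e ∷ L) ≡ ∑-merges e L contracted
    contracted-merge e L e-inner = begin
      tours ((w , w) ∷ (w , w) ∷ mapEdge κ e ∷ map (mapEdge κ) L)
        ≡⟨ tours-merge-third-apart (w , w) (w , w) (mapEdge κ e) (map (mapEdge κ) L) κe≢w κe≢w ⟩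
      ∑-merges (mapEdge κ e) (map (mapEdge κ) L) (λ M → tours ((w , w) ∷ (w , w) ∷ M))
        ≡⟨ ∑-picks-map (mapEdge κ) L _ ⟩
      ∑ (picks L) (λ (f , M) → ⟦ mapEdge κ e ↝ mapEdge κ f ⟧ * contracted (e ⋈ f ∷ M))
        ≡⟨ ∑-cong (picks L) (λ (f , M) → cong (_* contracted (e ⋈ f ∷ M))
             (𝟙-⇔ (mk⇔ (κ-injective e-inner) (cong κ)) (κ (target e) ≟ κ (source f)) (target e ≟ source f))) ⟩
      ∑-merges e L contracted ∎
      where
      κe≢w : κ (target e) ≢ w
      κe≢w κe≡w = e-inner (inj₁ (κ-injective e-inner (trans κe≡w (sym κu≡w))))

    -- By the BEST theorem a balanced digraph has τ · Π (deg − 1)! tours, where τ counts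
    -- spanning trees, and τ(G + uv) − τ(G) = τ(G / uv).  Every count below satisfies the same
    -- recurrence at the non-terminal vertices, which reduces the identity to two vertices.
    Contractible : ℕ → ℕ → List (Edge q) → Set
    Contractible i j L = Balanced L → indeg u L ≡ i → indeg v L ≡ j →
      suc (i + j) ! * crossed L ≡ suc (i + j) ! * parallel L + i ! * j ! * contracted L

    Contractible-resp-↭ : ∀ {i j} → Contractible i j Respects _↭_
    Contractible-resp-↭ {i} {j} {L} {M} L↭M contract balanced u-indeg v-indeg = begin
      suc (i + j) ! * crossed M
        ≡⟨ cong (suc (i + j) ! *_) (crossed-↭ L↭M) ⟨
      suc (i + j) ! * crossed L
        ≡⟨ contract (Balanced-resp-↭ (↭-sym L↭M) balanced)
             (trans (indeg-↭ u L↭M) u-indeg) (trans (indeg-↭ v L↭M) v-indeg) ⟩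
      suc (i + j) ! * parallel L + i ! * j ! * contracted L
        ≡⟨ cong₂ (λ s t → suc (i + j) ! * s + i ! * j ! * t) (parallel-↭ L↭M) (contracted-↭ L↭M) ⟩
      suc (i + j) ! * parallel M + i ! * j ! * contracted M ∎

    contract-terminal : ∀ {L} → All (Terminal ∘ target) L → ∀ {i j} → Contractible i j L
    contract-terminal {L} targets balanced refl refl = begin
      scale * crossed L
        ≡⟨ cong (scale *_) (exchange-terminal L balanced targets) ⟩
      scale * (parallel L + gain)
        ≡⟨ *-distribˡ-+ scale (parallel L) gain ⟩
      scale * parallel L + scale * gain
        ≡⟨ cong (scale * parallel L +_) (*-comm scale gain) ⟩
      scale * parallel L + gain * suc (indeg u L + indeg v L) !
        ≡⟨ cong (λ n → scale * parallel L + gain * suc n !) (indeg-terminal targets) ⟩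
      scale * parallel L + gain * suc (length L) !
        ≡⟨ cong (λ c → scale * parallel L + gain * c)
             (contracted-terminal (Balanced⇒sources⊆targets balanced targets) targets) ⟨
      scale * parallel L + gain * contracted L ∎
      where
      scale gain : ℕ
      scale = suc (indeg u L + indeg v L) !
      gain  = indeg u L ! * indeg v L !

    contract-merge : ∀ e L → ¬ Terminal (target e) → ∀ {i j} →
      (∀ M → length M ≤ length L → Contractible i j M) → Contractible i j (e ∷ L)
    contract-merge e L e-inner {i} {j} contract balanced u-indeg v-indeg = begin
      scale * crossed (e ∷ L)
        ≡⟨ cong (scale *_) (tours-merge-third-apart (u , v) (v , u) e L e≢u e≢v) ⟩
      scale * ∑-merges e L crossed
        ≡⟨ ∑-merges-*ˡ scale e L crossed ⟨
      ∑-merges e L (λ M → scale * crossed M)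
        ≡⟨ ∑-merges-cong e L (λ M → scale * crossed M) (λ M → scale * parallel M + gain * contracted M) merged ⟩
      ∑-merges e L (λ M → scale * parallel M + gain * contracted M)
        ≡⟨ ∑-merges-+ e L (λ M → scale * parallel M) (λ M → gain * contracted M) ⟩
      ∑-merges e L (λ M → scale * parallel M) + ∑-merges e L (λ M → gain * contracted M)
        ≡⟨ cong₂ _+_ (∑-merges-*ˡ scale e L parallel) (∑-merges-*ˡ gain e L contracted) ⟩
      scale * ∑-merges e L parallel + gain * ∑-merges e L contracted
        ≡⟨ cong₂ (λ s t → scale * s + gain * t)
             (tours-merge-third-apart (u , u) (v , v) e L e≢u e≢v) (contracted-merge e L e-inner) ⟨
      scale * parallel (e ∷ L) + gain * contracted (e ∷ L) ∎
      where
      scale gain : ℕ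
      scale = suc (i + j) !
      gain  = i ! * j !
      e≢u : target e ≢ u
      e≢u = e-inner ∘ inj₁
      e≢v : target e ≢ v
      e≢v = e-inner ∘ inj₂
      merged-indeg : ∀ {x d t M} → target e ≢ x → indeg x (e ∷ L) ≡ d → L ↭ (target e , t) ∷ M →
        indeg x ((source e , t) ∷ M) ≡ d
      merged-indeg {x} e≢x x-indeg L↭ = trans (sym (indeg-↭ x L↭))
        (trans (cong (_+ indeg x L) (sym (𝟙-false (x ≟ target e) (e≢x ∘ sym)))) x-indeg)
      merged : ∀ t M → L ↭ (target e , t) ∷ M →
        scale * crossed ((source e , t) ∷ M) ≡
        scale * parallel ((source e , t) ∷ M) + gain * contracted ((source e , t) ∷ M)
      merged t M L↭ = contract ((source e , t) ∷ M) (≤-reflexive (sym (Perm.↭-length L↭)))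
        (Balanced-merge (Balanced-resp-↭ (prep e L↭) balanced))
        (merged-indeg e≢u u-indeg L↭) (merged-indeg e≢v v-indeg L↭)

    contract : ∀ i j L → Contractible i j L
    contract i j = All-or-pick-induction (terminal? ∘ target) Contractible-resp-↭
      (λ targets → contract-terminal targets) (λ e L e-inner → contract-merge e L e-inner)

-- Coloured permutations

edges : (Fin n → Fin n) → Vec (Fin q) n → List (Edge q)
edges π f = tabulate (λ x → lookup f (π x) , lookup f x)

edges-balanced : {π : Fin n → Fin n} → Injective _≡_ _≡_ π → (f : Vec (Fin q) n) → Balanced (edges π f)
edges-balanced {n} {q} {π} π-injective f .Balanced.outdeg≡indeg w = begin
  outdeg w (edges π f)
    ≡⟨ ∑-tabulate edge (λ e → 𝟙 (w ≟ source e)) ⟩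
  ∑[ x ∈ allFin n ] 𝟙 (w ≟ lookup f (π x))
    ≡⟨ ∑-reindex π (Uniq.allFin⁺ n) ∈-allFin π-injective (λ x → 𝟙 (w ≟ lookup f x)) ⟩
  ∑[ x ∈ allFin n ] 𝟙 (w ≟ lookup f x)
    ≡⟨ ∑-tabulate edge (λ e → 𝟙 (w ≟ target e)) ⟨
  indeg w (edges π f) ∎
  where
  edge : Fin n → Edge q
  edge x = lookup f (π x) , lookup f x

edges-map : (κ : Fin q → Fin p) (π : Fin n → Fin n) (f : Vec (Fin q) n) →
  edges π (Vec.map κ f) ≡ map (mapEdge κ) (edges π f)
edges-map κ π f = trans
  (tabulate-cong (λ x → cong₂ _,_ (VecP.lookup-map (π x) κ f) (VecP.lookup-map x κ f)))
  (sym (map-tabulate (λ x → lookup f (π x) , lookup f x) (mapEdge κ)))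

multiplicity : Fin q → Vec (Fin q) n → ℕ
multiplicity w f = ∑[ x ∈ Vec.toList f ] 𝟙 (w ≟ x)

indeg-tabulate : (w : Fin q) (g : Fin n → Fin q) (f : Vec (Fin q) n) →
  indeg w (tabulate (λ x → g x , lookup f x)) ≡ multiplicity w f
indeg-tabulate w g []      = refl
indeg-tabulate w g (x ∷ f) = cong (𝟙 (w ≟ x) +_) (indeg-tabulate w (g ∘ suc) f)

identify : Fin (suc q) → Fin q → Fin (suc q) → Fin q
identify v w x with v ≟ x
... | yes _   = w
... | no  v≢x = punchOut v≢x

identify-v : (v : Fin (suc q)) (w : Fin q) → identify v w v ≡ w
identify-v v w with v ≟ v
... | yes _  = refl
... | no v≢v = contradiction refl v≢v

identify-punchIn : (v : Fin (suc q)) (w z : Fin q) → identify v w (punchIn v z) ≡ z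
identify-punchIn v w z with v ≟ punchIn v z
... | yes v≡ = contradiction (sym v≡) (punchInᵢ≢i v z)
... | no  v≢ = trans (punchOut-cong v refl) (punchOut-punchIn v)

identify-injective : (v : Fin (suc q)) (w : Fin q) → ∀ {x y} → ¬ (x ≡ punchIn v w ⊎ x ≡ v) →
  identify v w x ≡ identify v w y → x ≡ y
identify-injective v w {x} {y} x-apart x≈y with v ≟ x | v ≟ y
... | yes v≡x | _      = contradiction (inj₂ (sym v≡x)) x-apart
... | no  v≢x | no v≢y = punchOut-injective v≢x v≢y x≈y
... | no  v≢x | yes _  =
  contradiction (inj₁ (trans (sym (punchIn-punchOut v≢x)) (cong (punchIn v) x≈y))) x-apart

colouringFibre : (Fin p → Fin q) → Vec (Fin q) n → List (Vec (Fin p) n)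
colouringFibre κ = fibre (VecP.≡-dec _≟_) (Vec.map κ) (allVecs _ _)

∈-colouringFibre⁻ : {κ : Fin p → Fin q} {g : Vec (Fin q) n} {f : Vec (Fin p) n} →
  f ∈ colouringFibre κ g → g ≡ Vec.map κ f
∈-colouringFibre⁻ {κ = κ} {g} f∈ =
  proj₂ (∈-filter⁻ (λ f → VecP.≡-dec _≟_ g (Vec.map κ f)) {xs = allVecs _ _} f∈)

∑-colouringFibre-∷ :
  (κ : Fin p → Fin q) (z : Fin q) (g : Vec (Fin q) n) (φ : Vec (Fin p) (suc n) → ℕ) →
  ∑ (colouringFibre κ (z ∷ g)) φ ≡
  ∑[ x ∈ fibre _≟_ κ (allFin p) z ] ∑[ f ∈ colouringFibre κ g ] φ (x ∷ f)
∑-colouringFibre-∷ {p} {q} {n} κ z g φ = begin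
  ∑ (colouringFibre κ (z ∷ g)) φ
    ≡⟨ ∑-filter (λ f → (z ∷ g) ≟ᵥ Vec.map κ f) (allVecs p (suc n)) φ ⟩
  ∑[ f ∈ allVecs p (suc n) ] (𝟙 ((z ∷ g) ≟ᵥ Vec.map κ f) * φ f)
    ≡⟨ ∑-allVecs-∷ p n _ ⟩
  ∑[ x ∈ allFin p ] ∑[ f ∈ allVecs p n ] (𝟙 ((z ∷ g) ≟ᵥ (κ x ∷ Vec.map κ f)) * φ (x ∷ f))
    ≡⟨ ∑-cong (allFin p) (λ x →
         trans (∑-cong (allVecs p n) (λ f → split x f)) (∑-*ˡ (𝟙 (z ≟ κ x)) (allVecs p n) _)) ⟩
  ∑[ x ∈ allFin p ] (𝟙 (z ≟ κ x) * (∑[ f ∈ allVecs p n ] (𝟙 (g ≟ᵥ Vec.map κ f) * φ (x ∷ f))))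
    ≡⟨ ∑-cong (allFin p) (λ x →
         cong (𝟙 (z ≟ κ x) *_) (∑-filter (λ f → g ≟ᵥ Vec.map κ f) (allVecs p n) (φ ∘ (x ∷_)))) ⟨
  ∑[ x ∈ allFin p ] (𝟙 (z ≟ κ x) * (∑[ f ∈ colouringFibre κ g ] φ (x ∷ f)))
    ≡⟨ ∑-filter (λ x → z ≟ κ x) (allFin p) _ ⟨
  ∑[ x ∈ fibre _≟_ κ (allFin p) z ] ∑[ f ∈ colouringFibre κ g ] φ (x ∷ f) ∎
  where
  _≟ᵥ_ : DecidableEquality (Vec (Fin q) m)
  _≟ᵥ_ = VecP.≡-dec _≟_
  split : ∀ x f → 𝟙 ((z ∷ g) ≟ᵥ (κ x ∷ Vec.map κ f)) * φ (x ∷ f) ≡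
    𝟙 (z ≟ κ x) * (𝟙 (g ≟ᵥ Vec.map κ f) * φ (x ∷ f))
  split x f = begin
    𝟙 ((z ∷ g) ≟ᵥ (κ x ∷ Vec.map κ f)) * φ (x ∷ f)
      ≡⟨ cong (_* φ (x ∷ f)) (𝟙-⇔ (mk⇔ VecP.∷-injective (λ (z≡ , g≡) → cong₂ _∷_ z≡ g≡))
           ((z ∷ g) ≟ᵥ (κ x ∷ Vec.map κ f)) ((z ≟ κ x) ×-dec (g ≟ᵥ Vec.map κ f))) ⟩
    𝟙 ((z ≟ κ x) ×-dec (g ≟ᵥ Vec.map κ f)) * φ (x ∷ f)
      ≡⟨ cong (_* φ (x ∷ f)) (𝟙-×-dec (z ≟ κ x) (g ≟ᵥ Vec.map κ f)) ⟩
    𝟙 (z ≟ κ x) * 𝟙 (g ≟ᵥ Vec.map κ f) * φ (x ∷ f)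
      ≡⟨ *-assoc (𝟙 (z ≟ κ x)) _ _ ⟩
    𝟙 (z ≟ κ x) * (𝟙 (g ≟ᵥ Vec.map κ f) * φ (x ∷ f)) ∎

module Identification (v : Fin (suc q)) (w : Fin q) where

  u : Fin (suc q)
  u = punchIn v w

  u≢v : u ≢ v
  u≢v = punchInᵢ≢i v w

  κ : Fin (suc q) → Fin q
  κ = identify v w

  open Exchange u≢v

  𝟙-identify : ∀ x → 𝟙 (w ≟ κ x) ≡ 𝟙 (u ≟ x) + 𝟙 (v ≟ x)
  𝟙-identify x with v ≟ x
  ... | yes refl = trans (𝟙-≟-refl w) (sym (cong (_+ 1) 𝟙-u≟v))
  ... | no v≢x   = trans (𝟙-⇔ (mk⇔ to from) (w ≟ punchOut v≢x) (u ≟ x)) (sym (+-identityʳ (𝟙 (u ≟ x))))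
    where
    to : w ≡ punchOut v≢x → u ≡ x
    to w≡ = trans (cong (punchIn v) w≡) (punchIn-punchOut v≢x)
    from : u ≡ x → w ≡ punchOut v≢x
    from u≡x = punchIn-injective v w (punchOut v≢x) (trans u≡x (sym (punchIn-punchOut v≢x)))

  multiplicity-identify : (f : Vec (Fin (suc q)) n) →
    multiplicity w (Vec.map κ f) ≡ multiplicity u f + multiplicity v f
  multiplicity-identify []      = refl
  multiplicity-identify (x ∷ f) = trans (cong₂ _+_ (𝟙-identify x) (multiplicity-identify f))
    (+-interchange (𝟙 (u ≟ x)) (𝟙 (v ≟ x)) (multiplicity u f) (multiplicity v f))

  ∑-fibre-identify : (z : Fin q) (φ : Fin (suc q) → ℕ) →
    ∑ (fibre _≟_ κ (allFin (suc q)) z) φ ≡ 𝟙 (w ≟ z) * φ v + φ (punchIn v z)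
  ∑-fibre-identify z φ = begin
    ∑ (fibre _≟_ κ (allFin (suc q)) z) φ
      ≡⟨ trans (∑-filter (λ x → z ≟ κ x) (allFin (suc q)) φ) (∑-punchIn v _) ⟩
    𝟙 (z ≟ κ v) * φ v + (∑[ y ∈ allFin q ] (𝟙 (z ≟ κ (punchIn v y)) * φ (punchIn v y)))
      ≡⟨ cong₂ _+_ (cong (_* φ v) (𝟙-⇔ z≡κv⇔w≡z (z ≟ κ v) (w ≟ z)))
           (∑-𝟙-unique (λ y → z ≟ κ (punchIn v y)) (Uniq.allFin⁺ q) (∈-allFin z)
             (sym (identify-punchIn v w z)) (λ {y} z≡ → sym (trans z≡ (identify-punchIn v w y))) (φ ∘ punchIn v)) ⟩
    𝟙 (w ≟ z) * φ v + φ (punchIn v z) ∎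
    where
    z≡κv⇔w≡z : z ≡ κ v ⇔ w ≡ z
    z≡κv⇔w≡z = mk⇔ (λ z≡κv → sym (trans z≡κv (identify-v v w))) (λ w≡z → sym (trans (identify-v v w) w≡z))

  -- Pólya's urn: a pair of linear orders on the elements coloured u and on those coloured v
  -- can be extended by a new element in i + j + 2 ways.
  ∑-colouringFibre-! : (g : Vec (Fin q) n) →
    ∑[ f ∈ colouringFibre κ g ] (multiplicity u f ! * multiplicity v f !) ≡ suc (multiplicity w g) !
  ∑-colouringFibre-! []      = refl
  ∑-colouringFibre-! (z ∷ g) = begin
    ∑[ f ∈ colouringFibre κ (z ∷ g) ] (multiplicity u f ! * multiplicity v f !)
      ≡⟨ trans (∑-colouringFibre-∷ κ z g _) (∑-fibre-identify z ψ) ⟩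
    𝟙 (w ≟ z) * ψ v + ψ (punchIn v z)
      ≡⟨ extend (w ≟ z) ⟩
    suc (multiplicity w (z ∷ g)) ! ∎
    where
    ψ : Fin (suc q) → ℕ
    ψ x = ∑[ f ∈ colouringFibre κ g ] (multiplicity u (x ∷ f) ! * multiplicity v (x ∷ f) !)
    N : ℕ
    N = multiplicity w g

    ψ-≡ : ∀ {x i j} → 𝟙 (u ≟ x) ≡ i → 𝟙 (v ≟ x) ≡ j →
      ψ x ≡ ∑[ f ∈ colouringFibre κ g ] ((i + multiplicity u f) ! * (j + multiplicity v f) !)
    ψ-≡ u≟x v≟x = ∑-cong (colouringFibre κ g) (λ f →
      cong₂ (λ i j → (i + multiplicity u f) ! * (j + multiplicity v f) !) u≟x v≟x)

    insertions : ∀ {f} → f ∈ colouringFibre κ g → let i = multiplicity u f ; j = multiplicity v f in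
      i ! * suc j ! + suc i ! * j ! ≡ (2 + N) * (i ! * j !)
    insertions {f} f∈ with refl ← ∈-colouringFibre⁻ f∈ = trans
      (factor (multiplicity u f) (multiplicity v f) (multiplicity u f !) (multiplicity v f !))
      (cong (λ n → (2 + n) * (multiplicity u f ! * multiplicity v f !)) (sym (multiplicity-identify f)))
      where
      factor : ∀ i j i! j! → i! * (suc j * j!) + suc i * i! * j! ≡ (2 + (i + j)) * (i! * j!)
      factor = solve-∀

    extend : (w≟z : Dec (w ≡ z)) → 𝟙 w≟z * ψ v + ψ (punchIn v z) ≡ suc (𝟙 w≟z + N) !
    extend (no w≢z) = trans
      (ψ-≡ (𝟙-false (u ≟ punchIn v z) (w≢z ∘ punchIn-injective v w z))
        (𝟙-false (v ≟ punchIn v z) (punchInᵢ≢i v z ∘ sym)))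
      (∑-colouringFibre-! g)
    extend (yes refl) = begin
      1 * ψ v + ψ u
        ≡⟨ cong₂ _+_ (trans (*-identityˡ (ψ v)) (ψ-≡ 𝟙-u≟v (𝟙-≟-refl v))) (ψ-≡ (𝟙-≟-refl u) 𝟙-v≟u) ⟩
      ∑ (colouringFibre κ g) (λ f → multiplicity u f ! * suc (multiplicity v f) !)
        + ∑ (colouringFibre κ g) (λ f → suc (multiplicity u f) ! * multiplicity v f !)
        ≡⟨ ∑-+ (colouringFibre κ g) _ _ ⟨
      ∑[ f ∈ colouringFibre κ g ]
        (multiplicity u f ! * suc (multiplicity v f) ! + suc (multiplicity u f) ! * multiplicity v f !)
        ≡⟨ ∑-cong-∈ (colouringFibre κ g) insertions ⟩
      ∑[ f ∈ colouringFibre κ g ] ((2 + N) * (multiplicity u f ! * multiplicity v f !))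
        ≡⟨ trans (∑-*ˡ (2 + N) (colouringFibre κ g) _) (cong ((2 + N) *_) (∑-colouringFibre-! g)) ⟩
      (2 + N) ! ∎

  module _ {ρ : Fin n → Fin n} (ρ-injective : Injective _≡_ _≡_ ρ) where

    merged : Vec (Fin q) n → ℕ
    merged g = tours ((w , w) ∷ (w , w) ∷ edges ρ g)

    exchange-edges : ∀ {g f} → f ∈ colouringFibre κ g →
      suc (multiplicity w g) ! * crossed (edges ρ f) ≡
      suc (multiplicity w g) ! * parallel (edges ρ f) + multiplicity u f ! * multiplicity v f ! * merged g
    exchange-edges {f = f} f∈ with refl ← ∈-colouringFibre⁻ f∈ = begin
      suc (multiplicity w (Vec.map κ f)) ! * crossed (edges ρ f)
        ≡⟨ cong (λ n → suc n ! * crossed (edges ρ f)) (multiplicity-identify f) ⟩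
      suc (i + j) ! * crossed (edges ρ f)
        ≡⟨ contract κ (identify-punchIn v w w) (identify-v v w) (identify-injective v w) i j (edges ρ f)
             (edges-balanced ρ-injective f) (indeg-tabulate u (lookup f ∘ ρ) f) (indeg-tabulate v (lookup f ∘ ρ) f) ⟩
      suc (i + j) ! * parallel (edges ρ f) + i ! * j ! * tours ((w , w) ∷ (w , w) ∷ map (mapEdge κ) (edges ρ f))
        ≡⟨ cong₂ (λ n L → suc n ! * parallel (edges ρ f) + i ! * j ! * tours ((w , w) ∷ (w , w) ∷ L))
             (multiplicity-identify f) (edges-map κ ρ f) ⟨
      suc (multiplicity w (Vec.map κ f)) ! * parallel (edges ρ f) + i ! * j ! * merged (Vec.map κ f) ∎
      where
      i j : ℕ
      i = multiplicity u f
      j = multiplicity v f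

    ∑-colouringFibre-exchange : (g : Vec (Fin q) n) →
      ∑[ f ∈ colouringFibre κ g ] crossed (edges ρ f) ≡
      ∑ (colouringFibre κ g) (λ f → parallel (edges ρ f)) + merged g
    ∑-colouringFibre-exchange g = *-cancelˡ-≡ _ _ scale {{suc (multiplicity w g) !≢0}} (begin
      scale * ∑ lifts (λ f → crossed (edges ρ f))
        ≡⟨ ∑-*ˡ scale lifts _ ⟨
      ∑[ f ∈ lifts ] (scale * crossed (edges ρ f))
        ≡⟨ ∑-cong-∈ lifts exchange-edges ⟩
      ∑[ f ∈ lifts ] (scale * parallel (edges ρ f) + multiplicity u f ! * multiplicity v f ! * merged g)
        ≡⟨ ∑-+ lifts _ _ ⟩
      ∑ lifts (λ f → scale * parallel (edges ρ f)) + ∑ lifts (λ f → multiplicity u f ! * multiplicity v f ! * merged g)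
        ≡⟨ cong₂ _+_ (∑-*ˡ scale lifts _)
             (trans (∑-*ʳ (merged g) lifts _) (cong (_* merged g) (∑-colouringFibre-! g))) ⟩
      scale * ∑ lifts (λ f → parallel (edges ρ f)) + scale * merged g
        ≡⟨ *-distribˡ-+ scale _ (merged g) ⟨
      scale * (∑ lifts (λ f → parallel (edges ρ f)) + merged g) ∎)
      where
      lifts : List (Vec (Fin (suc q)) n)
      lifts = colouringFibre κ g
      scale : ℕ
      scale = suc (multiplicity w g) !

    ∑-exchange : ∑[ f ∈ allVecs (suc q) n ] crossed (edges ρ f) ≡
      ∑ (allVecs (suc q) n) (λ f → parallel (edges ρ f)) + ∑ (allVecs q n) merged
    ∑-exchange = begin
      ∑ (allVecs (suc q) n) (λ f → crossed (edges ρ f))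
        ≡⟨ ∑-over-fibres _ ⟩
      ∑[ g ∈ allVecs q n ] ∑ (colouringFibre κ g) (λ f → crossed (edges ρ f))
        ≡⟨ ∑-cong (allVecs q n) ∑-colouringFibre-exchange ⟩
      ∑[ g ∈ allVecs q n ] (∑ (colouringFibre κ g) (λ f → parallel (edges ρ f)) + merged g)
        ≡⟨ ∑-+ (allVecs q n) _ _ ⟩
      ∑ (allVecs q n) (λ g → ∑ (colouringFibre κ g) (λ f → parallel (edges ρ f))) + ∑ (allVecs q n) merged
        ≡⟨ cong (_+ ∑ (allVecs q n) merged) (∑-over-fibres _) ⟨
      ∑ (allVecs (suc q) n) (λ f → parallel (edges ρ f)) + ∑ (allVecs q n) merged ∎
      where
      ∑-over-fibres : (φ : Vec (Fin (suc q)) n → ℕ) →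
        ∑ (allVecs (suc q) n) φ ≡ ∑[ g ∈ allVecs q n ] ∑ (colouringFibre κ g) φ
      ∑-over-fibres = ∑-fibres (VecP.≡-dec _≟_) (Vec.map κ) (allVecs (suc q) n)
        (allVecs-unique q n) (∈-allVecs ∘ Vec.map κ)

∑-exchange-all : {ρ : Fin n → Fin n} → Injective _≡_ _≡_ ρ → ∀ q →
  ∑[ y ∈ allFin (suc q) ] ∑[ x ∈ allFin (suc q) ] ∑[ f ∈ allVecs (suc q) n ]
    tours ((x , y) ∷ (y , x) ∷ edges ρ f) ≡
  (∑[ y ∈ allFin (suc q) ] ∑[ x ∈ allFin (suc q) ] ∑[ f ∈ allVecs (suc q) n ]
    tours ((x , x) ∷ (y , y) ∷ edges ρ f))
  + suc q * (∑[ z ∈ allFin q ] ∑[ g ∈ allVecs q n ] tours ((z , z) ∷ (z , z) ∷ edges ρ g))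
∑-exchange-all {n} {ρ} ρ-injective q = begin
  ∑[ y ∈ colours ] ∑[ x ∈ colours ] crossed x y
    ≡⟨ ∑-cong colours column ⟩
  ∑[ y ∈ colours ] (∑ colours (λ x → parallel x y) + diagonal)
    ≡⟨ ∑-+ colours (λ y → ∑ colours (λ x → parallel x y)) (λ _ → diagonal) ⟩
  parallels + (∑[ _ ∈ colours ] diagonal)
    ≡⟨ cong (parallels +_) (trans (∑-const colours diagonal) (cong (_* diagonal) (length-allFin (suc q)))) ⟩
  parallels + suc q * diagonal ∎
  where
  colours : List (Fin (suc q))
  colours = allFin (suc q)
  crossed parallel : Fin (suc q) → Fin (suc q) → ℕ
  crossed  x y = ∑[ f ∈ allVecs (suc q) n ] tours ((x , y) ∷ (y , x) ∷ edges ρ f)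
  parallel x y = ∑[ f ∈ allVecs (suc q) n ] tours ((x , x) ∷ (y , y) ∷ edges ρ f)
  parallels diagonal : ℕ
  parallels = ∑[ y ∈ colours ] ∑[ x ∈ colours ] parallel x y
  diagonal = ∑[ z ∈ allFin q ] ∑[ g ∈ allVecs q n ] tours ((z , z) ∷ (z , z) ∷ edges ρ g)

  column : ∀ y → ∑ colours (λ x → crossed x y) ≡ ∑ colours (λ x → parallel x y) + diagonal
  column y = begin
    ∑ colours (λ x → crossed x y)
      ≡⟨ ∑-punchIn y (λ x → crossed x y) ⟩
    parallel y y + (∑[ z ∈ allFin q ] crossed (punchIn y z) y)
      ≡⟨ cong (parallel y y +_) (trans
           (∑-cong (allFin q) (λ z → Identification.∑-exchange y z ρ-injective)) (∑-+ (allFin q) _ _)) ⟩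
    parallel y y + ((∑[ z ∈ allFin q ] parallel (punchIn y z) y) + diagonal)
      ≡⟨ +-assoc (parallel y y) _ diagonal ⟨
    parallel y y + (∑[ z ∈ allFin q ] parallel (punchIn y z) y) + diagonal
      ≡⟨ cong (_+ diagonal) (∑-punchIn y (λ x → parallel x y)) ⟨
    ∑ colours (λ x → parallel x y) + diagonal ∎

-- Full cycles as Eulerian tours

iter-+ : (η : Map n) (i j : ℕ) (x : Fin n) → iter η (i + j) x ≡ iter η i (iter η j x)
iter-+ η zero    j x = refl
iter-+ η (suc i) j x = cong η (iter-+ η i j x)

iter-suc : (η : Map n) (j : ℕ) (x : Fin n) → iter η (suc j) x ≡ iter η j (η x)
iter-suc η zero    x = refl
iter-suc η (suc j) x = cong η (iter-suc η j x)

map-proj₁-picks : (xs : List A) → map proj₁ (picks xs) ≡ xs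
map-proj₁-picks []       = refl
map-proj₁-picks (x ∷ xs) = cong (x ∷_) (trans (sym (map-∘ (picks xs))) (map-proj₁-picks xs))

∈⇒∈-picks : {x : A} {xs : List A} → x ∈ xs → ∃ λ ys → (x , ys) ∈ picks xs
∈⇒∈-picks {x = x} {xs} x∈xs
  with (_ , ys) , p , refl ← ∈-map⁻ proj₁ (subst (x ∈_) (sym (map-proj₁-picks xs)) x∈xs) = ys , p

arrangements : ℕ → List A → List (List A)
arrangements zero    xs = [] ∷ []
arrangements (suc k) xs = concatMap (λ (x , ys) → map (x ∷_) (arrangements k ys)) (picks xs)

∈-arrangements⇒↭ : (k : ℕ) {xs o : List A} → length xs ≡ k → o ∈ arrangements k xs → o ↭ xs
∈-arrangements⇒↭ zero    {[]} _    (here refl) = ↭-refl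
∈-arrangements⇒↭ (suc k) {xs} ∣xs∣≡1+k o∈
  with (x , ys) , p , xo∈ ← find (∈-concatMap⁻ (λ (x , ys) → map (x ∷_) (arrangements k ys)) {xs = picks xs} o∈)
  with o , o∈′ , refl ← ∈-map⁻ (x ∷_) xo∈ =
  ↭-trans (prep x (∈-arrangements⇒↭ k (suc-injective (trans (sym (Perm.↭-length (picks-↭ p))) ∣xs∣≡1+k)) o∈′))
    (↭-sym (picks-↭ p))

↭⇒∈-arrangements : (o : List A) {xs : List A} → o ↭ xs → o ∈ arrangements (length o) xs
↭⇒∈-arrangements []      o↭xs = here refl
↭⇒∈-arrangements (x ∷ o) o↭xs with ys , p ← ∈⇒∈-picks (Perm.∈-resp-↭ o↭xs (here refl)) =
  ∈-concatMap⁺ _ (lose p (∈-map⁺ (x ∷_) (↭⇒∈-arrangements o (Perm.drop-∷ (↭-trans o↭xs (picks-↭ p))))))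

arrangements-unique : (k : ℕ) {xs : List A} → Unique xs → Unique (arrangements k xs)
arrangements-unique zero    xs! = [] ∷ []
arrangements-unique (suc k) {xs} xs! = concatMap-unique _ (Uniq.map⁻ picks!)
  (λ p → Uniq.map⁺ ∷-injectiveʳ (arrangements-unique k (tail (Unique-resp-↭ (picks-↭ p) xs!))))
  (λ p p′ o∈ o∈′ → let (_ , _ , o≡) = ∈-map⁻ _ o∈ ; (_ , _ , o≡′) = ∈-map⁻ _ o∈′ in
    unique-map⇒injective proj₁ picks! p p′ (∷-injectiveˡ (trans (sym o≡) o≡′)))
  where
  picks! : Unique (map proj₁ (picks xs))
  picks! = subst Unique (sym (map-proj₁-picks xs)) xs!
  tail : ∀ {x} {ys : List _} → Unique (x ∷ ys) → Unique ys
  tail (_ ∷ ys!) = ys!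

Chain : (A → A → Set) → A → List A → A → Set
Chain R x []      z = R x z
Chain R x (y ∷ o) z = R x y × Chain R y o z

chain? : {R : A → A → Set} → (∀ x y → Dec (R x y)) → ∀ x o z → Dec (Chain R x o z)
chain? R? x []      z = R? x z
chain? R? x (y ∷ o) z = R? x y ×-dec chain? R? y o z

module _ (g f : Fin n → Fin q) where

  Follows : Fin n → Fin n → Set
  Follows x y = f x ≡ g y

  follows? : ∀ x y → Dec (Follows x y)
  follows? x y = f x ≟ g y

  private
    edge : Fin n → Edge q
    edge x = g x , f x

  toursₖ-chains : ∀ k x z (L : List (Fin n)) →
    toursₖ k ((g z , f x) ∷ map edge L) ≡ ∑[ o ∈ arrangements k L ] 𝟙 (chain? follows? x o z)
  toursₖ-chains zero    x z L = sym (+-identityʳ _)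
  toursₖ-chains (suc k) x z L = begin
    ∑-merges (g z , f x) (map edge L) (toursₖ k)
      ≡⟨ ∑-picks-map edge L _ ⟩
    ∑ (picks L) (λ (y , M) → 𝟙 (f x ≟ g y) * toursₖ k ((g z , f y) ∷ map edge M))
      ≡⟨ ∑-cong (picks L) (λ (y , M) → first-step y M) ⟩
    ∑ (picks L) (λ (y , M) → ∑[ o ∈ map (y ∷_) (arrangements k M) ] 𝟙 (chain? follows? x o z))
      ≡⟨ ∑-concatMap _ (picks L) _ ⟨
    ∑[ o ∈ arrangements (suc k) L ] 𝟙 (chain? follows? x o z) ∎
    where
    first-step : ∀ y M → 𝟙 (f x ≟ g y) * toursₖ k ((g z , f y) ∷ map edge M) ≡
      ∑[ o ∈ map (y ∷_) (arrangements k M) ] 𝟙 (chain? follows? x o z)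
    first-step y M = begin
      𝟙 (f x ≟ g y) * toursₖ k ((g z , f y) ∷ map edge M)
        ≡⟨ cong (𝟙 (f x ≟ g y) *_) (toursₖ-chains k y z M) ⟩
      𝟙 (f x ≟ g y) * ∑ (arrangements k M) (λ o → 𝟙 (chain? follows? y o z))
        ≡⟨ ∑-*ˡ (𝟙 (f x ≟ g y)) (arrangements k M) _ ⟨
      ∑[ o ∈ arrangements k M ] (𝟙 (f x ≟ g y) * 𝟙 (chain? follows? y o z))
        ≡⟨ ∑-cong (arrangements k M) (λ o → 𝟙-×-dec (f x ≟ g y) (chain? follows? y o z)) ⟨
      ∑[ o ∈ arrangements k M ] 𝟙 (chain? follows? x (y ∷ o) z)
        ≡⟨ ∑-map (y ∷_) (arrangements k M) _ ⟨
      ∑[ o ∈ map (y ∷_) (arrangements k M) ] 𝟙 (chain? follows? x o z) ∎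

  tours-chains : ∀ x (L : List (Fin n)) →
    tours (map edge (x ∷ L)) ≡ ∑[ o ∈ arrangements (length L) L ] 𝟙 (chain? follows? x o x)
  tours-chains x L =
    trans (cong (λ k → toursₖ k (map edge (x ∷ L))) (length-map edge L)) (toursₖ-chains (length L) x x L)

Step : Map n → Fin n → Fin n → Set
Step η x y = η x ≡ y

trail : Map n → ℕ → Fin n → List (Fin n)
trail η zero    x = []
trail η (suc k) x = η x ∷ trail η k (η x)

length-trail : (η : Map n) (k : ℕ) (x : Fin n) → length (trail η k x) ≡ k
length-trail η zero    x = refl
length-trail η (suc k) x = cong suc (length-trail η k (η x))

trail-iter : (η : Map n) (k : ℕ) (x : Fin n) → map (λ i → iter η (suc i) x) (upTo k) ≡ trail η k x
trail-iter η zero    x = refl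
trail-iter η (suc k) x = cong (η x ∷_) (begin
  map (λ i → iter η (suc i) x) (applyUpTo suc k)  ≡⟨ map-applyUpTo suc (λ i → iter η (suc i) x) k ⟩
  applyUpTo (λ i → iter η (2 + i) x) k            ≡⟨ map-applyUpTo id (λ i → iter η (2 + i) x) k ⟨
  map (λ i → iter η (2 + i) x) (upTo k)           ≡⟨ map-cong (λ i → iter-suc η (suc i) x) (upTo k) ⟩
  map (λ i → iter η (suc i) (η x)) (upTo k)       ≡⟨ trail-iter η k (η x) ⟩
  trail η k (η x)                                 ∎)

trail-Chain⁺ : {R : Fin n → Fin n → Set} (η : Map n) (k : ℕ) (x : Fin n) →
  All (λ y → R y (η y)) (x ∷ trail η k x) → Chain R x (trail η k x) (iter η (suc k) x)
trail-Chain⁺ η zero    x (r ∷ []) = r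
trail-Chain⁺ {R = R} η (suc k) x (r ∷ rs) =
  r , subst (Chain R (η x) (trail η k (η x))) (sym (iter-suc η (suc k) x)) (trail-Chain⁺ η k (η x) rs)

trail-Chain⁻ : {R : Fin n → Fin n → Set} (η : Map n) (k : ℕ) (x : Fin n) →
  Chain R x (trail η k x) (iter η (suc k) x) → All (λ y → R y (η y)) (x ∷ trail η k x)
trail-Chain⁻ η zero    x r       = r ∷ []
trail-Chain⁻ {R = R} η (suc k) x (r , c) =
  r ∷ trail-Chain⁻ η k (η x) (subst (Chain R (η x) (trail η k (η x))) (iter-suc η (suc k) x) c)

Chain-Step⇒trail : (η : Map n) (o : List (Fin n)) {x z : Fin n} → Chain (Step η) x o z →
  o ≡ trail η (length o) x × iter η (suc (length o)) x ≡ z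
Chain-Step⇒trail η []      closes = refl , closes
Chain-Step⇒trail η (y ∷ o) {x} (refl , c) = let (o≡ , closes) = Chain-Step⇒trail η o c in
  cong (η x ∷_) o≡ , trans (iter-suc η (suc (length o)) x) closes

thread : Fin n → List (Fin n) → Fin n → Vec (Fin n) n → Vec (Fin n) n
thread x []      z v = v [ x ]≔ z
thread x (y ∷ o) z v = thread y o z v [ x ]≔ y

Chain-update : (v : Vec (Fin n) n) {x w y z : Fin n} (o : List (Fin n)) → x ∉ y ∷ o →
  Chain (Step (lookup v)) y o z → Chain (Step (lookup (v [ x ]≔ w))) y o z
Chain-update v []      x∉ s       = trans (VecP.lookup∘update′ (x∉ ∘ here ∘ sym) v _) s
Chain-update v (_ ∷ o) x∉ (s , c) =
  trans (VecP.lookup∘update′ (x∉ ∘ here ∘ sym) v _) s , Chain-update v o (x∉ ∘ there) c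

Chain-thread : (x : Fin n) (o : List (Fin n)) (z : Fin n) (v : Vec (Fin n) n) → Unique (x ∷ o) →
  Chain (Step (lookup (thread x o z v))) x o z
Chain-thread x []      z v _              = VecP.lookup∘update x v z
Chain-thread x (y ∷ o) z v (x∉ ∷ y∷o!) = VecP.lookup∘update x (thread y o z v) y ,
  Chain-update (thread y o z v) o (λ x∈ → All.lookup x∉ x∈ refl) (Chain-thread y o z v y∷o!)

orbit-trail : (ζ : Map (suc m)) → map (λ i → iter ζ i zero) (upTo (suc m)) ≡ zero ∷ trail ζ m zero
orbit-trail {m} ζ = cong (zero ∷_) (begin
  map (λ i → iter ζ i zero) (applyUpTo suc m)  ≡⟨ map-applyUpTo suc (λ i → iter ζ i zero) m ⟩
  applyUpTo (λ i → iter ζ (suc i) zero) m      ≡⟨ map-applyUpTo id (λ i → iter ζ (suc i) zero) m ⟨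
  map (λ i → iter ζ (suc i) zero) (upTo m)     ≡⟨ trail-iter ζ m zero ⟩
  trail ζ m zero                               ∎)

module FullCycle {ζ : Map (suc m)} (ζ-full : IsFullCycle ζ) where

  trail-covers : zero ∷ trail ζ m zero ↭ allFin (suc m)
  trail-covers = unique-⊆⇒↭ (subst Unique (orbit-trail ζ) (proj₁ ζ-full)) (λ {x} _ → ∈-allFin x)
    (≤-reflexive (trans (length-allFin (suc m)) (cong suc (sym (length-trail ζ m zero)))))

  ∈-trail : ∀ x → x ∈ zero ∷ trail ζ m zero
  ∈-trail x = Perm.∈-resp-↭ (↭-sym trail-covers) (∈-allFin x)

  Chain⁺ : {R : Fin (suc m) → Fin (suc m) → Set} →
    (∀ x → R x (ζ x)) → Chain R zero (trail ζ m zero) zero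
  Chain⁺ {R} r = subst (Chain R zero (trail ζ m zero)) (proj₂ ζ-full)
    (trail-Chain⁺ ζ m zero (All.tabulate (λ {x} _ → r x)))

  Chain⁻ : {R : Fin (suc m) → Fin (suc m) → Set} →
    Chain R zero (trail ζ m zero) zero → ∀ x → R x (ζ x)
  Chain⁻ {R} c x = All.lookup
    (trail-Chain⁻ ζ m zero (subst (Chain R zero (trail ζ m zero)) (sym (proj₂ ζ-full)) c)) (∈-trail x)

  reached : ∀ x → ∃ λ i → x ≡ iter ζ i zero
  reached x
    with i , _ , x≡ ← ∈-map⁻ (λ i → iter ζ i zero) {xs = upTo (suc m)}
                        (subst (x ∈_) (sym (orbit-trail ζ)) (∈-trail x)) = i , x≡

  iter-full : ∀ x → iter ζ (suc m) x ≡ x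
  iter-full x with i , refl ← reached x = begin
    iter ζ (suc m) (iter ζ i zero)  ≡⟨ iter-+ ζ (suc m) i zero ⟨
    iter ζ (suc m + i) zero         ≡⟨ cong (λ j → iter ζ j zero) (+-comm (suc m) i) ⟩
    iter ζ (i + suc m) zero         ≡⟨ iter-+ ζ i (suc m) zero ⟩
    iter ζ i (iter ζ (suc m) zero)  ≡⟨ cong (iter ζ i) (proj₂ ζ-full) ⟩
    iter ζ i zero                   ∎

  injective : Injective _≡_ _≡_ ζ
  injective {x} {y} ζx≡ζy = begin
    x                 ≡⟨ iter-full x ⟨
    iter ζ (suc m) x  ≡⟨ iter-suc ζ m x ⟩
    iter ζ m (ζ x)    ≡⟨ cong (iter ζ m) ζx≡ζy ⟩
    iter ζ m (ζ y)    ≡⟨ iter-suc ζ m y ⟨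
    iter ζ (suc m) y  ≡⟨ iter-full y ⟩
    y                 ∎

∈-fullCycles⁻ : {ζ : Map (suc m)} → ζ ∈ fullCycles m → IsFullCycle ζ
∈-fullCycles⁻ {m} ζ∈ = proj₂ (∈-filter⁻ isFullCycle? {xs = allMaps (suc m)} ζ∈)

module _ {m : ℕ} where

  nonzero : List (Fin (suc m))
  nonzero = tabulate suc

  fullCycleVecs : List (Vec (Fin (suc m)) (suc m))
  fullCycleVecs = filter (isFullCycle? ∘ lookup) (allVecs (suc m) (suc m))

  ∑-fullCycles : (φ : Map (suc m) → ℕ) → ∑ (fullCycles m) φ ≡ ∑[ v ∈ fullCycleVecs ] φ (lookup v)
  ∑-fullCycles φ = begin
    ∑ (fullCycles m) φ
      ≡⟨ ∑-filter isFullCycle? (allMaps (suc m)) φ ⟩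
    ∑[ ζ ∈ allMaps (suc m) ] (𝟙 (isFullCycle? ζ) * φ ζ)
      ≡⟨ ∑-map lookup (allVecs (suc m) (suc m)) (λ ζ → 𝟙 (isFullCycle? ζ) * φ ζ) ⟩
    ∑[ v ∈ allVecs (suc m) (suc m) ] (𝟙 (isFullCycle? (lookup v)) * φ (lookup v))
      ≡⟨ ∑-filter (isFullCycle? ∘ lookup) (allVecs (suc m) (suc m)) (φ ∘ lookup) ⟨
    ∑[ v ∈ fullCycleVecs ] φ (lookup v) ∎

  ∈-fullCycleVecs⁻ : ∀ {v} → v ∈ fullCycleVecs → IsFullCycle (lookup v)
  ∈-fullCycleVecs⁻ v∈ = proj₂ (∈-filter⁻ (isFullCycle? ∘ lookup) {xs = allVecs (suc m) (suc m)} v∈)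

  trail-injective : ∀ {v w} → v ∈ fullCycleVecs → w ∈ fullCycleVecs →
    trail (lookup v) m zero ≡ trail (lookup w) m zero → v ≡ w
  trail-injective {v} {w} v∈ w∈ v≈w = sym (lookup-ext (FullCycle.Chain⁻ (∈-fullCycleVecs⁻ v∈) v-trail-follows-w))
    where
    v-trail-follows-w : Chain (Step (lookup w)) zero (trail (lookup v) m zero) zero
    v-trail-follows-w = subst (λ o → Chain (Step (lookup w)) zero o zero) (sym v≈w)
      (FullCycle.Chain⁺ (∈-fullCycleVecs⁻ w∈) (λ _ → refl))

  trail-surjective : ∀ {o} → o ↭ nonzero → ∃ λ v → v ∈ fullCycleVecs × o ≡ trail (lookup v) m zero
  trail-surjective {o} o↭ = v , ∈-filter⁺ (isFullCycle? ∘ lookup) (∈-allVecs v) (orbit! , closes) , o≡trail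
    where
    v : Vec (Fin (suc m)) (suc m)
    v = thread zero o zero (Vec.replicate (suc m) zero)
    ∣o∣≡m : length o ≡ m
    ∣o∣≡m = trans (Perm.↭-length o↭) (length-tabulate {A = Fin (suc m)} suc)
    zero∷o! : Unique (zero ∷ o)
    zero∷o! = Unique-resp-↭ (↭-sym (prep zero o↭)) (Uniq.allFin⁺ (suc m))
    follows-o : o ≡ trail (lookup v) (length o) zero × iter (lookup v) (suc (length o)) zero ≡ zero
    follows-o = Chain-Step⇒trail (lookup v) o (Chain-thread zero o zero _ zero∷o!)
    o≡trail : o ≡ trail (lookup v) m zero
    o≡trail = trans (proj₁ follows-o) (cong (λ k → trail (lookup v) k zero) ∣o∣≡m)
    closes : iter (lookup v) (suc m) zero ≡ zero
    closes = trans (cong (λ k → iter (lookup v) (suc k) zero) (sym ∣o∣≡m)) (proj₂ follows-o)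
    orbit! : Unique (map (λ i → iter (lookup v) i zero) (upTo (suc m)))
    orbit! = subst Unique (trans (cong (zero ∷_) o≡trail) (sym (orbit-trail (lookup v)))) zero∷o!

  ∑-fullCycles-trail : (φ : List (Fin (suc m)) → ℕ) →
    ∑[ ζ ∈ fullCycles m ] φ (trail ζ m zero) ≡ ∑ (arrangements (length nonzero) nonzero) φ
  ∑-fullCycles-trail φ = trans (∑-fullCycles (λ ζ → φ (trail ζ m zero)))
    (∑-bijection (λ v → trail (lookup v) m zero)
      (Uniq.filter⁺ (isFullCycle? ∘ lookup) (allVecs-unique (suc m) (suc m)))
      (arrangements-unique (length nonzero) (Uniq.tabulate⁺ FinP.suc-injective))
      (λ {v} v∈ → subst (λ k → trail (lookup v) m zero ∈ arrangements k nonzero)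
        (trans (length-trail (lookup v) m zero) (sym (length-tabulate {A = Fin (suc m)} suc)))
        (↭⇒∈-arrangements _ (Perm.drop-∷ (FullCycle.trail-covers (∈-fullCycleVecs⁻ v∈)))))
      trail-injective
      (trail-surjective ∘ ∈-arrangements⇒↭ (length nonzero) refl)
      φ)

  ∑-fullCycles-tours : (g f : Fin (suc m) → Fin q) →
    ∑[ ζ ∈ fullCycles m ] 𝟙 (all? (λ x → g (ζ x) ≟ f x)) ≡ tours (tabulate (λ x → g x , f x))
  ∑-fullCycles-tours g f = begin
    ∑[ ζ ∈ fullCycles m ] 𝟙 (all? (λ x → g (ζ x) ≟ f x))
      ≡⟨ ∑-cong-∈ (fullCycles m) (λ {ζ} ζ∈ → let open FullCycle (∈-fullCycles⁻ ζ∈) in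
           𝟙-⇔ (mk⇔ (λ matches → Chain⁺ (sym ∘ matches)) (λ chain → sym ∘ Chain⁻ chain))
             (all? (λ x → g (ζ x) ≟ f x)) (chain? (follows? g f) zero (trail ζ m zero) zero)) ⟩
    ∑[ ζ ∈ fullCycles m ] 𝟙 (chain? (follows? g f) zero (trail ζ m zero) zero)
      ≡⟨ ∑-fullCycles-trail (λ o → 𝟙 (chain? (follows? g f) zero o zero)) ⟩
    ∑[ o ∈ arrangements (length nonzero) nonzero ] 𝟙 (chain? (follows? g f) zero o zero)
      ≡⟨ tours-chains g f zero nonzero ⟨
    tours (map (λ x → g x , f x) (zero ∷ nonzero))
      ≡⟨ cong tours (map-tabulate id (λ x → g x , f x)) ⟩
    tours (tabulate (λ x → g x , f x)) ∎

-- Colourings constant on cycles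

Invariant : Map n → Vec (Fin q) n → Set
Invariant η f = ∀ x → lookup f (η x) ≡ lookup f x

invariant? : (η : Map n) (f : Vec (Fin q) n) → Dec (Invariant η f)
invariant? η f = all? (λ x → lookup f (η x) ≟ lookup f x)

invariants : Map n → ℕ → ℕ
invariants η q = ∑[ f ∈ allVecs q _ ] 𝟙 (invariant? η f)

invariants₌ : Map n → Fin n → Fin n → ℕ → ℕ
invariants₌ η a b q = ∑[ f ∈ allVecs q _ ] (𝟙 (invariant? η f) * 𝟙 (lookup f a ≟ lookup f b))

invariant-iter : (η : Map n) (f : Vec (Fin q) n) → Invariant η f →
  ∀ j x → lookup f (iter η j x) ≡ lookup f x
invariant-iter η f f-inv zero    x = refl
invariant-iter η f f-inv (suc j) x = trans (f-inv (iter η j x)) (invariant-iter η f f-inv j x)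

lookup-injective : {xs : List A} → Unique xs → ∀ {i j} → List.lookup xs i ≡ List.lookup xs j → i ≡ j
lookup-injective (_ ∷ _)    {zero}  {zero}  _    = refl
lookup-injective (x∉ ∷ _)   {zero}  {suc j} x≡xⱼ = contradiction x≡xⱼ (All.lookup x∉ (∈-lookup j))
lookup-injective (x∉ ∷ _)   {suc i} {zero}  xᵢ≡x = contradiction (sym xᵢ≡x) (All.lookup x∉ (∈-lookup i))
lookup-injective (_ ∷ xs!)  {suc i} {suc j} xᵢ≡xⱼ = cong suc (lookup-injective xs! xᵢ≡xⱼ)

module Orbits {η : Map n} (η-injective : Injective _≡_ _≡_ η) where

  iter-injective : ∀ j → Injective _≡_ _≡_ (iter η j)
  iter-injective zero    = id
  iter-injective (suc j) = iter-injective j ∘ η-injective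

  period : ∀ x → ∃ λ p → suc p ≤ n × iter η (suc p) x ≡ x
  period x with i , j , i<j , ηⁱx≡ηʲx ← pigeonhole (n<1+n n) (λ (i : Fin (suc n)) → iter η (toℕ i) x) =
    gap , ≤-trans (≤-trans (m≤n+m (suc gap) (toℕ i)) (≤-reflexive (sym j≡))) (toℕ≤pred[n] j) ,
    sym (iter-injective (toℕ i) (begin
      iter η (toℕ i) x                     ≡⟨ ηⁱx≡ηʲx ⟩
      iter η (toℕ j) x                     ≡⟨ cong (λ k → iter η k x) j≡ ⟩
      iter η (toℕ i + suc gap) x           ≡⟨ iter-+ η (toℕ i) (suc gap) x ⟩
      iter η (toℕ i) (iter η (suc gap) x)  ∎))
    where
    gap : ℕ
    gap = toℕ j ∸ suc (toℕ i)
    j≡ : toℕ j ≡ toℕ i + suc gap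
    j≡ = sym (trans (+-suc (toℕ i) gap) (m+[n∸m]≡n i<j))

  iter-multiple : ∀ {p x} → iter η p x ≡ x → ∀ k → iter η (k * p) x ≡ x
  iter-multiple ηᵖx≡x zero    = refl
  iter-multiple {p} {x} ηᵖx≡x (suc k) = begin
    iter η (p + k * p) x         ≡⟨ iter-+ η p (k * p) x ⟩
    iter η p (iter η (k * p) x)  ≡⟨ cong (iter η p) (iter-multiple ηᵖx≡x k) ⟩
    iter η p x                   ≡⟨ ηᵖx≡x ⟩
    x                            ∎

  iter-back : ∀ j x → ∃ λ k → iter η k (iter η j x) ≡ x
  iter-back j x with p , _ , closes ← period x = j * suc p ∸ j , (begin
    iter η (j * suc p ∸ j) (iter η j x)  ≡⟨ iter-+ η (j * suc p ∸ j) j x ⟨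
    iter η (j * suc p ∸ j + j) x         ≡⟨ cong (λ k → iter η k x) (m∸n+n≡m (m≤m*n j (suc p))) ⟩
    iter η (j * suc p) x                 ≡⟨ iter-multiple closes j ⟩
    x                                    ∎)

  cycleMin⇒≤ : ∀ {x} → IsCycleMin η x → ∀ j → toℕ x ≤ toℕ (iter η j x)
  cycleMin⇒≤ {x} x-min j with p , p<n , closes ← period x =
    subst (λ y → toℕ x ≤ toℕ y) (sym reduce) (All.lookup x-min (∈-upTo⁺ (<-≤-trans (m%n<n j (suc p)) p<n)))
    where
    reduce : iter η j x ≡ iter η (j % suc p) x
    reduce = begin
      iter η j x
        ≡⟨ cong (λ k → iter η k x) (m≡m%n+[m/n]*n j (suc p)) ⟩
      iter η (j % suc p + j / suc p * suc p) x
        ≡⟨ iter-+ η (j % suc p) _ x ⟩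
      iter η (j % suc p) (iter η (j / suc p * suc p) x)
        ≡⟨ cong (iter η (j % suc p)) (iter-multiple closes (j / suc p)) ⟩
      iter η (j % suc p) x ∎

  cycleMin-≤ : ∀ i j x → IsCycleMin η (iter η i x) → toℕ (iter η i x) ≤ toℕ (iter η j x)
  cycleMin-≤ i j x y-min with k , back ← iter-back i x = subst (λ z → toℕ (iter η i x) ≤ toℕ z) (begin
    iter η (j + k) (iter η i x)        ≡⟨ iter-+ η j k (iter η i x) ⟩
    iter η j (iter η k (iter η i x))   ≡⟨ cong (iter η j) back ⟩
    iter η j x                         ∎) (cycleMin⇒≤ y-min (j + k))

  cycleMin-unique : ∀ i j x → IsCycleMin η (iter η i x) → IsCycleMin η (iter η j x) →
    iter η i x ≡ iter η j x
  cycleMin-unique i j x y-min z-min =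
    toℕ-injective (≤-antisym (cycleMin-≤ i j x y-min) (cycleMin-≤ j i x z-min))

  descend : ∀ x → ∃ λ j → IsCycleMin η (iter η j x)
  descend x = go x (<-wellFounded (toℕ x))
    where
    go : ∀ x → Acc _<_ (toℕ x) → ∃ λ j → IsCycleMin η (iter η j x)
    go x (acc rec) with isCycleMin? η x
    ... | yes x-min = 0 , x-min
    ... | no ¬x-min
      with j , _ , x≰ ← find (¬All⇒Any¬ (λ j → toℕ x ℕ.≤? toℕ (iter η j x)) (upTo n) ¬x-min)
      with k , y-min ← go (iter η j x) (rec (≰⇒> x≰)) =
      k + j , subst (IsCycleMin η) (sym (iter-+ η k j x)) y-min

  root : Fin n → Fin n
  root x = iter η (proj₁ (descend x)) x

  root-min : ∀ x → IsCycleMin η (root x)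
  root-min x = proj₂ (descend x)

  root-cycleMin : ∀ {x} → IsCycleMin η x → root x ≡ x
  root-cycleMin {x} x-min = cycleMin-unique (proj₁ (descend x)) 0 x (root-min x) x-min

  root-η : ∀ x → root (η x) ≡ root x
  root-η x = begin
    root (η x)              ≡⟨ iter-suc η j x ⟨
    iter η (suc j) x        ≡⟨ cycleMin-unique (suc j) (proj₁ (descend x)) x
                                 (subst (IsCycleMin η) (sym (iter-suc η j x)) (root-min (η x))) (root-min x) ⟩
    root x                  ∎
    where
    j : ℕ
    j = proj₁ (descend (η x))

  minima : List (Fin n)
  minima = filter (isCycleMin? η) (allFin n)

  minima-unique : Unique minima
  minima-unique = Uniq.filter⁺ (isCycleMin? η) (Uniq.allFin⁺ n)

  root∈minima : ∀ x → root x ∈ minima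
  root∈minima x = ∈-filter⁺ (isCycleMin? η) (∈-allFin (root x)) (root-min x)

  rootIndex : Fin n → Fin (cycles η)
  rootIndex x = index (root∈minima x)

  lookup-rootIndex : ∀ x → List.lookup minima (rootIndex x) ≡ root x
  lookup-rootIndex x = sym (lookup-index (root∈minima x))

  rootIndex-η : ∀ x → rootIndex (η x) ≡ rootIndex x
  rootIndex-η x = lookup-injective minima-unique
    (trans (lookup-rootIndex (η x)) (trans (root-η x) (sym (lookup-rootIndex x))))

  rootIndex-lookup : ∀ i → rootIndex (List.lookup minima i) ≡ i
  rootIndex-lookup i = lookup-injective minima-unique (trans (lookup-rootIndex (List.lookup minima i))
    (root-cycleMin (proj₂ (∈-filter⁻ (isCycleMin? η) {xs = allFin n} (∈-lookup i)))))

  restrict : Vec (Fin q) n → Vec (Fin q) (cycles η)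
  restrict f = Vec.tabulate (λ i → lookup f (List.lookup minima i))

  extend : Vec (Fin q) (cycles η) → Vec (Fin q) n
  extend g = Vec.tabulate (lookup g ∘ rootIndex)

  extend-invariant : (g : Vec (Fin q) (cycles η)) → Invariant η (extend g)
  extend-invariant g x = begin
    lookup (extend g) (η x)      ≡⟨ VecP.lookup∘tabulate (lookup g ∘ rootIndex) (η x) ⟩
    lookup g (rootIndex (η x))   ≡⟨ cong (lookup g) (rootIndex-η x) ⟩
    lookup g (rootIndex x)       ≡⟨ VecP.lookup∘tabulate (lookup g ∘ rootIndex) x ⟨
    lookup (extend g) x          ∎

  restrict-extend : (g : Vec (Fin q) (cycles η)) → restrict (extend g) ≡ g
  restrict-extend g = lookup-ext (λ i → begin
    lookup (restrict (extend g)) i                 ≡⟨ VecP.lookup∘tabulate _ i ⟩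
    lookup (extend g) (List.lookup minima i)       ≡⟨ VecP.lookup∘tabulate _ (List.lookup minima i) ⟩
    lookup g (rootIndex (List.lookup minima i))    ≡⟨ cong (lookup g) (rootIndex-lookup i) ⟩
    lookup g i                                     ∎)

  lookup-restrict : (f : Vec (Fin q) n) → Invariant η f →
    ∀ x → lookup (restrict f) (rootIndex x) ≡ lookup f x
  lookup-restrict f f-inv x = begin
    lookup (restrict f) (rootIndex x)              ≡⟨ VecP.lookup∘tabulate _ (rootIndex x) ⟩
    lookup f (List.lookup minima (rootIndex x))    ≡⟨ cong (lookup f) (lookup-rootIndex x) ⟩
    lookup f (root x)                              ≡⟨ invariant-iter η f f-inv (proj₁ (descend x)) x ⟩
    lookup f x                                     ∎

  restrict-injective : (f g : Vec (Fin q) n) → Invariant η f → Invariant η g → restrict f ≡ restrict g → f ≡ g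
  restrict-injective f g f-inv g-inv f≈g = lookup-ext (λ x → begin
    lookup f x                            ≡⟨ lookup-restrict f f-inv x ⟨
    lookup (restrict f) (rootIndex x)     ≡⟨ cong (λ h → lookup h (rootIndex x)) f≈g ⟩
    lookup (restrict g) (rootIndex x)     ≡⟨ lookup-restrict g g-inv x ⟩
    lookup g x                            ∎)

  invariants-cycles : ∀ q → invariants η q ≡ q ^ cycles η
  invariants-cycles q = begin
    ∑[ f ∈ F ] 𝟙 (invariant? η f)
      ≡⟨ ∑-cong F (λ f → *-identityʳ (𝟙 (invariant? η f))) ⟨
    ∑[ f ∈ F ] (𝟙 (invariant? η f) * 1)
      ≡⟨ ∑-filter (invariant? η) F (λ _ → 1) ⟨
    ∑[ _ ∈ filter (invariant? η) F ] 1
      ≡⟨ ∑-bijection restrict (Uniq.filter⁺ (invariant? η) (allVecs-unique q n)) (allVecs-unique q (cycles η))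
           (λ _ → ∈-allVecs _)
           (λ {f} {g} f∈ g∈ → restrict-injective f g (∈-filter-invariant f∈) (∈-filter-invariant g∈))
           (λ {g} _ → extend g , ∈-filter⁺ (invariant? η) (∈-allVecs (extend g)) (extend-invariant g) ,
             sym (restrict-extend g))
           (λ _ → 1) ⟩
    ∑[ _ ∈ allVecs q (cycles η) ] 1
      ≡⟨ ∑-allVecs-1 q (cycles η) ⟩
    q ^ cycles η ∎
    where
    F : List (Vec (Fin q) n)
    F = allVecs q n
    ∈-filter-invariant : ∀ {f} → f ∈ filter (invariant? η) F → Invariant η f
    ∈-filter-invariant f∈ = proj₂ (∈-filter⁻ (invariant? η) {xs = F} f∈)

cycles-fullCycle : {ζ : Map (suc m)} → IsFullCycle ζ → cycles ζ ≡ 1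
cycles-fullCycle {m} {ζ} ζ-full = begin
  cycles ζ
    ≡⟨ length-filter-𝟙 (isCycleMin? ζ) (allFin (suc m)) ⟩
  ∑[ x ∈ allFin (suc m) ] 𝟙 (isCycleMin? ζ x)
    ≡⟨ ∑-single _ (Uniq.allFin⁺ (suc m)) (∈-allFin zero)
         (λ {x} _ x≢0 → 𝟙-false (isCycleMin? ζ x) (x≢0 ∘ only-zero)) ⟩
  𝟙 (isCycleMin? ζ zero)
    ≡⟨ 𝟙-true (isCycleMin? ζ zero) zero-min ⟩
  1 ∎
  where
  open Orbits (FullCycle.injective ζ-full)
  zero-min : IsCycleMin ζ zero
  zero-min = All.tabulate (λ _ → z≤n)
  only-zero : ∀ {x} → IsCycleMin ζ x → x ≡ zero
  only-zero {x} x-min with i , refl ← FullCycle.reached ζ-full x = cycleMin-unique i 0 zero x-min zero-min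

cycles-positive : (η : Map (suc m)) → ∃ λ d → cycles η ≡ suc d
cycles-positive {m} η with filter (isCycleMin? η) (allFin (suc m))
    | ∈-filter⁺ (isCycleMin? η) {xs = allFin (suc m)} (∈-allFin zero) (All.tabulate (λ _ → z≤n))
... | _ ∷ xs | _ = length xs , refl

cycles-≤ : (η : Map n) → cycles η ≤ n
cycles-≤ {n} η = ≤-trans (length-filter (isCycleMin? η) (allFin n)) (≤-reflexive (length-allFin n))

-- Multiplication by a transposition

transpose-left : (a b : Fin n) → transpose a b a ≡ b
transpose-left a b rewrite dec-true (a ≟ a) refl = refl

transpose-right : (a b : Fin n) → transpose a b b ≡ a
transpose-right a b with b ≟ a
... | yes b≡a = b≡a
... | no _ rewrite dec-true (b ≟ b) refl = refl

transpose-other : {a b x : Fin n} → x ≢ a → x ≢ b → transpose a b x ≡ x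
transpose-other {a = a} {b} {x} x≢a x≢b rewrite dec-false (x ≟ a) x≢a | dec-false (x ≟ b) x≢b = refl

data Position (a b x : Fin n) : Set where
  left  : x ≡ a → Position a b x
  right : x ≡ b → Position a b x
  other : x ≢ a → x ≢ b → Position a b x

position : (a b x : Fin n) → Position a b x
position a b x with x ≟ a | x ≟ b
... | yes x≡a | _       = left x≡a
... | no _    | yes x≡b = right x≡b
... | no x≢a  | no x≢b  = other x≢a x≢b

transpose-involutive : (a b : Fin n) → Involutive _≡_ (transpose a b)
transpose-involutive a b x with position a b x
... | left refl     = trans (cong (transpose a b) (transpose-left a b)) (transpose-right a b)
... | right refl    = trans (cong (transpose a b) (transpose-right a b)) (transpose-left a b)
... | other x≢a x≢b = trans (cong (transpose a b) (transpose-other x≢a x≢b)) (transpose-other x≢a x≢b)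

involutive⇒injective : (f : A → A) → Involutive _≡_ f → Injective _≡_ _≡_ f
involutive⇒injective f f-involutive {x} {y} fx≡fy =
  trans (sym (f-involutive x)) (trans (cong f fx≡fy) (f-involutive y))

transpose-injective : (a b : Fin n) → Injective _≡_ _≡_ (transpose a b)
transpose-injective a b = involutive⇒injective (transpose a b) (transpose-involutive a b)

-- Exchanging f a and c on the cycle S of b turns the colourings with f b = c into those with
-- f b = f a, so every colour of b is equally frequent.
module Recolouring (η : Map n) (S : Fin n → Bool) (S-invariant : ∀ x → S (η x) ≡ S x)
  {a b : Fin n} (a∉S : S a ≡ false) (b∈S : S b ≡ true) where

  recolour : Fin q → Vec (Fin q) n → Vec (Fin q) n
  recolour c f = Vec.tabulate (λ x →
    if S x then transpose (lookup f a) c (lookup f x) else lookup f x)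

  lookup-recolour : (c : Fin q) (f : Vec (Fin q) n) (x : Fin n) →
    lookup (recolour c f) x ≡ (if S x then transpose (lookup f a) c (lookup f x) else lookup f x)
  lookup-recolour c f = VecP.lookup∘tabulate _

  lookup-recolour-a : (c : Fin q) (f : Vec (Fin q) n) → lookup (recolour c f) a ≡ lookup f a
  lookup-recolour-a c f = trans (lookup-recolour c f a)
    (cong (if_then transpose (lookup f a) c (lookup f a) else lookup f a) a∉S)

  lookup-recolour-b : (c : Fin q) (f : Vec (Fin q) n) →
    lookup (recolour c f) b ≡ transpose (lookup f a) c (lookup f b)
  lookup-recolour-b c f = trans (lookup-recolour c f b)
    (cong (if_then transpose (lookup f a) c (lookup f b) else lookup f b) b∈S)

  recolour-involutive : (c : Fin q) → Involutive _≡_ (recolour c)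
  recolour-involutive {q} c f = lookup-ext (λ x → begin
    lookup (recolour c (recolour c f)) x
      ≡⟨ lookup-recolour c (recolour c f) x ⟩
    (if S x then transpose (lookup (recolour c f) a) c (lookup (recolour c f) x)
      else lookup (recolour c f) x)
      ≡⟨ cong₂ (λ i y → if S x then transpose i c y else y)
           (lookup-recolour-a c f) (lookup-recolour c f x) ⟩
    (if S x then τ (if S x then τ (lookup f x) else lookup f x)
      else (if S x then τ (lookup f x) else lookup f x))
      ≡⟨ twice (S x) (lookup f x) ⟩
    lookup f x ∎)
    where
    τ : Fin q → Fin q
    τ = transpose (lookup f a) c

    twice : ∀ s y → (if s then τ (if s then τ y else y) else (if s then τ y else y)) ≡ y
    twice true  y = transpose-involutive (lookup f a) c y
    twice false y = refl

  recolour-invariant : (c : Fin q) (f : Vec (Fin q) n) →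
    Invariant η f → Invariant η (recolour c f)
  recolour-invariant c f f-inv x = begin
    lookup (recolour c f) (η x)
      ≡⟨ lookup-recolour c f (η x) ⟩
    (if S (η x) then transpose (lookup f a) c (lookup f (η x)) else lookup f (η x))
      ≡⟨ cong₂ (λ s y → if s then transpose (lookup f a) c y else y) (S-invariant x) (f-inv x) ⟩
    (if S x then transpose (lookup f a) c (lookup f x) else lookup f x)
      ≡⟨ lookup-recolour c f x ⟨
    lookup (recolour c f) x ∎

  recolour-invariant-⇔ : (c : Fin q) (f : Vec (Fin q) n) →
    Invariant η (recolour c f) ⇔ Invariant η f
  recolour-invariant-⇔ c f = mk⇔
    (subst (Invariant η) (recolour-involutive c f) ∘ recolour-invariant c (recolour c f))
    (recolour-invariant c f)

  recolour-b-⇔ : (c : Fin q) (f : Vec (Fin q) n) →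
    (c ≡ lookup (recolour c f) b) ⇔ (lookup f a ≡ lookup f b)
  recolour-b-⇔ {q} c f = mk⇔
    (λ c≡ → begin
      lookup f a          ≡⟨ transpose-right (lookup f a) c ⟨
      τ c                 ≡⟨ cong τ (trans c≡ (lookup-recolour-b c f)) ⟩
      τ (τ (lookup f b))  ≡⟨ transpose-involutive (lookup f a) c (lookup f b) ⟩
      lookup f b          ∎)
    (λ fa≡fb → begin
      c                        ≡⟨ transpose-left (lookup f a) c ⟨
      τ (lookup f a)           ≡⟨ cong τ fa≡fb ⟩
      τ (lookup f b)           ≡⟨ lookup-recolour-b c f ⟨
      lookup (recolour c f) b  ∎)
    where
    τ : Fin q → Fin q
    τ = transpose (lookup f a) c

  invariants-colouring-b : (c : Fin q) →
    ∑[ f ∈ allVecs q n ] (𝟙 (c ≟ lookup f b) * 𝟙 (invariant? η f)) ≡ invariants₌ η a b q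
  invariants-colouring-b {q} c = begin
    ∑[ f ∈ allVecs q n ] (𝟙 (c ≟ lookup f b) * 𝟙 (invariant? η f))
      ≡⟨ ∑-reindex (recolour c) (allVecs-unique q n) ∈-allVecs
           (involutive⇒injective (recolour c) (recolour-involutive c)) _ ⟨
    ∑[ f ∈ allVecs q n ] (𝟙 (c ≟ lookup (recolour c f) b) * 𝟙 (invariant? η (recolour c f)))
      ≡⟨ ∑-cong (allVecs q n) (λ f → trans
           (cong₂ _*_
             (𝟙-⇔ (recolour-b-⇔ c f) (c ≟ lookup (recolour c f) b) (lookup f a ≟ lookup f b))
             (𝟙-⇔ (recolour-invariant-⇔ c f) (invariant? η (recolour c f)) (invariant? η f)))
           (*-comm (𝟙 (lookup f a ≟ lookup f b)) _)) ⟩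
    invariants₌ η a b q ∎

  invariants-disconnected : ∀ q → invariants η q ≡ q * invariants₌ η a b q
  invariants-disconnected q = begin
    ∑[ f ∈ allVecs q n ] 𝟙 (invariant? η f)
      ≡⟨ ∑-cong (allVecs q n) (λ f → ∑-𝟙-unique (_≟ lookup f b) (Uniq.allFin⁺ q)
           (∈-allFin (lookup f b)) refl id (λ _ → 𝟙 (invariant? η f))) ⟨
    ∑[ f ∈ allVecs q n ] ∑[ c ∈ allFin q ] (𝟙 (c ≟ lookup f b) * 𝟙 (invariant? η f))
      ≡⟨ ∑-swap (allVecs q n) (allFin q) _ ⟩
    ∑[ c ∈ allFin q ] ∑[ f ∈ allVecs q n ] (𝟙 (c ≟ lookup f b) * 𝟙 (invariant? η f))
      ≡⟨ ∑-cong (allFin q) invariants-colouring-b ⟩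
    ∑[ c ∈ allFin q ] invariants₌ η a b q
      ≡⟨ ∑-const (allFin q) _ ⟩
    length (allFin q) * invariants₌ η a b q
      ≡⟨ cong (_* invariants₌ η a b q) (length-allFin q) ⟩
    q * invariants₌ η a b q ∎

record FirstReturn (η : Map n) (a b c : Fin n) : Set where
  field
    time    : ℕ
    avoids  : ∀ s → s < time → iter η (suc s) b ≢ a × iter η (suc s) b ≢ b
    returns : iter η (suc time) b ≡ c

open FirstReturn

firstReturn : {η : Map n} → Injective _≡_ _≡_ η → (a b : Fin n) →
  FirstReturn η a b a ⊎ FirstReturn η a b b
firstReturn {η = η} η-injective a b
  with p , _ , closes ← Orbits.period η-injective b
  with search (suc p)
  where
  Avoids : ℕ → Set
  Avoids t = ∀ s → s < t → iter η (suc s) b ≢ a × iter η (suc s) b ≢ b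

  search : ∀ t → Avoids t ⊎ (FirstReturn η a b a ⊎ FirstReturn η a b b)
  search zero = inj₁ (λ _ ())
  search (suc t) with search t
  ... | inj₂ found = inj₂ found
  ... | inj₁ avoids with position a b (iter η (suc t) b)
  ...   | left  returns = inj₂ (inj₁ record { time = t ; avoids = avoids ; returns = returns })
  ...   | right returns = inj₂ (inj₂ record { time = t ; avoids = avoids ; returns = returns })
  ...   | other ≢a ≢b   = inj₁ (λ s s<1+t → case m<1+n⇒m<n∨m≡n s<1+t of λ where
    (inj₁ s<t)  → avoids s s<t
    (inj₂ refl) → ≢a , ≢b)
... | inj₂ found  = found
... | inj₁ avoids = contradiction closes (proj₂ (avoids p ≤-refl))

firstReturn-transpose : {η : Map n} {a b c : Fin n} →
  FirstReturn η a b c → FirstReturn (transpose a b ∘ η) a b (transpose a b c)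
firstReturn-transpose {η = η} {a} {b} r = record
  { time    = time r
  ; avoids  = λ s s<t → subst (λ x → x ≢ a × x ≢ b) (sym (agrees (suc s) s<t)) (avoids r s s<t)
  ; returns = cong (transpose a b) (trans (cong η (agrees (time r) ≤-refl)) (returns r))
  }
  where
  agrees : ∀ s → s ≤ time r → iter (transpose a b ∘ η) s b ≡ iter η s b
  agrees zero    _   = refl
  agrees (suc s) s<t = trans (cong (transpose a b ∘ η) (agrees s (<⇒≤ s<t)))
    (transpose-other (proj₁ (avoids r s s<t)) (proj₂ (avoids r s s<t)))

invariants-connected : {η : Map n} {a b : Fin n} → FirstReturn η a b a → ∀ q →
  invariants η q ≡ invariants₌ η a b q
invariants-connected {n} {η} {a} {b} r q = ∑-cong (allVecs q n) (λ f → begin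
  𝟙 (invariant? η f)                                ≡⟨ *-identityʳ (𝟙 (invariant? η f)) ⟨
  𝟙 (invariant? η f) * 1                            ≡⟨ 𝟙-*-cong (invariant? η f) (fa≡fb f) ⟨
  𝟙 (invariant? η f) * 𝟙 (lookup f a ≟ lookup f b)  ∎)
  where
  fa≡fb : ∀ f → Invariant η f → 𝟙 (lookup f a ≟ lookup f b) ≡ 1
  fa≡fb f f-inv = 𝟙-true (lookup f a ≟ lookup f b)
    (trans (cong (lookup f) (sym (returns r))) (invariant-iter η f f-inv (suc (time r)) b))

invariants-disconnected : {η : Map n} → Injective _≡_ _≡_ η → {a b : Fin n} → a ≢ b →
  FirstReturn η a b b → ∀ q → invariants η q ≡ q * invariants₌ η a b q
invariants-disconnected {n} {η} η-injective {a} {b} a≢b r = Recolouring.invariants-disconnected η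
  (does ∘ onCycle?)
  (λ x → does-⇔ (mk⇔ (backward x) (forward x)) (onCycle? (η x)) (onCycle? x))
  (dec-false (onCycle? a) a-off) (dec-true (onCycle? b) (0 , s≤s z≤n , refl))
  where
  OnCycle : Fin n → Set
  OnCycle x = ∃ λ s → s < suc (time r) × iter η s b ≡ x
  onCycle? : Decidable OnCycle
  onCycle? x = anyUpTo? (λ s → iter η s b ≟ x) (suc (time r))
  forward : ∀ x → OnCycle x → OnCycle (η x)
  forward x (s , s<1+t , refl) with m<1+n⇒m<n∨m≡n s<1+t
  ... | inj₁ s<t  = suc s , s≤s s<t , refl
  ... | inj₂ refl = 0 , s≤s z≤n , sym (returns r)
  backward : ∀ x → OnCycle (η x) → OnCycle x
  backward x (zero  , _     , b≡ηx)   = time r , ≤-refl , η-injective (trans (returns r) b≡ηx)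
  backward x (suc s , s<1+t , ηˢb≡ηx) = s , <-trans (n<1+n s) s<1+t , η-injective ηˢb≡ηx
  a-off : ¬ OnCycle a
  a-off (zero  , _       , b≡a)  = a≢b (sym b≡a)
  a-off (suc s , s≤s s<t , ηˢb≡a) = proj₁ (avoids r s s<t) ηˢb≡a

invariants₌-transpose : (η : Map n) (a b : Fin n) → ∀ q →
  invariants₌ (transpose a b ∘ η) a b q ≡ invariants₌ η a b q
invariants₌-transpose {n} η a b q = ∑-cong (allVecs q n) (λ f → begin
  𝟙 (invariant? τη f) * 𝟙 (lookup f a ≟ lookup f b)  ≡⟨ *-comm (𝟙 (invariant? τη f)) _ ⟩
  𝟙 (lookup f a ≟ lookup f b) * 𝟙 (invariant? τη f)  ≡⟨ 𝟙-*-cong (lookup f a ≟ lookup f b) (τη≡η f) ⟩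
  𝟙 (lookup f a ≟ lookup f b) * 𝟙 (invariant? η f)   ≡⟨ *-comm (𝟙 (lookup f a ≟ lookup f b)) _ ⟩
  𝟙 (invariant? η f) * 𝟙 (lookup f a ≟ lookup f b)   ∎)
  where
  τη : Map n
  τη = transpose a b ∘ η

  lookup-transpose : ∀ f → lookup f a ≡ lookup f b → ∀ x → lookup f (transpose a b x) ≡ lookup f x
  lookup-transpose f fa≡fb x with position a b x
  ... | left refl     = trans (cong (lookup f) (transpose-left a b)) (sym fa≡fb)
  ... | right refl    = trans (cong (lookup f) (transpose-right a b)) fa≡fb
  ... | other x≢a x≢b = cong (lookup f) (transpose-other x≢a x≢b)

  τη≡η : ∀ f → lookup f a ≡ lookup f b → 𝟙 (invariant? τη f) ≡ 𝟙 (invariant? η f)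
  τη≡η f fa≡fb = 𝟙-⇔ (mk⇔
    (λ f-inv x → trans (sym (lookup-transpose f fa≡fb (η x))) (f-inv x))
    (λ f-inv x → trans (lookup-transpose f fa≡fb (η x)) (f-inv x)))
    (invariant? τη f) (invariant? η f)

-- Exactly one of η and (a b) η has a and b on a common cycle.
invariants-transpose : {η : Map n} → Injective _≡_ _≡_ η → {a b : Fin n} → a ≢ b → ∀ q →
  invariants (transpose a b ∘ η) q + invariants η q ≡ suc q * invariants₌ η a b q
invariants-transpose {n} {η} η-injective {a} {b} a≢b q with firstReturn η-injective a b
... | inj₂ disconnected = begin
  invariants τη q + invariants η q
    ≡⟨ cong₂ _+_ (invariants-connected τη-connected q)
         (invariants-disconnected η-injective a≢b disconnected q) ⟩
  invariants₌ τη a b q + q * invariants₌ η a b q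
    ≡⟨ cong (_+ q * invariants₌ η a b q) (invariants₌-transpose η a b q) ⟩
  suc q * invariants₌ η a b q ∎
  where
  τη : Map n
  τη = transpose a b ∘ η
  τη-connected : FirstReturn τη a b a
  τη-connected = subst (FirstReturn τη a b) (transpose-right a b) (firstReturn-transpose disconnected)
... | inj₁ connected = begin
  invariants τη q + invariants η q
    ≡⟨ +-comm (invariants τη q) _ ⟩
  invariants η q + invariants τη q
    ≡⟨ cong₂ _+_ (invariants-connected connected q)
         (invariants-disconnected (η-injective ∘ transpose-injective a b) a≢b τη-disconnected q) ⟩
  invariants₌ η a b q + q * invariants₌ τη a b q
    ≡⟨ cong (λ i → invariants₌ η a b q + q * i) (invariants₌-transpose η a b q) ⟩
  suc q * invariants₌ η a b q ∎
  where
  τη : Map n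
  τη = transpose a b ∘ η
  τη-disconnected : FirstReturn τη a b b
  τη-disconnected = subst (FirstReturn τη a b) (transpose-left a b) (firstReturn-transpose connected)

-- Sums over full cycles

cycleSum : Map (suc m) → ℕ → ℕ
cycleSum {m} π q = ∑[ ζ ∈ fullCycles m ] invariants (ζ · π) q

cycleSum₌ : Map (suc m) → Fin (suc m) → Fin (suc m) → ℕ → ℕ
cycleSum₌ {m} π a b q = ∑[ ζ ∈ fullCycles m ] invariants₌ (ζ · π) a b q

cycleSum-cycles : {π : Map (suc m)} → Injective _≡_ _≡_ π → ∀ q →
  cycleSum π q ≡ ∑[ ζ ∈ fullCycles m ] (q ^ cycles (ζ · π))
cycleSum-cycles {m} π-injective q = ∑-cong-∈ (fullCycles m) (λ ζ∈ →
  Orbits.invariants-cycles (FullCycle.injective (∈-fullCycles⁻ ζ∈) ∘ π-injective) q)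

cycleSum-cong : {π ρ : Map (suc m)} → π ≗ ρ → ∀ q → cycleSum π q ≡ cycleSum ρ q
cycleSum-cong {m} {π} {ρ} π≗ρ q = ∑-cong (fullCycles m) (λ ζ → ∑-cong (allVecs q (suc m)) (λ f →
  𝟙-⇔ (mk⇔
    (λ f-inv x → trans (cong (lookup f) (sym (π≗ρ (ζ x)))) (f-inv x))
    (λ f-inv x → trans (cong (lookup f) (π≗ρ (ζ x))) (f-inv x)))
    (invariant? (ζ · π) f) (invariant? (ζ · ρ) f)))

cycleSum-id : ∀ m q → cycleSum {m} id q ≡ length (fullCycles m) * q
cycleSum-id m q = begin
  cycleSum {m} id q                     ≡⟨ cycleSum-cycles {m} {id} id q ⟩
  ∑[ ζ ∈ fullCycles m ] (q ^ cycles ζ)  ≡⟨ ∑-cong-∈ (fullCycles m) (λ ζ∈ →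
                                             cong (q ^_) (cycles-fullCycle (∈-fullCycles⁻ ζ∈))) ⟩
  ∑[ ζ ∈ fullCycles m ] (q ^ 1)         ≡⟨ ∑-const (fullCycles m) (q ^ 1) ⟩
  length (fullCycles m) * (q ^ 1)       ≡⟨ cong (length (fullCycles m) *_) (*-identityʳ q) ⟩
  length (fullCycles m) * q             ∎

cycleSum-transpose-+ : {π : Map (suc m)} → Injective _≡_ _≡_ π → {a b : Fin (suc m)} → a ≢ b → ∀ q →
  cycleSum (transpose a b ∘ π) q + cycleSum π q ≡ suc q * cycleSum₌ π a b q
cycleSum-transpose-+ {m} {π} π-injective {a} {b} a≢b q = begin
  cycleSum (transpose a b ∘ π) q + cycleSum π q
    ≡⟨ ∑-+ (fullCycles m) _ _ ⟨
  ∑[ ζ ∈ fullCycles m ] (invariants (transpose a b ∘ (ζ · π)) q + invariants (ζ · π) q)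
    ≡⟨ ∑-cong-∈ (fullCycles m) (λ ζ∈ →
         invariants-transpose (FullCycle.injective (∈-fullCycles⁻ ζ∈) ∘ π-injective) a≢b q) ⟩
  ∑[ ζ ∈ fullCycles m ] (suc q * invariants₌ (ζ · π) a b q)
    ≡⟨ ∑-*ˡ (suc q) (fullCycles m) _ ⟩
  suc q * cycleSum₌ π a b q ∎

cycleSum-tours : (π : Map (suc m)) (q : ℕ) →
  cycleSum π q ≡ ∑[ f ∈ allVecs q (suc m) ] tours (edges π f)
cycleSum-tours {m} π q = begin
  ∑[ ζ ∈ fullCycles m ] ∑[ f ∈ allVecs q (suc m) ] 𝟙 (invariant? (ζ · π) f)
    ≡⟨ ∑-swap (fullCycles m) (allVecs q (suc m)) _ ⟩
  ∑[ f ∈ allVecs q (suc m) ] ∑[ ζ ∈ fullCycles m ] 𝟙 (invariant? (ζ · π) f)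
    ≡⟨ ∑-cong (allVecs q (suc m)) (λ f → ∑-fullCycles-tours (lookup f ∘ π) (lookup f)) ⟩
  ∑[ f ∈ allVecs q (suc m) ] tours (edges π f) ∎

cycleSum₌-tours : (π : Map (suc m)) (a b : Fin (suc m)) (q : ℕ) →
  cycleSum₌ π a b q ≡ ∑[ f ∈ allVecs q (suc m) ] (𝟙 (lookup f a ≟ lookup f b) * tours (edges π f))
cycleSum₌-tours {m} π a b q = begin
  ∑[ ζ ∈ fullCycles m ] ∑[ f ∈ F ] (𝟙 (invariant? (ζ · π) f) * 𝟙 (lookup f a ≟ lookup f b))
    ≡⟨ ∑-swap (fullCycles m) F _ ⟩
  ∑[ f ∈ F ] ∑[ ζ ∈ fullCycles m ] (𝟙 (invariant? (ζ · π) f) * 𝟙 (lookup f a ≟ lookup f b))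
    ≡⟨ ∑-cong F (λ f → ∑-*ʳ (𝟙 (lookup f a ≟ lookup f b)) (fullCycles m) _) ⟩
  ∑[ f ∈ F ] ((∑[ ζ ∈ fullCycles m ] 𝟙 (invariant? (ζ · π) f)) * 𝟙 (lookup f a ≟ lookup f b))
    ≡⟨ ∑-cong F (λ f → cong (_* 𝟙 (lookup f a ≟ lookup f b))
         (∑-fullCycles-tours (lookup f ∘ π) (lookup f))) ⟩
  ∑[ f ∈ F ] (tours (edges π f) * 𝟙 (lookup f a ≟ lookup f b))
    ≡⟨ ∑-cong F (λ f → *-comm (tours (edges π f)) _) ⟩
  ∑[ f ∈ F ] (𝟙 (lookup f a ≟ lookup f b) * tours (edges π f)) ∎
  where
  F : List (Vec (Fin q) (suc m))
  F = allVecs q (suc m)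

-- Removing two fixed points

∑-insertAt : (i : Fin (suc n)) (φ : Vec (Fin q) (suc n) → ℕ) →
  ∑ (allVecs q (suc n)) φ ≡ ∑[ x ∈ allFin q ] ∑[ f ∈ allVecs q n ] φ (insertAt f i x)
∑-insertAt {n} {q} zero φ = ∑-allVecs-∷ q n φ
∑-insertAt {suc n} {q} (suc i) φ = begin
  ∑ (allVecs q (2 + n)) φ
    ≡⟨ ∑-allVecs-∷ q (suc n) φ ⟩
  ∑[ y ∈ allFin q ] ∑[ f ∈ allVecs q (suc n) ] φ (y ∷ f)
    ≡⟨ ∑-cong (allFin q) (λ y → ∑-insertAt i (φ ∘ (y ∷_))) ⟩
  ∑[ y ∈ allFin q ] ∑[ x ∈ allFin q ] ∑[ f ∈ allVecs q n ] φ (y ∷ insertAt f i x)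
    ≡⟨ ∑-swap (allFin q) (allFin q) _ ⟩
  ∑[ x ∈ allFin q ] ∑[ y ∈ allFin q ] ∑[ f ∈ allVecs q n ] φ (y ∷ insertAt f i x)
    ≡⟨ ∑-cong (allFin q) (λ x → ∑-allVecs-∷ q n (λ f → φ (insertAt f (suc i) x))) ⟨
  ∑[ x ∈ allFin q ] ∑[ f ∈ allVecs q (suc n) ] φ (insertAt f (suc i) x) ∎

removeFixed : {π : Map (suc n)} → Injective _≡_ _≡_ π → {b : Fin (suc n)} → π b ≡ b →
  ∃ λ (ρ : Map n) → Injective _≡_ _≡_ ρ × ∀ z → π (punchIn b z) ≡ punchIn b (ρ z)
removeFixed {n} {π} π-injective {b} πb≡b = ρ , ρ-injective , λ z → sym (punchIn-punchOut (b≢π z))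
  where
  b≢π : ∀ z → b ≢ π (punchIn b z)
  b≢π z b≡ = punchInᵢ≢i b z (π-injective (trans (sym b≡) (sym πb≡b)))
  ρ : Map n
  ρ z = punchOut (b≢π z)
  ρ-injective : Injective _≡_ _≡_ ρ
  ρ-injective {x} {y} ρx≡ρy =
    punchIn-injective b x y (π-injective (punchOut-injective (b≢π x) (b≢π y) ρx≡ρy))

module TwoFixedPoints {π : Map (2 + n)} (π-injective : Injective _≡_ _≡_ π)
  (b : Fin (2 + n)) (a′ : Fin (suc n))
  (πa≡a : π (punchIn b a′) ≡ punchIn b a′) (πb≡b : π b ≡ b) where

  a : Fin (2 + n)
  a = punchIn b a′

  ι : Fin n → Fin (2 + n)
  ι z = punchIn b (punchIn a′ z)

  ι≢a : ∀ z → ι z ≢ a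
  ι≢a z ι≡a = punchInᵢ≢i a′ z (punchIn-injective b (punchIn a′ z) a′ ι≡a)

  ι≢b : ∀ z → ι z ≢ b
  ι≢b z = punchInᵢ≢i b (punchIn a′ z)

  restriction : ∃ λ (ρ : Map n) → Injective _≡_ _≡_ ρ × ∀ z → π (ι z) ≡ ι (ρ z)
  restriction
    with ρ₁ , ρ₁-injective , π≡ρ₁ ← removeFixed π-injective πb≡b
    with ρ₂ , ρ₂-injective , ρ₁≡ρ₂ ← removeFixed ρ₁-injective
           (punchIn-injective b _ a′ (trans (sym (π≡ρ₁ a′)) πa≡a)) =
    ρ₂ , ρ₂-injective , λ z → trans (π≡ρ₁ (punchIn a′ z)) (cong (punchIn b) (ρ₁≡ρ₂ z))

  ρ : Map n
  ρ = proj₁ restriction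

  π-ι : ∀ z → π (ι z) ≡ ι (ρ z)
  π-ι = proj₂ (proj₂ restriction)

  colouring : Fin q → Fin q → Vec (Fin q) n → Vec (Fin q) (2 + n)
  colouring x y f = insertAt (insertAt f a′ x) b y

  lookup-a : (x y : Fin q) (f : Vec (Fin q) n) → lookup (colouring x y f) a ≡ x
  lookup-a x y f =
    trans (VecP.insertAt-punchIn (insertAt f a′ x) b y a′) (VecP.insertAt-lookup f a′ x)

  lookup-b : (x y : Fin q) (f : Vec (Fin q) n) → lookup (colouring x y f) b ≡ y
  lookup-b x y f = VecP.insertAt-lookup (insertAt f a′ x) b y

  lookup-ι : (x y : Fin q) (f : Vec (Fin q) n) (z : Fin n) →
    lookup (colouring x y f) (ι z) ≡ lookup f z
  lookup-ι x y f z =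
    trans (VecP.insertAt-punchIn (insertAt f a′ x) b y (punchIn a′ z)) (VecP.insertAt-punchIn f a′ x z)

  ∑-colouring : ∀ q (φ : Vec (Fin q) (2 + n) → ℕ) → ∑ (allVecs q (2 + n)) φ ≡
    ∑[ y ∈ allFin q ] ∑[ x ∈ allFin q ] ∑[ f ∈ allVecs q n ] φ (colouring x y f)
  ∑-colouring q φ =
    trans (∑-insertAt b φ) (∑-cong (allFin q) (λ y → ∑-insertAt a′ (λ f → φ (insertAt f b y))))

  edges-colouring : (σ : Map (2 + n)) → (∀ z → σ (ι z) ≡ ι (ρ z)) →
    (x y : Fin q) (f : Vec (Fin q) n) → edges σ (colouring x y f) ↭
      (lookup (colouring x y f) (σ b) , y) ∷ (lookup (colouring x y f) (σ a) , x) ∷ edges ρ f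
  edges-colouring {q} σ σ-ι x y f = ↭-trans (tabulate-punchIn-↭ edge b)
    (↭-trans (prep (edge b) (tabulate-punchIn-↭ (edge ∘ punchIn b) a′)) (↭.↭-reflexive
      (cong₂ _∷_ (cong (lookup F (σ b) ,_) (lookup-b x y f))
        (cong₂ _∷_ (cong (lookup F (σ a) ,_) (lookup-a x y f))
          (tabulate-cong edge-ι)))))
    where
    F : Vec (Fin q) (2 + n)
    F = colouring x y f
    edge : Fin (2 + n) → Edge q
    edge z = lookup F (σ z) , lookup F z
    edge-ι : ∀ z → edge (ι z) ≡ (lookup f (ρ z) , lookup f z)
    edge-ι z = cong₂ _,_ (trans (cong (lookup F) (σ-ι z)) (lookup-ι x y f (ρ z))) (lookup-ι x y f z)

  tours-π : (x y : Fin q) (f : Vec (Fin q) n) →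
    tours (edges π (colouring x y f)) ≡ tours ((x , x) ∷ (y , y) ∷ edges ρ f)
  tours-π {q} x y f = begin
    tours (edges π F)
      ≡⟨ tours-↭ (edges-colouring π π-ι x y f) ⟩
    tours ((lookup F (π b) , y) ∷ (lookup F (π a) , x) ∷ edges ρ f)
      ≡⟨ cong₂ (λ s t → tours ((s , y) ∷ (t , x) ∷ edges ρ f))
           (trans (cong (lookup F) πb≡b) (lookup-b x y f))
           (trans (cong (lookup F) πa≡a) (lookup-a x y f)) ⟩
    tours ((y , y) ∷ (x , x) ∷ edges ρ f)
      ≡⟨ tours-swap (y , y) (x , x) (edges ρ f) ⟩
    tours ((x , x) ∷ (y , y) ∷ edges ρ f) ∎
    where
    F : Vec (Fin q) (2 + n)
    F = colouring x y f

  tours-transpose-π : (x y : Fin q) (f : Vec (Fin q) n) →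
    tours (edges (transpose a b ∘ π) (colouring x y f)) ≡ tours ((x , y) ∷ (y , x) ∷ edges ρ f)
  tours-transpose-π {q} x y f = begin
    tours (edges τπ F)
      ≡⟨ tours-↭ (edges-colouring τπ τπ-ι x y f) ⟩
    tours ((lookup F (τπ b) , y) ∷ (lookup F (τπ a) , x) ∷ edges ρ f)
      ≡⟨ cong₂ (λ s t → tours ((s , y) ∷ (t , x) ∷ edges ρ f))
           (trans (cong (lookup F) τπb≡a) (lookup-a x y f))
           (trans (cong (lookup F) τπa≡b) (lookup-b x y f)) ⟩
    tours ((x , y) ∷ (y , x) ∷ edges ρ f) ∎
    where
    F : Vec (Fin q) (2 + n)
    F = colouring x y f
    τπ : Map (2 + n)
    τπ = transpose a b ∘ π
    τπ-ι : ∀ z → τπ (ι z) ≡ ι (ρ z)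
    τπ-ι z = trans (cong (transpose a b) (π-ι z)) (transpose-other (ι≢a (ρ z)) (ι≢b (ρ z)))
    τπa≡b : τπ a ≡ b
    τπa≡b = trans (cong (transpose a b) πa≡a) (transpose-left a b)
    τπb≡a : τπ b ≡ a
    τπb≡a = trans (cong (transpose a b) πb≡b) (transpose-right a b)

  cycleSum₌-loops : ∀ q → cycleSum₌ π a b q ≡
    ∑[ z ∈ allFin q ] ∑[ f ∈ allVecs q n ] tours ((z , z) ∷ (z , z) ∷ edges ρ f)
  cycleSum₌-loops q = begin
    cycleSum₌ π a b q
      ≡⟨ trans (cycleSum₌-tours π a b q) (∑-colouring q _) ⟩
    ∑[ y ∈ allFin q ] ∑[ x ∈ allFin q ] ∑[ f ∈ allVecs q n ]
      (𝟙 (lookup (colouring x y f) a ≟ lookup (colouring x y f) b) * tours (edges π (colouring x y f)))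
      ≡⟨ ∑-cong (allFin q) (λ y → ∑-cong (allFin q) (λ x → ∑-cong (allVecs q n) (λ f →
           cong₂ _*_ (cong₂ (λ s t → 𝟙 (s ≟ t)) (lookup-a x y f) (lookup-b x y f)) (tours-π x y f)))) ⟩
    ∑[ y ∈ allFin q ] ∑[ x ∈ allFin q ] ∑[ f ∈ allVecs q n ]
      (𝟙 (x ≟ y) * tours ((x , x) ∷ (y , y) ∷ edges ρ f))
      ≡⟨ ∑-cong (allFin q) (λ y → ∑-cong (allFin q) (λ x → ∑-*ˡ (𝟙 (x ≟ y)) (allVecs q n) _)) ⟩
    ∑[ y ∈ allFin q ] ∑[ x ∈ allFin q ]
      (𝟙 (x ≟ y) * (∑[ f ∈ allVecs q n ] tours ((x , x) ∷ (y , y) ∷ edges ρ f)))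
      ≡⟨ ∑-cong (allFin q) (λ y → ∑-𝟙-unique (_≟ y) (Uniq.allFin⁺ q) (∈-allFin y) refl id _) ⟩
    ∑[ z ∈ allFin q ] ∑[ f ∈ allVecs q n ] tours ((z , z) ∷ (z , z) ∷ edges ρ f) ∎

  cycleSum-punchIn : ∀ q (σ : Map (2 + n)) {φ : Fin q → Fin q → Vec (Fin q) n → ℕ} →
    (∀ x y f → tours (edges σ (colouring x y f)) ≡ φ x y f) →
    cycleSum σ q ≡ ∑[ y ∈ allFin q ] ∑[ x ∈ allFin q ] ∑[ f ∈ allVecs q n ] φ x y f
  cycleSum-punchIn q σ {φ} tours≡φ = begin
    cycleSum σ q
      ≡⟨ trans (cycleSum-tours σ q) (∑-colouring q _) ⟩
    ∑[ y ∈ allFin q ] ∑[ x ∈ allFin q ] ∑[ f ∈ allVecs q n ] tours (edges σ (colouring x y f))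
      ≡⟨ ∑-cong (allFin q) (λ y → ∑-cong (allFin q) (λ x → ∑-cong (allVecs q n) (tours≡φ x y))) ⟩
    ∑[ y ∈ allFin q ] ∑[ x ∈ allFin q ] ∑[ f ∈ allVecs q n ] φ x y f ∎

  cycleSum-transpose-punchIn : ∀ q →
    cycleSum (transpose a b ∘ π) (suc q) ≡ cycleSum π (suc q) + suc q * cycleSum₌ π a b q
  cycleSum-transpose-punchIn q = begin
    cycleSum (transpose a b ∘ π) (suc q)
      ≡⟨ cycleSum-punchIn (suc q) (transpose a b ∘ π) tours-transpose-π ⟩
    ∑[ y ∈ allFin (suc q) ] ∑[ x ∈ allFin (suc q) ] ∑[ f ∈ allVecs (suc q) n ]
      tours ((x , y) ∷ (y , x) ∷ edges ρ f)
      ≡⟨ ∑-exchange-all (proj₁ (proj₂ restriction)) q ⟩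
    (∑[ y ∈ allFin (suc q) ] ∑[ x ∈ allFin (suc q) ] ∑[ f ∈ allVecs (suc q) n ]
        tours ((x , x) ∷ (y , y) ∷ edges ρ f))
      + suc q * (∑[ z ∈ allFin q ] ∑[ f ∈ allVecs q n ] tours ((z , z) ∷ (z , z) ∷ edges ρ f))
      ≡⟨ cong₂ (λ s t → s + suc q * t) (cycleSum-punchIn (suc q) π tours-π) (cycleSum₌-loops q) ⟨
    cycleSum π (suc q) + suc q * cycleSum₌ π a b q ∎

cycleSum-transpose-suc : {π : Map (suc m)} → Injective _≡_ _≡_ π → {a b : Fin (suc m)} → a ≢ b →
  π a ≡ a → π b ≡ b → ∀ q →
  cycleSum (transpose a b ∘ π) (suc q) ≡ cycleSum π (suc q) + suc q * cycleSum₌ π a b q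
cycleSum-transpose-suc {zero}  π-injective {zero} {zero} a≢b = contradiction refl a≢b
cycleSum-transpose-suc {suc n} {π} π-injective {a} {b} a≢b = subst
  (λ a → π a ≡ a → π b ≡ b → ∀ q →
    cycleSum (transpose a b ∘ π) (suc q) ≡ cycleSum π (suc q) + suc q * cycleSum₌ π a b q)
  (punchIn-punchOut b≢a)
  (TwoFixedPoints.cycleSum-transpose-punchIn π-injective b (punchOut b≢a))
  where
  b≢a : b ≢ a
  b≢a = a≢b ∘ sym

cycleSum-recurrence : {π : Map (suc m)} → Injective _≡_ _≡_ π → {a b : Fin (suc m)} → a ≢ b →
  π a ≡ a → π b ≡ b → ∀ q →
  cycleSum (transpose a b ∘ π) (suc q) ≡
    cycleSum (transpose a b ∘ π) q + (cycleSum π (suc q) + cycleSum π q)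
cycleSum-recurrence {π = π} π-injective {a} {b} a≢b πa≡a πb≡b q = begin
  cycleSum (transpose a b ∘ π) (suc q)
    ≡⟨ cycleSum-transpose-suc π-injective a≢b πa≡a πb≡b q ⟩
  cycleSum π (suc q) + suc q * cycleSum₌ π a b q
    ≡⟨ cong (cycleSum π (suc q) +_) (cycleSum-transpose-+ π-injective a≢b q) ⟨
  cycleSum π (suc q) + (cycleSum (transpose a b ∘ π) q + cycleSum π q)
    ≡⟨ x+yz≡y+xz (cycleSum π (suc q)) (cycleSum (transpose a b ∘ π) q) _ ⟩
  cycleSum (transpose a b ∘ π) q + (cycleSum π (suc q) + cycleSum π q) ∎

-- The Harer–Zagier polynomials

eval : ℕ → (ℕ → ℕ) → ℕ → ℕ
eval N a q = ∑[ c ∈ upTo N ] (q ^ c * a c)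

eval-suc : ∀ N a q → eval (suc N) a q ≡ a 0 + q * eval N (a ∘ suc) q
eval-suc N a q = cong₂ _+_ (*-identityˡ (a 0)) (begin
  ∑[ c ∈ applyUpTo suc N ] (q ^ c * a c)
    ≡⟨ cong (λ cs → ∑ cs (λ c → q ^ c * a c)) (map-applyUpTo id suc N) ⟨
  ∑[ c ∈ map suc (upTo N) ] (q ^ c * a c)
    ≡⟨ ∑-map suc (upTo N) _ ⟩
  ∑[ c ∈ upTo N ] (q * q ^ c * a (suc c))
    ≡⟨ ∑-cong (upTo N) (λ c → *-assoc q (q ^ c) _) ⟩
  ∑[ c ∈ upTo N ] (q * (q ^ c * a (suc c)))
    ≡⟨ ∑-*ˡ q (upTo N) _ ⟩
  q * eval N (a ∘ suc) q ∎)

eval-*ˡ : ∀ N x a q → eval N (λ c → x * a c) q ≡ x * eval N a q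
eval-*ˡ N x a q =
  trans (∑-cong (upTo N) (λ c → x*yz≡y*xz (q ^ c) x (a c))) (∑-*ˡ x (upTo N) _)

eval-+ : ∀ N a b q → eval N (λ c → a c + b c) q ≡ eval N a q + eval N b q
eval-+ N a b q =
  trans (∑-cong (upTo N) (λ c → *-distribˡ-+ (q ^ c) (a c) (b c))) (∑-+ (upTo N) _ _)

eval-∑-𝟙 : (N : ℕ) (xs : List A) (d : A → ℕ) → (∀ x → d x < N) → ∀ q →
  eval N (λ c → ∑[ x ∈ xs ] 𝟙 (d x ℕ.≟ c)) q ≡ ∑[ x ∈ xs ] (q ^ d x)
eval-∑-𝟙 N xs d d<N q = begin
  ∑[ c ∈ upTo N ] (q ^ c * (∑[ x ∈ xs ] 𝟙 (d x ℕ.≟ c)))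
    ≡⟨ ∑-cong (upTo N) (λ c → ∑-*ˡ (q ^ c) xs _) ⟨
  ∑[ c ∈ upTo N ] ∑[ x ∈ xs ] (q ^ c * 𝟙 (d x ℕ.≟ c))
    ≡⟨ ∑-swap (upTo N) xs _ ⟩
  ∑[ x ∈ xs ] ∑[ c ∈ upTo N ] (q ^ c * 𝟙 (d x ℕ.≟ c))
    ≡⟨ ∑-cong xs (λ x → ∑-cong (upTo N) (λ c → *-comm (q ^ c) _)) ⟩
  ∑[ x ∈ xs ] ∑[ c ∈ upTo N ] (𝟙 (d x ℕ.≟ c) * q ^ c)
    ≡⟨ ∑-cong xs (λ x →
         ∑-𝟙-unique (d x ℕ.≟_) (Uniq.upTo⁺ N) (∈-upTo⁺ (d<N x)) refl sym (q ^_)) ⟩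
  ∑[ x ∈ xs ] (q ^ d x) ∎

-- At a base exceeding every digit the value determines the digits.
eval-injective : ∀ N a b → (∀ q → eval N a (suc q) ≡ eval N b (suc q)) → ∀ c → c < N → a c ≡ b c
eval-injective (suc N) a b a≈b = λ where
    zero    _         → a₀≡b₀
    (suc c) (s≤s c<N) → eval-injective N (a ∘ suc) (b ∘ suc) tails c c<N
  where
  horner : ∀ q → a 0 + suc q * eval N (a ∘ suc) (suc q) ≡ b 0 + suc q * eval N (b ∘ suc) (suc q)
  horner q = trans (sym (eval-suc N a (suc q))) (trans (a≈b q) (eval-suc N b (suc q)))

  base : ℕ
  base = suc (a 0 + b 0)

  last-digit : ∀ d h → d ≤ a 0 + b 0 → (d + base * h) % base ≡ d
  last-digit d h d≤ = begin
    (d + base * h) % base  ≡⟨ cong (λ y → (d + y) % base) (*-comm base h) ⟩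
    (d + h * base) % base  ≡⟨ [m+kn]%n≡m%n d h base ⟩
    d % base               ≡⟨ m<n⇒m%n≡m (s≤s d≤) ⟩
    d                      ∎

  a₀≡b₀ : a 0 ≡ b 0
  a₀≡b₀ = begin
    a 0
      ≡⟨ last-digit (a 0) (eval N (a ∘ suc) base) (m≤m+n (a 0) (b 0)) ⟨
    (a 0 + base * eval N (a ∘ suc) base) % base
      ≡⟨ cong (_% base) (horner (a 0 + b 0)) ⟩
    (b 0 + base * eval N (b ∘ suc) base) % base
      ≡⟨ last-digit (b 0) (eval N (b ∘ suc) base) (m≤n+m (b 0) (a 0)) ⟩
    b 0 ∎

  tails : ∀ q → eval N (a ∘ suc) (suc q) ≡ eval N (b ∘ suc) (suc q)
  tails q = *-cancelˡ-≡ _ _ (suc q) (+-cancelˡ-≡ (a 0) _ _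
    (trans (horner q) (cong (_+ suc q * eval N (b ∘ suc) (suc q)) (sym a₀≡b₀))))

shift : (ℕ → ℕ) → ℕ → ℕ
shift a zero    = 0
shift a (suc c) = a c

eval-shift : ∀ N a q → eval (suc N) (shift a) q ≡ q * eval N a q
eval-shift N a q = eval-suc N (shift a) q

-- (k + 1)! times the coefficient of x^(k+1) in ((1 + x) / (1 - x))^q / 2.
hz : ℕ → ℕ → ℕ
hz zero          q = q
hz (suc zero)    q = 2 * (q * q)
hz (suc (suc k)) q = 2 * (q * hz (suc k) q) + (2 + k) * (1 + k) * hz k q

hz-0 : ∀ k → hz k 0 ≡ 0
hz-0 zero          = refl
hz-0 (suc zero)    = refl
hz-0 (suc (suc k)) = trans (cong ((2 + k) * (1 + k) *_) (hz-0 k)) (*-zeroʳ ((2 + k) * (1 + k)))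

hz-sum : ∀ k q → hz (suc k) q + (1 + k) * hz k q ≡ q * (hz k (suc q) + hz k q)
hz-difference : ∀ k q →
  hz (suc k) (suc q) ≡ hz (suc k) q + (2 + k) * (hz k (suc q) + hz k q)

hz-sum zero q = expand q
  where
  expand : ∀ q → 2 * (q * q) + (1 + 0) * q ≡ q * (suc q + q)
  expand = solve-∀
hz-sum (suc k) q = begin
  2 * (q * y′) + (2 + k) * (1 + k) * y + (2 + k) * y′  ≡⟨ collect k q y y′ ⟩
  2 * (q * y′) + (2 + k) * (y′ + (1 + k) * y)          ≡⟨ cong (λ s → 2 * (q * y′) + (2 + k) * s) (hz-sum k q) ⟩
  2 * (q * y′) + (2 + k) * (q * (x + y))               ≡⟨ factor k q (x + y) y′ ⟩
  q * (y′ + (2 + k) * (x + y) + y′)                    ≡⟨ cong (λ x′ → q * (x′ + y′)) (hz-difference k q) ⟨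
  q * (hz (suc k) (suc q) + y′)                        ∎
  where
  x y y′ : ℕ
  x = hz k (suc q)
  y = hz k q
  y′ = hz (suc k) q
  collect : ∀ k q y y′ →
    2 * (q * y′) + (2 + k) * (1 + k) * y + (2 + k) * y′ ≡ 2 * (q * y′) + (2 + k) * (y′ + (1 + k) * y)
  collect = solve-∀
  factor : ∀ k q s y′ → 2 * (q * y′) + (2 + k) * (q * s) ≡ q * (y′ + (2 + k) * s + y′)
  factor = solve-∀

hz-difference zero q = expand q
  where
  expand : ∀ q → 2 * (suc q * suc q) ≡ 2 * (q * q) + (2 + 0) * (suc q + q)
  expand = solve-∀
hz-difference (suc k) q = begin
  2 * (suc q * x′) + (2 + k) * (1 + k) * x
    ≡⟨ cong (λ x′ → 2 * (suc q * x′) + (2 + k) * (1 + k) * x) (hz-difference k q) ⟩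
  2 * (suc q * (y′ + (2 + k) * (x + y))) + (2 + k) * (1 + k) * x
    ≡⟨ isolate k q x y y′ ⟩
  rest + 2 * (2 + k) * (q * (x + y))
    ≡⟨ cong (λ s → rest + 2 * (2 + k) * s) (hz-sum k q) ⟨
  rest + 2 * (2 + k) * (y′ + (1 + k) * y)
    ≡⟨ regroup k q x y y′ ⟩
  2 * (q * y′) + (2 + k) * (1 + k) * y + (3 + k) * (y′ + (2 + k) * (x + y) + y′)
    ≡⟨ cong (λ x′ → 2 * (q * y′) + (2 + k) * (1 + k) * y + (3 + k) * (x′ + y′)) (hz-difference k q) ⟨
  2 * (q * y′) + (2 + k) * (1 + k) * y + (3 + k) * (x′ + y′) ∎
  where
  x y x′ y′ rest : ℕ
  x = hz k (suc q)
  y = hz k q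
  x′ = hz (suc k) (suc q)
  y′ = hz (suc k) q
  rest = 2 * (suc q * y′) + 2 * (2 + k) * (x + y) + (2 + k) * (1 + k) * x
  isolate : ∀ k q x y y′ → 2 * (suc q * (y′ + (2 + k) * (x + y))) + (2 + k) * (1 + k) * x ≡
    2 * (suc q * y′) + 2 * (2 + k) * (x + y) + (2 + k) * (1 + k) * x + 2 * (2 + k) * (q * (x + y))
  isolate = solve-∀
  regroup : ∀ k q x y y′ →
    2 * (suc q * y′) + 2 * (2 + k) * (x + y) + (2 + k) * (1 + k) * x + 2 * (2 + k) * (y′ + (1 + k) * y) ≡
    2 * (q * y′) + (2 + k) * (1 + k) * y + (3 + k) * (y′ + (2 + k) * (x + y) + y′)
  regroup = solve-∀

hzCoeff : ℕ → ℕ → ℕ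
hzCoeff zero          c = 𝟙 (c ℕ.≟ 1)
hzCoeff (suc zero)    c = 2 * shift (hzCoeff zero) c
hzCoeff (suc (suc k)) c = 2 * shift (hzCoeff (suc k)) c + (2 + k) * (1 + k) * hzCoeff k c

eval-hzCoeff : ∀ k N → suc k < N → ∀ q → eval N (hzCoeff k) q ≡ hz k q
eval-hzCoeff zero N 1<N q = begin
  ∑[ c ∈ upTo N ] (q ^ c * 𝟙 (c ℕ.≟ 1))
    ≡⟨ ∑-cong (upTo N) (λ c → *-comm (q ^ c) _) ⟩
  ∑[ c ∈ upTo N ] (𝟙 (c ℕ.≟ 1) * q ^ c)
    ≡⟨ ∑-𝟙-unique (ℕ._≟ 1) (Uniq.upTo⁺ N) (∈-upTo⁺ 1<N) refl id (q ^_) ⟩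
  q ^ 1
    ≡⟨ *-identityʳ q ⟩
  q ∎
eval-hzCoeff (suc zero) (suc N) (s≤s 1<N) q = begin
  eval (suc N) (λ c → 2 * shift (hzCoeff zero) c) q  ≡⟨ eval-*ˡ (suc N) 2 (shift (hzCoeff zero)) q ⟩
  2 * eval (suc N) (shift (hzCoeff zero)) q          ≡⟨ cong (2 *_) (eval-shift N (hzCoeff zero) q) ⟩
  2 * (q * eval N (hzCoeff zero) q)                  ≡⟨ cong (λ x → 2 * (q * x)) (eval-hzCoeff zero N 1<N q) ⟩
  2 * (q * q)                                        ∎
eval-hzCoeff (suc (suc k)) (suc N) (s≤s 2+k<N) q = begin
  eval (suc N) (hzCoeff (2 + k)) q
    ≡⟨ eval-+ (suc N) (λ c → 2 * shift (hzCoeff (suc k)) c) (λ c → (2 + k) * (1 + k) * hzCoeff k c) q ⟩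
  eval (suc N) (λ c → 2 * shift (hzCoeff (suc k)) c) q
    + eval (suc N) (λ c → (2 + k) * (1 + k) * hzCoeff k c) q
    ≡⟨ cong₂ _+_ (eval-*ˡ (suc N) 2 (shift (hzCoeff (suc k))) q)
         (eval-*ˡ (suc N) ((2 + k) * (1 + k)) (hzCoeff k) q) ⟩
  2 * eval (suc N) (shift (hzCoeff (suc k))) q + (2 + k) * (1 + k) * eval (suc N) (hzCoeff k) q
    ≡⟨ cong (λ x → 2 * x + (2 + k) * (1 + k) * eval (suc N) (hzCoeff k) q)
         (eval-shift N (hzCoeff (suc k)) q) ⟩
  2 * (q * eval N (hzCoeff (suc k)) q) + (2 + k) * (1 + k) * eval (suc N) (hzCoeff k) q
    ≡⟨ cong₂ (λ x y → 2 * (q * x) + (2 + k) * (1 + k) * y)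
         (eval-hzCoeff (suc k) N 2+k<N q)
         (eval-hzCoeff k (suc N) (m≤n⇒m≤1+n (<-trans (n<1+n (suc k)) 2+k<N)) q) ⟩
  hz (2 + k) q ∎

hzCoeff-0 : ∀ k → hzCoeff k 0 ≡ 0
hzCoeff-0 zero          = refl
hzCoeff-0 (suc zero)    = refl
hzCoeff-0 (suc (suc k)) = trans (cong ((2 + k) * (1 + k) *_) (hzCoeff-0 k)) (*-zeroʳ ((2 + k) * (1 + k)))

combination≡0 : ∀ x y {a b} → a ≡ 0 → b ≡ 0 → x * a + y * b ≡ 0
combination≡0 x y refl refl = cong₂ _+_ (*-zeroʳ x) (*-zeroʳ y)

hzCoeff-even-even : ∀ r j → hzCoeff (r * 2) (j * 2) ≡ 0
hzCoeff-odd-odd   : ∀ r j → hzCoeff (1 + r * 2) (1 + j * 2) ≡ 0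

hzCoeff-even-even r       zero    = hzCoeff-0 (r * 2)
hzCoeff-even-even zero    (suc j) = refl
hzCoeff-even-even (suc r) (suc j) =
  combination≡0 2 ((2 + r * 2) * (1 + r * 2)) (hzCoeff-odd-odd r j) (hzCoeff-even-even r (suc j))

hzCoeff-odd-odd zero    j = cong (2 *_) (hzCoeff-even-even zero j)
hzCoeff-odd-odd (suc r) j =
  combination≡0 2 ((3 + r * 2) * (2 + r * 2)) (hzCoeff-even-even (suc r) j) (hzCoeff-odd-odd r j)

hzEven hzOdd : ℕ → ℕ → ℕ
hzEven r j = hzCoeff (r * 2) (1 + j * 2)
hzOdd  r j = hzCoeff (1 + r * 2) (2 + j * 2)

-- Log-concavity

record Combination (x y : ℕ) (a b c : ℕ → ℕ) : Set where
  field combines : ∀ j → c j ≡ x * a j + y * b j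

open Combination

-- The ratios a (j + 1) / a j are at most the ratios b (i + 1) / b i with i ≤ j; multiplied out,
-- this is linear in a and in b and needs no positivity.
record _⊑_ (a b : ℕ → ℕ) : Set where
  field ratio-≤ : ∀ {i j} → i ≤ j → a (suc j) * b i ≤ a j * b (suc i)

open _⊑_

infix 4 _⊑_

⊑-combineˡ : ∀ {x y a b c d} → Combination x y a b c → a ⊑ d → b ⊑ d → c ⊑ d
⊑-combineˡ {x} {y} {a} {b} {c} {d} comb a⊑d b⊑d .ratio-≤ {i} {j} i≤j = subst₂ _≤_
  (combine (d i) (suc j)) (combine (d (suc i)) j)
  (+-mono-≤ (*-monoʳ-≤ x (ratio-≤ a⊑d i≤j)) (*-monoʳ-≤ y (ratio-≤ b⊑d i≤j)))
  where
  factor : ∀ a b d x y → x * (a * d) + y * (b * d) ≡ (x * a + y * b) * d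
  factor = solve-∀
  combine : ∀ dᵢ j → x * (a j * dᵢ) + y * (b j * dᵢ) ≡ c j * dᵢ
  combine dᵢ j = trans (factor (a j) (b j) dᵢ x y) (cong (_* dᵢ) (sym (combines comb j)))

⊑-combineʳ : ∀ {x y a b c d} → Combination x y b c d → a ⊑ b → a ⊑ c → a ⊑ d
⊑-combineʳ {x} {y} {a} {b} {c} {d} comb a⊑b a⊑c .ratio-≤ {i} {j} i≤j = subst₂ _≤_
  (combine (a (suc j)) i) (combine (a j) (suc i))
  (+-mono-≤ (*-monoʳ-≤ x (ratio-≤ a⊑b i≤j)) (*-monoʳ-≤ y (ratio-≤ a⊑c i≤j)))
  where
  factor : ∀ a b c x y → x * (a * b) + y * (a * c) ≡ a * (x * b + y * c)
  factor = solve-∀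
  combine : ∀ aⱼ i → x * (aⱼ * b i) + y * (aⱼ * c i) ≡ aⱼ * d i
  combine aⱼ i = trans (factor aⱼ (b i) (c i) x y) (cong (aⱼ *_) (sym (combines comb i)))

⊑-shiftʳ : ∀ {a b} → a ⊑ b → a ⊑ shift b
⊑-shiftʳ {a} a⊑b .ratio-≤ {zero}  {j} _     = ≤-trans (≤-reflexive (*-zeroʳ (a (suc j)))) z≤n
⊑-shiftʳ     a⊑b .ratio-≤ {suc i}     1+i≤j = ratio-≤ a⊑b (<⇒≤ 1+i≤j)

⊑-shift : ∀ {a b} → a ⊑ b → shift a ⊑ shift b
⊑-shift {a} a⊑b .ratio-≤ {zero}  {j}     _         = ≤-trans (≤-reflexive (*-zeroʳ (a j))) z≤n
⊑-shift     a⊑b .ratio-≤ {suc i} {suc j} (s≤s i≤j) = ratio-≤ a⊑b i≤j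

⊑-shift⇒⊑-refl : ∀ {a} → a ⊑ shift a → a ⊑ a
⊑-shift⇒⊑-refl {a} a⊑shift-a .ratio-≤ {i} {j} i≤j with m≤n⇒m<n∨m≡n i≤j
... | inj₁ i<j  = ratio-≤ a⊑shift-a i<j
... | inj₂ refl = ≤-reflexive (*-comm (a (suc i)) (a i))

⊑-shift⇒LogConcave : ∀ {a} → a ⊑ shift a → LogConcave a
⊑-shift⇒LogConcave {a} a⊑shift-a k =
  ≤-trans (≤-reflexive (*-comm (a k) (a (2 + k)))) (ratio-≤ a⊑shift-a (≤-refl {suc k}))

Combination-shift : ∀ {x y a b c} →
  Combination x y a b c → Combination x y (shift a) (shift b) (shift c)
Combination-shift {x} {y} comb .combines zero    = sym (combination≡0 x y refl refl)
Combination-shift         comb .combines (suc j) = combines comb j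

record Interlaced (e o : ℕ → ℕ) : Set where
  field
    o⊑e       : o ⊑ e
    e⊑shift-o : e ⊑ shift o
    e⊑shift-e : e ⊑ shift e
    o⊑shift-o : o ⊑ shift o

interlaced-step : ∀ {x y x′ y′ e o e′ o′} →
  Combination x y (shift o) e e′ → Combination x′ y′ e′ o o′ → Interlaced e o → Interlaced e′ o′
interlaced-step {e = e} {o} {e′} {o′} e′-comb o′-comb interlaced = record
  { o⊑e       = ⊑-combineˡ o′-comb (⊑-shift⇒⊑-refl e′⊑shift-e′) o⊑e′
  ; e⊑shift-o = e′⊑shift-o′
  ; e⊑shift-e = e′⊑shift-e′
  ; o⊑shift-o = ⊑-combineˡ o′-comb e′⊑shift-o′
      (⊑-combineʳ (Combination-shift o′-comb) (⊑-shiftʳ o⊑e′) o⊑shift-o)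
  }
  where
  open Interlaced interlaced
  o⊑e′ : o ⊑ e′
  o⊑e′ = ⊑-combineʳ e′-comb o⊑shift-o o⊑e
  e′⊑shift-o : e′ ⊑ shift o
  e′⊑shift-o = ⊑-combineˡ e′-comb (⊑-shift (⊑-shift⇒⊑-refl o⊑shift-o)) e⊑shift-o
  e′⊑shift-e′ : e′ ⊑ shift e′
  e′⊑shift-e′ = ⊑-combineˡ e′-comb (⊑-shift o⊑e′)
    (⊑-combineʳ (Combination-shift e′-comb) (⊑-shiftʳ e⊑shift-o) e⊑shift-e)
  e′⊑shift-o′ : e′ ⊑ shift o′
  e′⊑shift-o′ = ⊑-combineʳ (Combination-shift o′-comb) e′⊑shift-e′ e′⊑shift-o

hzEven-suc : ∀ r → Combination 2 ((2 + r * 2) * (1 + r * 2)) (shift (hzOdd r)) (hzEven r) (hzEven (suc r))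
hzEven-suc r .combines zero    =
  cong (λ x → 2 * x + (2 + r * 2) * (1 + r * 2) * hzEven r 0) (hzCoeff-0 (1 + r * 2))
hzEven-suc r .combines (suc j) = refl

hzOdd-suc : ∀ r → Combination 2 ((3 + r * 2) * (2 + r * 2)) (hzEven (suc r)) (hzOdd r) (hzOdd (suc r))
hzOdd-suc r .combines j = refl

interlaced : ∀ r → Interlaced (hzEven r) (hzOdd r)
interlaced zero = record
  { o⊑e       = record { ratio-≤ = λ _ → z≤n }
  ; e⊑shift-o = record { ratio-≤ = λ _ → z≤n }
  ; e⊑shift-e = record { ratio-≤ = λ _ → z≤n }
  ; o⊑shift-o = record { ratio-≤ = λ _ → z≤n }
  }
interlaced (suc r) = interlaced-step (hzEven-suc r) (hzOdd-suc r) (interlaced r)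

LogConcave-cong : ∀ {a b} → a ≗ b → LogConcave b → LogConcave a
LogConcave-cong a≗b b-lc k = subst₂ _≤_
  (sym (cong₂ _*_ (a≗b k) (a≗b (2 + k)))) (sym (cong₂ _*_ (a≗b (1 + k)) (a≗b (1 + k)))) (b-lc k)

LogConcave-scale : ∀ {a b} x y → .{{NonZero x}} → (∀ j → x * a j ≡ y * b j) →
  LogConcave b → LogConcave a
LogConcave-scale {a} {b} x y xa≡yb b-lc k = *-cancelˡ-≤ (x * x) {{m*n≢0 x x}}
  (subst₂ _≤_ (rescale k (2 + k)) (rescale (1 + k) (1 + k)) (*-monoʳ-≤ (y * y) (b-lc k)))
  where
  rescale : ∀ i j → y * y * (b i * b j) ≡ x * x * (a i * a j)
  rescale i j = begin
    y * y * (b i * b j)       ≡⟨ *-interchange y y (b i) (b j) ⟩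
    (y * b i) * (y * b j)     ≡⟨ cong₂ _*_ (xa≡yb i) (xa≡yb j) ⟨
    (x * a i) * (x * a j)     ≡⟨ *-interchange x x (a i) (a j) ⟨
    x * x * (a i * a j)       ∎

-- The exponent ⌊(c − 1)/2⌋ merges the coefficients of q^(2j+1) and q^(2j+2), one of which vanishes.
hzPair : ℕ → ℕ → ℕ
hzPair k j = hzCoeff k (1 + j * 2) + hzCoeff k (2 + j * 2)

hzPair-logConcave : ∀ k → LogConcave (hzPair k)
hzPair-logConcave k with parity k
  where
  parity : ∀ k → ∃ λ r → k ≡ r * 2 ⊎ k ≡ 1 + r * 2
  parity zero    = 0 , inj₁ refl
  parity (suc k) with parity k
  ... | r , inj₁ refl = r , inj₂ refl
  ... | r , inj₂ refl = suc r , inj₁ refl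
... | r , inj₁ refl = LogConcave-cong
  (λ j → trans (cong (hzEven r j +_) (hzCoeff-even-even r (suc j))) (+-identityʳ (hzEven r j)))
  (⊑-shift⇒LogConcave (Interlaced.e⊑shift-e (interlaced r)))
... | r , inj₂ refl = LogConcave-cong
  (λ j → cong (_+ hzOdd r j) (hzCoeff-odd-odd r j))
  (⊑-shift⇒LogConcave (Interlaced.o⊑shift-o (interlaced r)))

-- Involutions

data DisjointTranspositions : ℕ → Map n → Set where
  none : {π : Map n} → π ≗ id → DisjointTranspositions 0 π
  add  : {π ρ : Map n} {a b : Fin n} → DisjointTranspositions k ρ → Involutive _≡_ ρ →
    a ≢ b → ρ a ≡ a → ρ b ≡ b → π ≗ transpose a b ∘ ρ → DisjointTranspositions (suc k) π

module Untranspose (π : Map n) (π-involutive : Involutive _≡_ π) (a : Fin n) where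

  ρ : Map n
  ρ = transpose a (π a) ∘ π

  ρ-a : ρ a ≡ a
  ρ-a = transpose-right a (π a)

  ρ-πa : ρ (π a) ≡ π a
  ρ-πa = trans (cong (transpose a (π a)) (π-involutive a)) (transpose-left a (π a))

  π≢a : ∀ {x} → x ≢ π a → π x ≢ a
  π≢a x≢πa πx≡a = x≢πa (trans (sym (π-involutive _)) (cong π πx≡a))

  π≢πa : ∀ {x} → x ≢ a → π x ≢ π a
  π≢πa x≢a = x≢a ∘ involutive⇒injective π π-involutive

  ρ-other : ∀ {x} → x ≢ a → x ≢ π a → ρ x ≡ π x
  ρ-other x≢a x≢πa = transpose-other (π≢a x≢πa) (π≢πa x≢a)

  ρ-fixes : ∀ {x} → π x ≡ x → ρ x ≡ x
  ρ-fixes {x} πx≡x with position a (π a) x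
  ... | left refl      = ρ-a
  ... | right refl     = ρ-πa
  ... | other x≢a x≢πa = trans (ρ-other x≢a x≢πa) πx≡x

  ρ-involutive : Involutive _≡_ ρ
  ρ-involutive x with position a (π a) x
  ... | left refl      = trans (cong ρ ρ-a) ρ-a
  ... | right refl     = trans (cong ρ ρ-πa) ρ-πa
  ... | other x≢a x≢πa = begin
    ρ (ρ x)  ≡⟨ cong ρ (ρ-other x≢a x≢πa) ⟩
    ρ (π x)  ≡⟨ ρ-other (π≢a x≢πa) (π≢πa x≢a) ⟩
    π (π x)  ≡⟨ π-involutive x ⟩
    x        ∎

involutive⇒transpositions : (π : Map n) → Involutive _≡_ π → ∃ λ k → DisjointTranspositions k π
involutive⇒transpositions {n} π π-involutive =
  moving-only (allFin n) π π-involutive (λ x x∉ → contradiction (∈-allFin x) x∉)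
  where
  moving-only : ∀ xs (π : Map n) → Involutive _≡_ π → (∀ x → x ∉ xs → π x ≡ x) →
    ∃ λ k → DisjointTranspositions k π
  moving-only []       π π-involutive π-fixes = 0 , none (λ x → π-fixes x (λ ()))
  moving-only (a ∷ xs) π π-involutive π-fixes with π a ≟ a
  ... | yes πa≡a = moving-only xs π π-involutive π-fixes-∉xs
    where
    π-fixes-∉xs : ∀ x → x ∉ xs → π x ≡ x
    π-fixes-∉xs x x∉xs with x ≟ a
    ... | yes refl = πa≡a
    ... | no x≢a   = π-fixes x (x∉xs ∘ ∈-tail x≢a)
  ... | no πa≢a = let (k , ts) = moving-only xs ρ ρ-involutive ρ-fixes-∉xs in
      suc k , add ts ρ-involutive (πa≢a ∘ sym) ρ-a ρ-πa (λ x → sym (transpose-involutive a (π a) (π x)))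
    where
    open Untranspose π π-involutive a
    ρ-fixes-∉xs : ∀ x → x ∉ xs → ρ x ≡ x
    ρ-fixes-∉xs x x∉xs with x ≟ a
    ... | yes refl = ρ-a
    ... | no x≢a   = ρ-fixes (π-fixes x (x∉xs ∘ ∈-tail x≢a))

cycleSum-0 : (π : Map (suc m)) → cycleSum π 0 ≡ 0
cycleSum-0 {m} π = ∑-zero (fullCycles m) (λ _ → refl)

cycleSum-hz : {π : Map (suc m)} → DisjointTranspositions k π → ∀ q →
  suc k ! * cycleSum π q ≡ length (fullCycles m) * hz k q
cycleSum-hz {m} {π = π} (none π≗id) q = begin
  1 * cycleSum π q             ≡⟨ *-identityˡ (cycleSum π q) ⟩
  cycleSum π q                 ≡⟨ cycleSum-cong π≗id q ⟩
  cycleSum {m} id q            ≡⟨ cycleSum-id m q ⟩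
  length (fullCycles m) * q    ∎
cycleSum-hz {m} {suc k} {π} (add {ρ = ρ} {a} {b} ts ρ-involutive a≢b ρa≡a ρb≡b π≗τρ) q =
  trans (cong ((2 + k) ! *_) (cycleSum-cong π≗τρ q)) (cycleSum-τρ q)
  where
  #ζ : ℕ
  #ζ = length (fullCycles m)
  τρ : Map (suc m)
  τρ = transpose a b ∘ ρ

  cycleSum-τρ : ∀ q → (2 + k) ! * cycleSum τρ q ≡ #ζ * hz (suc k) q
  cycleSum-τρ zero = begin
    (2 + k) ! * cycleSum τρ 0  ≡⟨ trans (cong ((2 + k) ! *_) (cycleSum-0 τρ)) (*-zeroʳ ((2 + k) !)) ⟩
    0                          ≡⟨ trans (cong (#ζ *_) (hz-0 (suc k))) (*-zeroʳ #ζ) ⟨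
    #ζ * hz (suc k) 0          ∎
  cycleSum-τρ (suc q) = begin
    (2 + k) ! * cycleSum τρ (suc q)
      ≡⟨ cong ((2 + k) ! *_)
           (cycleSum-recurrence (involutive⇒injective ρ ρ-involutive) a≢b ρa≡a ρb≡b q) ⟩
    (2 + k) ! * (cycleSum τρ q + (cycleSum ρ (suc q) + cycleSum ρ q))
      ≡⟨ distribute (2 + k) (suc k !) (cycleSum τρ q) (cycleSum ρ (suc q)) (cycleSum ρ q) ⟩
    (2 + k) ! * cycleSum τρ q + (2 + k) * (suc k ! * cycleSum ρ (suc q) + suc k ! * cycleSum ρ q)
      ≡⟨ cong₂ _+_ (cycleSum-τρ q)
           (cong₂ (λ x y → (2 + k) * (x + y)) (cycleSum-hz ts (suc q)) (cycleSum-hz ts q)) ⟩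
    #ζ * hz (suc k) q + (2 + k) * (#ζ * hz k (suc q) + #ζ * hz k q)
      ≡⟨ factor (2 + k) #ζ (hz (suc k) q) (hz k (suc q)) (hz k q) ⟩
    #ζ * (hz (suc k) q + (2 + k) * (hz k (suc q) + hz k q))
      ≡⟨ cong (#ζ *_) (hz-difference k q) ⟨
    #ζ * hz (suc k) (suc q) ∎
    where
    distribute : ∀ c f x y z → c * f * (x + (y + z)) ≡ c * f * x + c * (f * y + f * z)
    distribute = solve-∀
    factor : ∀ c l x y z → l * x + c * (l * y + l * z) ≡ l * (x + c * (y + z))
    factor = solve-∀

cycleCoeff : Map (suc m) → ℕ → ℕ
cycleCoeff {m} π c = ∑[ ζ ∈ fullCycles m ] 𝟙 (cycles (ζ · π) ℕ.≟ c)

eval-cycleCoeff : {π : Map (suc m)} → Injective _≡_ _≡_ π → ∀ N → suc m < N → ∀ q →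
  eval N (cycleCoeff π) q ≡ cycleSum π q
eval-cycleCoeff {m} {π} π-injective N m<N q = begin
  eval N (cycleCoeff π) q
    ≡⟨ eval-∑-𝟙 N (fullCycles m) (λ ζ → cycles (ζ · π)) (λ ζ → ≤-<-trans (cycles-≤ (ζ · π)) m<N) q ⟩
  ∑[ ζ ∈ fullCycles m ] (q ^ cycles (ζ · π))
    ≡⟨ cycleSum-cycles π-injective q ⟨
  cycleSum π q ∎

cycleCoeff-hzCoeff : {π : Map (suc m)} → Injective _≡_ _≡_ π → DisjointTranspositions k π → ∀ c →
  suc k ! * cycleCoeff π c ≡ length (fullCycles m) * hzCoeff k c
cycleCoeff-hzCoeff {m} {k} {π} π-injective ts c =
  eval-injective bound (λ c → suc k ! * cycleCoeff π c) (λ c → #ζ * hzCoeff k c) equal-values c c<bound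
  where
  #ζ bound : ℕ
  #ζ = length (fullCycles m)
  bound = 2 + (m + (k + c))
  m<bound : suc m < bound
  m<bound = s≤s (s≤s (m≤m+n m (k + c)))
  k<bound : suc k < bound
  k<bound = s≤s (s≤s (≤-trans (m≤m+n k c) (m≤n+m (k + c) m)))
  c<bound : c < bound
  c<bound = s≤s (m≤n⇒m≤1+n (≤-trans (m≤n+m c k) (m≤n+m (k + c) m)))

  equal-values : ∀ q →
    eval bound (λ c → suc k ! * cycleCoeff π c) (suc q) ≡ eval bound (λ c → #ζ * hzCoeff k c) (suc q)
  equal-values q = begin
    eval bound (λ c → suc k ! * cycleCoeff π c) (suc q)
      ≡⟨ eval-*ˡ bound (suc k !) (cycleCoeff π) (suc q) ⟩
    suc k ! * eval bound (cycleCoeff π) (suc q)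
      ≡⟨ cong (suc k ! *_) (eval-cycleCoeff π-injective bound m<bound (suc q)) ⟩
    suc k ! * cycleSum π (suc q)
      ≡⟨ cycleSum-hz ts (suc q) ⟩
    #ζ * hz k (suc q)
      ≡⟨ cong (#ζ *_) (eval-hzCoeff k bound k<bound (suc q)) ⟨
    #ζ * eval bound (hzCoeff k) (suc q)
      ≡⟨ eval-*ˡ bound #ζ (hzCoeff k) (suc q) ⟨
    eval bound (λ c → #ζ * hzCoeff k c) (suc q) ∎

𝟙-halve : ∀ d j → 𝟙 (d / 2 ℕ.≟ j) ≡ 𝟙 (d ℕ.≟ j * 2) + 𝟙 (d ℕ.≟ 1 + j * 2)
𝟙-halve zero          zero    = refl
𝟙-halve zero          (suc j) = refl
𝟙-halve (suc zero)    zero    = refl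
𝟙-halve (suc zero)    (suc j) = refl
𝟙-halve (suc (suc d)) j       =
  trans (cong (λ h → 𝟙 (h ℕ.≟ j)) (m/n≡1+[m∸n]/n {2 + d} {2} (s≤s (s≤s z≤n)))) (suc-half j)
  where
  suc-half : ∀ j → 𝟙 (suc (d / 2) ℕ.≟ j) ≡ 𝟙 (2 + d ℕ.≟ j * 2) + 𝟙 (2 + d ℕ.≟ 1 + j * 2)
  suc-half zero    = refl
  suc-half (suc j) = 𝟙-halve d j

F-coeff-cycleCoeff : (π : Map (suc m)) → ∀ j →
  F-coeff π j ≡ cycleCoeff π (1 + j * 2) + cycleCoeff π (2 + j * 2)
F-coeff-cycleCoeff {m} π j = begin
  F-coeff π j
    ≡⟨ length-filter-𝟙 (λ ζ → expo ζ π ℕ.≟ j) (fullCycles m) ⟩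
  ∑[ ζ ∈ fullCycles m ] 𝟙 (expo ζ π ℕ.≟ j)
    ≡⟨ ∑-cong (fullCycles m) (λ ζ → exponent (cycles-positive (ζ · π))) ⟩
  ∑[ ζ ∈ fullCycles m ] (𝟙 (cycles (ζ · π) ℕ.≟ 1 + j * 2) + 𝟙 (cycles (ζ · π) ℕ.≟ 2 + j * 2))
    ≡⟨ ∑-+ (fullCycles m) _ _ ⟩
  cycleCoeff π (1 + j * 2) + cycleCoeff π (2 + j * 2) ∎
  where
  exponent : ∀ {c} → (∃ λ d → c ≡ suc d) →
    𝟙 ((c ∸ 1) / 2 ℕ.≟ j) ≡ 𝟙 (c ℕ.≟ 1 + j * 2) + 𝟙 (c ℕ.≟ 2 + j * 2)
  exponent (d , refl) = 𝟙-halve d j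

F-coeff-hzPair : {π : Map (suc m)} → Injective _≡_ _≡_ π → DisjointTranspositions k π → ∀ j →
  suc k ! * F-coeff π j ≡ length (fullCycles m) * hzPair k j
F-coeff-hzPair {m} {k} {π} π-injective ts j = begin
  suc k ! * F-coeff π j
    ≡⟨ cong (suc k ! *_) (F-coeff-cycleCoeff π j) ⟩
  suc k ! * (cycleCoeff π (1 + j * 2) + cycleCoeff π (2 + j * 2))
    ≡⟨ *-distribˡ-+ (suc k !) (cycleCoeff π (1 + j * 2)) (cycleCoeff π (2 + j * 2)) ⟩
  suc k ! * cycleCoeff π (1 + j * 2) + suc k ! * cycleCoeff π (2 + j * 2)
    ≡⟨ cong₂ _+_ (cycleCoeff-hzCoeff π-injective ts (1 + j * 2))
         (cycleCoeff-hzCoeff π-injective ts (2 + j * 2)) ⟩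
  length (fullCycles m) * hzCoeff k (1 + j * 2) + length (fullCycles m) * hzCoeff k (2 + j * 2)
    ≡⟨ *-distribˡ-+ (length (fullCycles m)) (hzCoeff k (1 + j * 2)) (hzCoeff k (2 + j * 2)) ⟨
  length (fullCycles m) * hzPair k j ∎

theorem2p3 : (m : ℕ) (π : Fin (suc m) → Fin (suc m)) →
    (∀ x → π (π x) ≡ x) →
    LogConcave (F-coeff π)
theorem2p3 m π π-involutive with k , ts ← involutive⇒transpositions π π-involutive =
  LogConcave-scale {F-coeff π} {hzPair k} (suc k !) (length (fullCycles m)) {{suc k !≢0}}
    (F-coeff-hzPair (involutive⇒injective π π-involutive) ts) (hzPair-logConcave k)
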